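{- $\rho\tau(K_9, o(\mathbf{Q}(3,n))) \le 3/10$. That is, for every $\gamma>0$ there is $\delta>0$ such that every $n$-vertex $K_9$-free graph $G$ with $\alpha(G)\le \delta\,\mathbf{Q}(3,n)$ satisfies $e(G)\le (3/10+\gamma)n^2$ for all sufficiently large $n$.
   Context: For a graph $H$ and a function $f(n)$, the Ramsey–Turán number $\mathbf{RT}(n,H,f(n))$ is the maximum number of edges in an $n$-vertex $H$-free graph with independence number at most $f(n)$. Let $\overline{\rho\tau}(H,f)=\limsup_{n\to\infty}\mathbf{RT}(n,H,f(n))/n^2$ and $\underline{\rho\tau}(H,f)=\liminf_{n\to\infty}\mathbf{RT}(n,H,f(n))/n^2$; when they coincide, their common value is $\rho\tau(H,f)$. Further $\rho\tau(H,o(f)) := \lim_{\delta\to 0}\rho\tau(H,\delta f)$; an upper bound $\rho\tau(H,o(f))\le c$ means $\lim_{\delta\to0}\overline{\rho\tau}(H,\delta f)\le c$. The inverse Ramsey number $\mathbf{Q}(t,n)$ is the minimum independence number of a $K_t$-free graph on $n$ vertices. $\alpha(G)$ is the independence number and $e(G)$ the number of edges of $G$. -}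

module Defs where

open import Data.Nat using (ℕ; zero; suc; _⊔_; _<ᵇ_)
open import Data.Bool using (Bool; true; false; _∧_; not; if_then_else_)
open import Data.Fin using (Fin; toℕ)
open import Data.Fin.Subset using (Subset; ∣_∣)
open import Data.Vec using ([]; _∷_; lookup)
open import Data.List using (List; []; _∷_; map; _++_; foldr; allFin; cartesianProduct)
open import Data.Bool.ListAction using (and)
open import Data.Product using (_×_; _,_; Σ; ∃; ∃-syntax)
open import Relation.Binary.PropositionalEquality using (_≡_; _≢_)
open import Relation.Nullary using (¬_)
open import Function.Definitions using (Injective)

record Graph (n : ℕ) : Set where
  field
    adj    : Fin n → Fin n → Bool
    sym    : ∀ i j → adj i j ≡ adj j i
    irrefl : ∀ i → adj i i ≡ false
open Graph public

pairs : (n : ℕ) → List (Fin n × Fin n)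
pairs n = cartesianProduct (allFin n) (allFin n)

countB : {A : Set} → (A → Bool) → List A → ℕ
countB p = foldr (λ x k → if p x then suc k else k) 0

edges : {n : ℕ} → Graph n → ℕ
edges {n} G = countB (λ { (i , j) → (toℕ i <ᵇ toℕ j) ∧ adj G i j }) (pairs n)

allSubsets : (n : ℕ) → List (Subset n)
allSubsets zero = [] ∷ []
allSubsets (suc n) = map (true ∷_) (allSubsets n) ++ map (false ∷_) (allSubsets n)

isIndependent : {n : ℕ} → Graph n → Subset n → Bool
isIndependent {n} G S =
  and (map (λ { (i , j) → not (lookup S i ∧ lookup S j ∧ adj G i j) }) (pairs n))

indepNumber : {n : ℕ} → Graph n → ℕ
indepNumber {n} G =
  foldr (λ S m → (if isIndependent G S then ∣ S ∣ else 0) ⊔ m) 0 (allSubsets n)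

HasClique : {n : ℕ} → (t : ℕ) → Graph n → Set
HasClique {n} t G =
  Σ (Fin t → Fin n) λ f →
    Injective _≡_ _≡_ f × (∀ (a b : Fin t) → a ≢ b → adj G (f a) (f b) ≡ true)

KFree : {n : ℕ} → (t : ℕ) → Graph n → Set
KFree t G = ¬ HasClique t G

IsInverseRamsey : (t n q : ℕ) → Set
IsInverseRamsey t n q =
  (∃[ H ] (KFree t H × indepNumber {n} H ≡ q)) ×
  (∀ (H : Graph n) → KFree t H → q ≤ℕ indepNumber H)
  where open import Data.Nat renaming (_≤_ to _≤ℕ_)

{-# OPTIONS --safe #-}

-- The hypothesis α(G) ≤ δ Q(3,n) gives two facts. Every linear-sized vertex set contains a triangle,
-- since otherwise disjoint copies of it would beat Q(3,n). And Q(3,n) ≤ n^(1-c), by an explicit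
-- construction, so dependent random choice finds, in a linear-sized set of vertices each having a
-- positive fraction of its possible neighbours in Y₁, Y₂, Y₃, an edge whose ends have a positive
-- fraction of common neighbours in every Yⱼ.
--
-- Consider M-tuples of vertex weights X : Fin n → ℕ, starting from M copies of the constant weight 1,
-- and call a pair of a tuple absent, light or heavy according to its density being close to 0, at most
-- about 2/3, or larger. Four pairwise present weights would give K₉ as 2 + 2 + 2 + 3 vertices, and three
-- pairwise heavy ones as 3 + 3 + 3, unless the construction is stopped by weights A ≤ X, B ≤ Y whose
-- density falls below that of (X , Y). In that case one of the splittings 2X = A + (2X − A),
-- 2Y = B + (2Y − B) increases the energy Σ (M d + d²) by a constant, by convexity of d². The energy is
-- bounded, so some tuple with average density still above 3/5 has neither obstruction, which
-- contradicts the weighted Turán bound (attained by part sizes 4 : 3 : 3 with one light pair).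
module Submission where

-- A tuple of fixed length takes the place of a regularity partition: an obstruction concerns a
-- single pair, so a split may keep one of its two pieces and discard the other. Squared densities
-- alone would supply the gain, but raising them could destroy the density that the argument starts
-- from. The linear part prevents this: squares contribute at most 1 per pair, so with the factor M
-- in front of d an increase of the energy lowers the average density by at most 1/M. The second
-- piece is 2X - A rather than X - A because it dominates X, hence stays large even when A is nearly
-- X.
--
-- The two obstructions reflect two prices of common neighbours. An edge keeps them at any positive
-- density, but only through dependent random choice, that is, because Q(3,n) is polynomially
-- smaller than n. A triangle keeps them for free above density 2/3, since three sets of density
-- above 2/3 always meet. The last weight has to leave no neighbours, so it gives a triangle in both
-- cases. Densities near the thresholds cost O(1/M), and every constant depends on M alone.

module Combinatorics where

  open import Defs hiding (sym)
  open import Data.Nat using (ℕ; zero; suc; _+_; _*_; _∸_; _^_; _≤_; _<_; _≥_; z≤n; s≤s; _⊔_; NonZero; >-nonZero; _≤?_; s≤s⁻¹)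
  open import Data.Nat.Properties
  open import Data.Nat.Solver using (module +-*-Solver)
  open import Data.Bool as Bool using (Bool; true; false; _∧_; _∨_; not; if_then_else_)
  open import Data.Bool.Properties using (∧-zeroʳ; ∧-identityʳ)
  open import Data.Fin.Patterns
  open import Data.Fin using (Fin; zero; suc; toℕ; inject≤; remQuot; combine; _↑ˡ_; _↑ʳ_)
  import Data.Fin.Properties as Fin
  open import Data.Fin.Subset using (Subset; ∣_∣)
  open import Data.Vec as Vec using ([]; _∷_; lookup; tabulate)
  import Data.Vec.Properties as Vec
  open import Data.List as List using (List; []; _∷_; foldr; _++_; length)
  open import Data.List.Membership.Propositional using (_∈_)
  open import Data.List.Membership.Propositional.Properties using (∈-++⁺ˡ; ∈-++⁺ʳ; ∈-map⁺; ∈-cartesianProduct⁺; ∈-allFin; ∈-lookup)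
  open import Data.List.Relation.Unary.Any as Any using (Any; here; there)
  open import Data.List.Relation.Unary.All as All using (All; []; _∷_)
  open import Data.List.Relation.Unary.All.Properties using (¬All⇒Any¬)
  open import Data.Bool.ListAction using (and)
  import Data.Nat.ListAction as ListAction
  open import Data.Product using (_×_; _,_; Σ; ∃-syntax; proj₁; proj₂; uncurry)
  open import Data.Sum using (_⊎_; inj₁; inj₂)
  open import Data.Empty using (⊥; ⊥-elim)
  open import Relation.Binary.PropositionalEquality
  open import Relation.Nullary using (¬_; Dec; yes; no; does)
  open import Relation.Binary.Definitions using (tri<; tri≈; tri>)
  open import Relation.Nullary.Decidable using (toWitness; dec-true; _×-dec_; _→-dec_; ¬?)
  open import Function using (_∘_; id; Injective)
  open import Algebra.Properties.Semiring.Sum +-*-semiring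
    using (sum; sum-cong-≗; ∑-distrib-+; ∑-comm; *-distribˡ-sum; *-distribʳ-sum; sum-replicate-zero)
  open import Data.Nat.DivMod using (_/_; _%_; m≡m%n+[m/n]*n; m%n<n; m*n/n≡m; /-monoˡ-≤)
  open import Data.List.Properties using (length-map; length-++)
  open import Data.List.Relation.Unary.AllPairs as AllPairs using (AllPairs; []; _∷_)
  import Data.List.Relation.Unary.AllPairs.Properties as AllPairs
  import Data.List.Relation.Unary.All.Properties as All
  import Data.List.Relation.Unary.Any.Properties as Any

  private variable
    m n k : ℕ

  -- Sums and independent sets

  𝟙 : Bool → ℕ
  𝟙 true  = 1
  𝟙 false = 0

  𝟙-∧ : ∀ x y → 𝟙 (x ∧ y) ≡ 𝟙 x * 𝟙 y
  𝟙-∧ true  y = sym (+-identityʳ _)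
  𝟙-∧ false y = refl

  𝟙≤1 : ∀ x → 𝟙 x ≤ 1
  𝟙≤1 true  = ≤-refl
  𝟙≤1 false = z≤n

  ∑-mono : {f g : Fin n → ℕ} → (∀ i → f i ≤ g i) → sum f ≤ sum g
  ∑-mono {zero}  h = z≤n
  ∑-mono {suc n} h = +-mono-≤ (h zero) (∑-mono (h ∘ suc))

  term≤∑ : (f : Fin n → ℕ) (i : Fin n) → f i ≤ sum f
  term≤∑ f zero    = m≤m+n _ _
  term≤∑ f (suc i) = ≤-trans (term≤∑ (f ∘ suc) i) (m≤n+m _ _)

  ∑-const : ∀ n c → sum {n} (λ _ → c) ≡ n * c
  ∑-const zero    c = refl
  ∑-const (suc n) c = cong (c +_) (∑-const n c)

  ∑-≤-const : {f : Fin n → ℕ} (c : ℕ) → (∀ i → f i ≤ c) → sum f ≤ n * c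
  ∑-≤-const {n} c h = ≤-trans (∑-mono h) (≤-reflexive (∑-const n c))

  ∑-+ : {m n : ℕ} (f : Fin (m + n) → ℕ) → sum f ≡ sum (λ i → f (i ↑ˡ n)) + sum (λ i → f (m ↑ʳ i))
  ∑-+ {zero}  f = refl
  ∑-+ {suc m} f = trans (cong (f zero +_) (∑-+ {m} (f ∘ suc))) (sym (+-assoc (f zero) _ _))

  ∑-combine : {m n : ℕ} (f : Fin (m * n) → ℕ) → sum f ≡ sum {m} (λ i → sum {n} (λ j → f (combine i j)))
  ∑-combine {zero}      f = refl
  ∑-combine {suc m} {n} f = trans (∑-+ {n} f) (cong (sum (λ i → f (i ↑ˡ (m * n))) +_) (∑-combine {m} (f ∘ (n ↑ʳ_))))

  ∑-at-most-one : (U : Fin n → Bool) → (∀ i j → U i ≡ true → U j ≡ true → i ≡ j) → sum (𝟙 ∘ U) ≤ 1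
  ∑-at-most-one {zero} U h = z≤n
  ∑-at-most-one {suc n} U h with U zero in e
  ... | false = ∑-at-most-one (U ∘ suc) (λ i j p q → Fin.suc-injective (h _ _ p q))
  ... | true  = s≤s (≤-trans (∑-mono {g = λ _ → 0} none) (≤-reflexive (sum-replicate-zero n)))
    where
    none : ∀ i → 𝟙 (U (suc i)) ≤ 0
    none i with U (suc i) in e′
    ... | false = z≤n
    ... | true with () ← h _ _ e e′

  card : (Fin n → Bool) → ℕ
  card U = sum (𝟙 ∘ U)

  ∧-true : ∀ {x y} → (x ∧ y) ≡ true → x ≡ true × y ≡ true
  ∧-true {true} {true} _ = refl , refl

  ≟-true : {i j : Fin n} → does (i Fin.≟ j) ≡ true → i ≡ j
  ≟-true {i = i} {j} e with i Fin.≟ j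
  ... | yes p = p

  ≟-refl : (i : Fin n) → does (i Fin.≟ i) ≡ true
  ≟-refl i with i Fin.≟ i
  ... | yes _ = refl
  ... | no ¬p = ⊥-elim (¬p refl)

  does-≟-sym : (i j : Fin n) → does (i Fin.≟ j) ≡ does (j Fin.≟ i)
  does-≟-sym i j with i Fin.≟ j | j Fin.≟ i
  ... | yes _ | yes _ = refl
  ... | no _  | no _  = refl
  ... | yes p | no ¬q = ⊥-elim (¬q (sym p))
  ... | no ¬p | yes q = ⊥-elim (¬p (sym q))

  ∑-≟ : (f : Fin n → ℕ) (i : Fin n) → sum (λ j → 𝟙 (does (i Fin.≟ j)) * f j) ≡ f i
  ∑-≟ {suc n} f zero    = trans (cong (1 * f zero +_) (sum-replicate-zero n)) (trans (+-identityʳ _) (*-identityˡ _))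
  ∑-≟ {suc n} f (suc i) = ∑-≟ (f ∘ suc) i

  card-injection : (U : Fin m → Bool) (V : Fin n → Bool) (φ : Fin m → Fin n) →
    (∀ i → U i ≡ true → V (φ i) ≡ true) →
    (∀ i j → U i ≡ true → U j ≡ true → φ i ≡ φ j → i ≡ j) → card U ≤ card V
  card-injection {m} {n} U V φ into inj = begin
    sum (λ i → 𝟙 (U i))                                             ≤⟨ ∑-mono fibre ⟩
    sum (λ i → sum (λ y → 𝟙 (U i ∧ does (φ i Fin.≟ y)) * 𝟙 (V y)))  ≡⟨ ∑-comm (λ i y → 𝟙 (U i ∧ does (φ i Fin.≟ y)) * 𝟙 (V y)) ⟩
    sum (λ y → sum (λ i → 𝟙 (U i ∧ does (φ i Fin.≟ y)) * 𝟙 (V y)))  ≡⟨ sum-cong-≗ (λ y → sym (*-distribʳ-sum (𝟙 (V y)) (λ i → 𝟙 (U i ∧ does (φ i Fin.≟ y))))) ⟩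
    sum (λ y → card (λ i → U i ∧ does (φ i Fin.≟ y)) * 𝟙 (V y))     ≤⟨ ∑-mono (λ y → *-monoˡ-≤ (𝟙 (V y)) (single y)) ⟩
    sum (λ y → 1 * 𝟙 (V y))                                         ≡⟨ sum-cong-≗ (λ y → *-identityˡ (𝟙 (V y))) ⟩
    sum (λ y → 𝟙 (V y))                                             ∎
    where
    open ≤-Reasoning
    single : ∀ y → card (λ i → U i ∧ does (φ i Fin.≟ y)) ≤ 1
    single y = ∑-at-most-one _ λ i j p q → let (a , b) = ∧-true p ; (c , d) = ∧-true q in
      inj i j a c (trans (≟-true b) (sym (≟-true d)))
    fibre : ∀ i → 𝟙 (U i) ≤ sum (λ y → 𝟙 (U i ∧ does (φ i Fin.≟ y)) * 𝟙 (V y))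
    fibre i with U i in e
    ... | false = z≤n
    ... | true  = ≤-reflexive (trans (cong 𝟙 (sym (into i e))) (sym (∑-≟ (𝟙 ∘ V) (φ i))))

  Independent : Graph n → (Fin n → Bool) → Set
  Independent G U = ∀ u v → U u ≡ true → U v ≡ true → adj G u v ≡ false

  ∣tabulate∣ : (U : Fin n → Bool) → ∣ tabulate U ∣ ≡ card U
  ∣tabulate∣ {zero} U = refl
  ∣tabulate∣ {suc n} U with U zero
  ... | true  = cong suc (∣tabulate∣ (U ∘ suc))
  ... | false = ∣tabulate∣ (U ∘ suc)

  ∈-allSubsets : (S : Subset n) → S ∈ allSubsets n
  ∈-allSubsets [] = here refl
  ∈-allSubsets (true ∷ S)  = ∈-++⁺ˡ (∈-map⁺ (true ∷_) (∈-allSubsets S))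
  ∈-allSubsets {suc n} (false ∷ S) = ∈-++⁺ʳ (List.map (true ∷_) (allSubsets n)) (∈-map⁺ (false ∷_) (∈-allSubsets S))

  and-map⁺ : {A : Set} (p : A → Bool) (xs : List A) → (∀ x → p x ≡ true) → and (List.map p xs) ≡ true
  and-map⁺ p [] h = refl
  and-map⁺ p (x ∷ xs) h rewrite h x = and-map⁺ p xs h

  and-map⁻ : {A : Set} (p : A → Bool) {xs : List A} → and (List.map p xs) ≡ true → ∀ {x} → x ∈ xs → p x ≡ true
  and-map⁻ p e (here refl) = proj₁ (∧-true e)
  and-map⁻ p e (there i)   = and-map⁻ p (proj₂ (∧-true e)) i

  foldr-⊔-lower : {A : Set} (f : A → ℕ) {xs : List A} {x : A} → x ∈ xs → f x ≤ foldr (λ y m → f y ⊔ m) 0 xs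
  foldr-⊔-lower f (here refl) = m≤m⊔n _ _
  foldr-⊔-lower f (there i)   = ≤-trans (foldr-⊔-lower f i) (m≤n⊔m _ _)

  foldr-⊔-upper : {A : Set} (f : A → ℕ) (b : ℕ) (xs : List A) → (∀ x → f x ≤ b) → foldr (λ y m → f y ⊔ m) 0 xs ≤ b
  foldr-⊔-upper f b [] h = z≤n
  foldr-⊔-upper f b (x ∷ xs) h = ⊔-lub (h x) (foldr-⊔-upper f b xs h)

  independent-card≤ : (G : Graph n) (U : Fin n → Bool) → Independent G U → card U ≤ indepNumber G
  independent-card≤ {n} G U ind = ≤-trans (≤-reflexive value)
    (foldr-⊔-lower (λ S → if isIndependent G S then ∣ S ∣ else 0) (∈-allSubsets (tabulate U)))
    where
    test : ∀ i j → not (lookup (tabulate U) i ∧ lookup (tabulate U) j ∧ adj G i j) ≡ true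
    test i j rewrite Vec.lookup∘tabulate U i | Vec.lookup∘tabulate U j with U i in p | U j in q
    ... | false | _     = refl
    ... | true  | false = refl
    ... | true  | true  rewrite ind i j p q = refl
    isIndep : isIndependent G (tabulate U) ≡ true
    isIndep = and-map⁺ _ (pairs n) (λ { (i , j) → test i j })
    value : card U ≡ (if isIndependent G (tabulate U) then ∣ tabulate U ∣ else 0)
    value rewrite isIndep = sym (∣tabulate∣ U)

  indepNumber≤ : (G : Graph n) (b : ℕ) → (∀ U → Independent G U → card U ≤ b) → indepNumber G ≤ b
  indepNumber≤ {n} G b h = foldr-⊔-upper _ b (allSubsets n) bound
    where
    bound : ∀ S → (if isIndependent G S then ∣ S ∣ else 0) ≤ b
    bound S with isIndependent G S in e
    ... | false = z≤n
    ... | true  = subst (_≤ b) (trans (sym (∣tabulate∣ (lookup S))) (cong ∣_∣ (Vec.tabulate∘lookup S))) (h (lookup S) ind)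
      where
      ind : Independent G (lookup S)
      ind i j p q with and-map⁻ _ e (∈-cartesianProduct⁺ (∈-allFin i) (∈-allFin j))
      ... | t rewrite p | q with adj G i j
      ...   | false = refl
      ...   | true with () ← t

  TriangleFree : Graph n → Set
  TriangleFree G = ∀ u v w → adj G u v ≡ true → adj G v w ≡ true → adj G u w ≡ true → ⊥

  triangleFree⇒KFree : (G : Graph n) → TriangleFree G → KFree 3 G
  triangleFree⇒KFree G tf (f , _ , h) =
    tf (f zero) (f (suc zero)) (f (suc (suc zero))) (h _ _ λ ()) (h _ _ λ ()) (h _ _ λ ())

  -- An upper bound on the inverse Ramsey number, and triangles in large sets

  -- Four copies of a graph, placed on the path 0 - 1 - 2 - 3: within a copy and between neighbouring
  -- copies vertices are joined as in the graph, and copies 0 and 3 by the identity matching. This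
  -- multiplies the number of vertices by 4 but the independence number by at most 3.
  data Link : Set where
    inner identity none : Link

  link : Fin 4 → Fin 4 → Link
  link zero                   zero                   = inner
  link zero                   (suc zero)             = inner
  link zero                   (suc (suc zero))       = none
  link zero                   (suc (suc (suc zero))) = identity
  link (suc zero)             zero                   = inner
  link (suc zero)             (suc zero)             = inner
  link (suc zero)             (suc (suc zero))       = inner
  link (suc zero)             (suc (suc (suc zero))) = none
  link (suc (suc zero))       zero                   = none
  link (suc (suc zero))       (suc zero)             = inner
  link (suc (suc zero))       (suc (suc zero))       = inner
  link (suc (suc zero))       (suc (suc (suc zero))) = inner
  link (suc (suc (suc zero))) zero                   = identity
  link (suc (suc (suc zero))) (suc zero)             = none
  link (suc (suc (suc zero))) (suc (suc zero))       = inner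
  link (suc (suc (suc zero))) (suc (suc (suc zero))) = inner

  link-sym : ∀ i j → link i j ≡ link j i
  link-sym = toWitness {a? = Fin.all? λ i → Fin.all? λ j → link i j ≟ₗ link j i} _
    where
    _≟ₗ_ : (a b : Link) → Dec (a ≡ b)
    inner    ≟ₗ inner    = yes refl
    inner    ≟ₗ identity = no λ ()
    inner    ≟ₗ none     = no λ ()
    identity ≟ₗ inner    = no λ ()
    identity ≟ₗ identity = yes refl
    identity ≟ₗ none     = no λ ()
    none     ≟ₗ inner    = no λ ()
    none     ≟ₗ identity = no λ ()
    none     ≟ₗ none     = yes refl

  link-refl : ∀ i → link i i ≡ inner
  link-refl zero = refl
  link-refl (suc zero) = refl
  link-refl (suc (suc zero)) = refl
  link-refl (suc (suc (suc zero))) = refl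

  -- Three copies never carry the patterns (inner, inner, identity) and (identity, identity, identity).
  harmless : Link → Link → Link → Bool
  harmless none     _        _        = true
  harmless _        none     _        = true
  harmless _        _        none     = true
  harmless inner    inner    inner    = true
  harmless inner    identity identity = true
  harmless identity inner    identity = true
  harmless identity identity inner    = true
  harmless _        _        _        = false

  link-harmless : ∀ i j k → harmless (link i j) (link j k) (link i k) ≡ true
  link-harmless = toWitness {a? = Fin.all? λ i → Fin.all? λ j → Fin.all? λ k →
    harmless (link i j) (link j k) (link i k) Bool.≟ true} _

  module Fourfold (H : Graph m) where

    linked : Link → Fin m → Fin m → Bool
    linked inner    x y = adj H x y
    linked identity x y = does (x Fin.≟ y)
    linked none     x y = false

    linked-sym : ∀ l x y → linked l x y ≡ linked l y x
    linked-sym inner    x y = Graph.sym H x y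
    linked-sym none     x y = refl
    linked-sym identity x y = does-≟-sym x y

    pairAdj : Fin 4 × Fin m → Fin 4 × Fin m → Bool
    pairAdj (i , x) (j , y) = linked (link i j) x y

    pairAdj-sym : ∀ p q → pairAdj p q ≡ pairAdj q p
    pairAdj-sym (i , x) (j , y) = trans (linked-sym (link i j) x y) (cong (λ l → linked l y x) (link-sym i j))

    pairAdj-irrefl : ∀ p → pairAdj p p ≡ false
    pairAdj-irrefl (i , x) = trans (cong (λ l → linked l x x) (link-refl i)) (irrefl H x)

    fourfold : Graph (4 * m)
    fourfold = record
      { adj    = λ p q → pairAdj (remQuot m p) (remQuot m q)
      ; sym    = λ p q → pairAdj-sym (remQuot m p) (remQuot m q)
      ; irrefl = λ p → pairAdj-irrefl (remQuot m p)
      }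

    no-loop : ∀ {x y} → x ≡ y → adj H x y ≡ true → ⊥
    no-loop {x} refl e with () ← trans (sym e) (irrefl H x)

    linked-triangleFree : TriangleFree H → ∀ a b c {x y z} → harmless a b c ≡ true →
      linked a x y ≡ true → linked b y z ≡ true → linked c x z ≡ true → ⊥
    linked-triangleFree tf inner inner inner _ p q r = tf _ _ _ p q r
    linked-triangleFree tf inner identity identity {x} {y} {z} _ p q r =
      no-loop (trans (≟-true {i = x} {z} r) (sym (≟-true {i = y} {z} q))) p
    linked-triangleFree tf identity inner identity {x} {y} {z} _ p q r =
      no-loop (trans (sym (≟-true {i = x} {y} p)) (≟-true {i = x} {z} r)) q
    linked-triangleFree tf identity identity inner {x} {y} {z} _ p q r =
      no-loop (trans (≟-true {i = x} {y} p) (≟-true {i = y} {z} q)) r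

    fourfold-triangleFree : TriangleFree H → TriangleFree fourfold
    fourfold-triangleFree tf u v w =
      let (i , x) = remQuot m u ; (j , y) = remQuot m v ; (k , z) = remQuot m w in
      linked-triangleFree tf (link i j) (link j k) (link i k) (link-harmless i j k)

    -- If copy 3 is missing, charge copies 0, 1, 2 to the unions 01, 12, 23 in this order; if copy 0
    -- is missing, charge copies 1, 2, 3 to them.
    four-sets : ∀ a b c d → (a ∧ d) ≡ false →
      𝟙 a + (𝟙 b + (𝟙 c + (𝟙 d + 0))) ≤ 𝟙 (a ∨ b) + (𝟙 (b ∨ c) + 𝟙 (c ∨ d))
    four-sets true  true  true  false _ = ≤-refl
    four-sets true  true  false false _ = ≤-refl
    four-sets true  false true  false _ = n≤1+n _
    four-sets true  false false false _ = ≤-refl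
    four-sets false true  true  true  _ = ≤-refl
    four-sets false true  true  false _ = n≤1+n _
    four-sets false true  false true  _ = n≤1+n _
    four-sets false true  false false _ = n≤1+n _
    four-sets false false true  true  _ = ≤-refl
    four-sets false false true  false _ = n≤1+n _
    four-sets false false false true  _ = ≤-refl
    four-sets false false false false _ = z≤n

    -- The matching makes the traces on copies 0 and 3 disjoint. Neighbouring copies carry the
    -- adjacency of `H` both within and across, so the union of the traces on two of them is still
    -- independent in `H`. Three such unions cover the four traces with multiplicity.
    fourfold-independence : ∀ b → (∀ U → Independent H U → card U ≤ b) →
      ∀ U → Independent fourfold U → card U ≤ 3 * b
    fourfold-independence b bound U ind = begin
      card U                                                              ≡⟨ ∑-combine {4} {m} (𝟙 ∘ U) ⟩
      card (S 0F) + (card (S 1F) + (card (S 2F) + (card (S 3F) + 0)))     ≡⟨ assemble ⟨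
      sum (λ x → 𝟙 (S 0F x) + (𝟙 (S 1F x) + (𝟙 (S 2F x) + (𝟙 (S 3F x) + 0))))
        ≤⟨ ∑-mono (λ x → four-sets (S 0F x) (S 1F x) (S 2F x) (S 3F x) (disjoint x)) ⟩
      sum (λ x → 𝟙 (S 0F x ∨ S 1F x) + (𝟙 (S 1F x ∨ S 2F x) + 𝟙 (S 2F x ∨ S 3F x)))
        ≡⟨ trans (∑-distrib-+ (λ x → 𝟙 (S 0F x ∨ S 1F x)) _)
                 (cong (card (λ x → S 0F x ∨ S 1F x) +_) (∑-distrib-+ (λ x → 𝟙 (S 1F x ∨ S 2F x)) _)) ⟩
      card (λ x → S 0F x ∨ S 1F x) + (card (λ x → S 1F x ∨ S 2F x) + card (λ x → S 2F x ∨ S 3F x))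
        ≤⟨ +-mono-≤ (bound _ (∪-independent 0F 1F refl))
                    (+-mono-≤ (bound _ (∪-independent 1F 2F refl)) (bound _ (∪-independent 2F 3F refl))) ⟩
      b + (b + b)                                                         ≡⟨ cong (λ t → b + (b + t)) (+-identityʳ b) ⟨
      3 * b                                                               ∎
      where
      open ≤-Reasoning
      S : Fin 4 → Fin m → Bool
      S i x = U (combine i x)
      assemble = trans (∑-distrib-+ (𝟙 ∘ S 0F) _) (cong (card (S 0F) +_)
                (trans (∑-distrib-+ (𝟙 ∘ S 1F) _) (cong (card (S 1F) +_)
                (trans (∑-distrib-+ (𝟙 ∘ S 2F) _) (cong (card (S 2F) +_)
                (trans (∑-distrib-+ (𝟙 ∘ S 3F) (λ _ → 0)) (cong (card (S 3F) +_) (sum-replicate-zero m))))))))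
      apart : ∀ i j x y → S i x ≡ true → S j y ≡ true → linked (link i j) x y ≡ false
      apart i j x y p q = trans (sym (cong₂ pairAdj (Fin.remQuot-combine i x) (Fin.remQuot-combine j y)))
                                (ind (combine i x) (combine j y) p q)
      disjoint : ∀ x → (S 0F x ∧ S 3F x) ≡ false
      disjoint x with S 0F x in p | S 3F x in q
      ... | false | _     = refl
      ... | true  | false = refl
      ... | true  | true with () ← trans (sym (≟-refl x)) (apart 0F 3F x x p q)
      ∨-cases : ∀ a b → (a ∨ b) ≡ true → a ≡ true ⊎ b ≡ true
      ∨-cases true  b e = inj₁ refl
      ∨-cases false b e = inj₂ e
      ∪-independent : ∀ i j → link i j ≡ inner → Independent H (λ x → S i x ∨ S j x)
      ∪-independent i j l x y p q with ∨-cases (S i x) _ p | ∨-cases (S i y) _ q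
      ... | inj₁ a | inj₁ c = trans (cong (λ t → linked t x y) (sym (link-refl i))) (apart i i x y a c)
      ... | inj₁ a | inj₂ c = trans (cong (λ t → linked t x y) (sym l)) (apart i j x y a c)
      ... | inj₂ a | inj₁ c = trans (cong (λ t → linked t x y) (trans (sym l) (link-sym i j))) (apart j i x y a c)
      ... | inj₂ a | inj₂ c = trans (cong (λ t → linked t x y) (sym (link-refl j))) (apart j j x y a c)

  open Fourfold using (fourfold; fourfold-triangleFree; fourfold-independence)

  tower : ∀ j → Graph (4 ^ j)
  tower zero    = record { adj = λ _ _ → false ; sym = λ _ _ → refl ; irrefl = λ _ → refl }
  tower (suc j) = fourfold (tower j)

  tower-triangleFree : ∀ j → TriangleFree (tower j)
  tower-triangleFree zero u v w ()
  tower-triangleFree (suc j) = fourfold-triangleFree (tower j) (tower-triangleFree j)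

  tower-independence : ∀ j U → Independent (tower j) U → card U ≤ 3 ^ j
  tower-independence zero U _ = ∑-≤-const {1} 1 (λ i → 𝟙≤1 (U i))
  tower-independence (suc j) = fourfold-independence (tower j) (3 ^ j) (tower-independence j)

  pullback : Graph m → (Fin n → Fin m) → Graph n
  pullback H φ = record
    { adj = λ u v → adj H (φ u) (φ v) ; sym = λ u v → Graph.sym H (φ u) (φ v) ; irrefl = λ u → irrefl H (φ u) }

  -- Injectivity is asked on `U` only, because the lemma also serves disjoint copies of one graph,
  -- where `φ` repeats a vertex in different copies.
  independent-card-via : ∀ (H : Graph m) (φ : Fin n → Fin m) (b : ℕ) → (∀ V → Independent H V → card V ≤ b) →
    (U : Fin n → Bool) → (∀ i j → U i ≡ true → U j ≡ true → φ i ≡ φ j → i ≡ j) →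
    (∀ i j → U i ≡ true → U j ≡ true → adj H (φ i) (φ j) ≡ false) → card U ≤ b
  independent-card-via {m} {n} H φ b bound U inj apart =
    ≤-trans (card-injection U image φ into inj)
            (bound image λ y z p q → lift (out p) (out q))
    where
    image : Fin m → Bool
    image y = does (Fin.any? λ i → (U i Bool.≟ true) ×-dec (φ i Fin.≟ y))
    into : ∀ i → U i ≡ true → image (φ i) ≡ true
    into i p = dec-true (Fin.any? _) (i , p , refl)
    out : ∀ {y} → image y ≡ true → ∃[ i ] (U i ≡ true × φ i ≡ y)
    out {y} e with Fin.any? (λ i → (U i Bool.≟ true) ×-dec (φ i Fin.≟ y))
    ... | yes p = p
    lift : ∀ {y z} → ∃[ i ] (U i ≡ true × φ i ≡ y) → ∃[ i ] (U i ≡ true × φ i ≡ z) → adj H y z ≡ false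
    lift (i , a , refl) (j , c , refl) = apart i j a c

  -- Any n vertices of the tower induce a competitor in the minimum that defines Q(3,n). With
  -- `4 ^ j` of the order of n this is the bound n^(log 3 / log 4), up to a constant.
  inverseRamsey≤3^ : ∀ {q} j → IsInverseRamsey 3 n q → n ≤ 4 ^ j → q ≤ 3 ^ j
  inverseRamsey≤3^ {n} j (_ , least) n≤ = ≤-trans
    (least H (triangleFree⇒KFree H λ u v w → tower-triangleFree j (φ u) (φ v) (φ w)))
    (indepNumber≤ H (3 ^ j) λ U ind → independent-card-via (tower j) φ (3 ^ j) (tower-independence j) U
      (λ u v _ _ → Fin.inject≤-injective n≤ n≤ u v) ind)
    where
    φ : Fin n → Fin (4 ^ j)
    φ i = inject≤ i n≤
    H = pullback (tower j) φ

  enumerate : (U : Fin n → Bool) → Fin (card U) → Fin n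
  enumerate {suc n} U i with U zero
  enumerate {suc n} U zero    | true  = zero
  enumerate {suc n} U (suc i) | true  = suc (enumerate (U ∘ suc) i)
  enumerate {suc n} U i       | false = suc (enumerate (U ∘ suc) i)

  enumerate-∈ : (U : Fin n → Bool) (i : Fin (card U)) → U (enumerate U i) ≡ true
  enumerate-∈ {suc n} U i with U zero in e
  enumerate-∈ {suc n} U zero    | true  = e
  enumerate-∈ {suc n} U (suc i) | true  = enumerate-∈ (U ∘ suc) i
  enumerate-∈ {suc n} U i       | false = enumerate-∈ (U ∘ suc) i

  enumerate-injective : (U : Fin n → Bool) {i j : Fin (card U)} → enumerate U i ≡ enumerate U j → i ≡ j
  enumerate-injective {suc n} U {i} {j} eq with U zero
  enumerate-injective {suc n} U {zero}  {zero}  eq | true  = refl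
  enumerate-injective {suc n} U {suc i} {suc j} eq | true  = cong suc (enumerate-injective (U ∘ suc) (Fin.suc-injective eq))
  enumerate-injective {suc n} U {i}     {j}     eq | false = enumerate-injective (U ∘ suc) (Fin.suc-injective eq)

  TriangleIn : Graph n → (Fin n → Bool) → Set
  TriangleIn {n} G U = Σ (Fin n) λ u → Σ (Fin n) λ v → Σ (Fin n) λ w →
    (U u ≡ true × U v ≡ true × U w ≡ true) × (adj G u v ≡ true × adj G v w ≡ true × adj G u w ≡ true)

  triangleIn? : (G : Graph n) (U : Fin n → Bool) → Dec (TriangleIn G U)
  triangleIn? G U = Fin.any? λ u → Fin.any? λ v → Fin.any? λ w →
    ((U u Bool.≟ true) ×-dec (U v Bool.≟ true) ×-dec (U w Bool.≟ true)) ×-dec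
    ((adj G u v Bool.≟ true) ×-dec (adj G v w Bool.≟ true) ×-dec (adj G u w Bool.≟ true))

  -- If U is triangle-free, then n vertices fit into L disjoint copies of G[U].
  triangle-in-large-set : ∀ {q L} → IsInverseRamsey 3 n q → (G : Graph n) → L * indepNumber G < q →
    (U : Fin n → Bool) → n ≤ L * card U → TriangleIn G U
  triangle-in-large-set {n} {q} {L} (_ , least) G small U large with triangleIn? G U
  ... | yes t = t
  ... | no ¬t = ⊥-elim (<-irrefl refl (<-≤-trans small (≤-trans (least H H-free) (indepNumber≤ H _ H-independence))))
    where
    s = card U
    position : Fin n → Fin L × Fin s
    position i = remQuot s (inject≤ i large)
    position-injective : ∀ {i j} → position i ≡ position j → i ≡ j
    position-injective {i} {j} e = Fin.inject≤-injective large large i j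
      (trans (sym (Fin.combine-remQuot {L} s _)) (trans (cong (uncurry combine) e) (Fin.combine-remQuot {L} s _)))
    block : Fin n → Fin L
    block i = proj₁ (position i)
    ψ : Fin n → Fin n
    ψ i = enumerate U (proj₂ (position i))
    H : Graph n
    H = record
      { adj    = λ i j → does (block i Fin.≟ block j) ∧ adj G (ψ i) (ψ j)
      ; sym    = λ i j → cong₂ _∧_ (does-≟-sym (block i) (block j)) (Graph.sym G (ψ i) (ψ j))
      ; irrefl = λ i → trans (cong (does (block i Fin.≟ block i) ∧_) (irrefl G (ψ i))) (∧-zeroʳ _)
      }
    H-free : KFree 3 H
    H-free = triangleFree⇒KFree H λ u v w a b c → ¬t (ψ u , ψ v , ψ w ,
      (enumerate-∈ U _ , enumerate-∈ U _ , enumerate-∈ U _) ,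
      (proj₂ (∧-true a) , proj₂ (∧-true b) , proj₂ (∧-true c)))
    H-independence : ∀ V → Independent H V → card V ≤ L * indepNumber G
    H-independence V ind = begin
      sum (λ i → 𝟙 (V i))                                       ≤⟨ ∑-mono inBlock ⟩
      sum (λ i → sum (λ l → 𝟙 (V i ∧ does (block i Fin.≟ l))))  ≡⟨ ∑-comm (λ i l → 𝟙 (V i ∧ does (block i Fin.≟ l))) ⟩
      sum (λ l → card (λ i → V i ∧ does (block i Fin.≟ l)))     ≤⟨ ∑-≤-const (indepNumber G) perBlock ⟩
      L * indepNumber G                                         ∎
      where
      open ≤-Reasoning
      inBlock : ∀ i → 𝟙 (V i) ≤ sum (λ l → 𝟙 (V i ∧ does (block i Fin.≟ l)))
      inBlock i = ≤-trans (≤-reflexive (cong 𝟙 (sym (trans (cong (V i ∧_) (≟-refl (block i))) (∧-identityʳ _)))))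
                          (term≤∑ (λ l → 𝟙 (V i ∧ does (block i Fin.≟ l))) (block i))
      perBlock : ∀ l → card (λ i → V i ∧ does (block i Fin.≟ l)) ≤ indepNumber G
      perBlock l = independent-card-via G ψ _ (independent-card≤ G) (λ i → V i ∧ does (block i Fin.≟ l))
        (λ i j p q e → position-injective (cong₂ _,_
          (trans (≟-true (proj₂ (∧-true {V i} p))) (sym (≟-true (proj₂ (∧-true {V j} q)))))
          (enumerate-injective U e)))
        (λ i j p q → let bi = ≟-true (proj₂ (∧-true {V i} p)) ; bj = ≟-true (proj₂ (∧-true {V j} q)) in
          trans (sym (cong (_∧ adj G (ψ i) (ψ j)) (dec-true (block i Fin.≟ block j) (trans bi (sym bj)))))
                (ind i j (proj₁ (∧-true p)) (proj₁ (∧-true q))))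

  -- Dependent random choice

  module _ (G : Graph n) where

    private
      a : Fin n → Fin n → ℕ
      a u v = 𝟙 (adj G u v)
      Weight : Set
      Weight = Fin n → ℕ

    degree : Weight → Fin n → ℕ
    degree Y u = sum λ b → Y b * a u b

    codegree : Weight → Fin n → Fin n → ℕ
    codegree Y u v = sum λ b → Y b * (a u b * a v b)

  ∏ : {A : Set} → (A → ℕ) → List A → ℕ
  ∏ f []       = 1
  ∏ f (x ∷ xs) = f x * ∏ f xs

  ∏-++ : {A : Set} (f : A → ℕ) (xs ys : List A) → ∏ f (xs ++ ys) ≡ ∏ f xs * ∏ f ys
  ∏-++ f []       ys = sym (*-identityˡ _)
  ∏-++ f (x ∷ xs) ys = trans (cong (f x *_) (∏-++ f xs ys)) (sym (*-assoc (f x) _ _))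

  -- Repeating the list stands for sampling `t` vertices from each weight, so that the moment
  -- inequality for lists also yields `t`-th powers.
  copies : {A : Set} → ℕ → List A → List A
  copies zero    xs = []
  copies (suc t) xs = xs ++ copies t xs

  ∏-copies : {A : Set} (f : A → ℕ) (t : ℕ) (xs : List A) → ∏ f (copies t xs) ≡ ∏ f xs ^ t
  ∏-copies f zero    xs = refl
  ∏-copies f (suc t) xs = trans (∏-++ f xs _) (cong (∏ f xs *_) (∏-copies f t xs))

  module _ (G : Graph n) where

    private
      a : Fin n → Fin n → ℕ
      a u v = 𝟙 (adj G u v)
      α = indepNumber G

    edgeSum : (Fin n → Bool) → (Fin n → Fin n → ℕ) → ℕ
    edgeSum U C = sum λ u → sum λ v → 𝟙 (U u) * (𝟙 (U v) * (a u v * C u v))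

    -- The vertices of U without an earlier neighbour in U form an independent set.
    card≤independence+edges : ∀ U → card U ≤ α + edgeSum U (λ _ _ → 1)
    card≤independence+edges U = begin
      sum (λ u → 𝟙 (U u))                                        ≤⟨ ∑-mono split ⟩
      sum (λ u → 𝟙 (first u) + sum (λ v → 𝟙 (U u) * (𝟙 (U v) * (a u v * 1))))  ≡⟨ ∑-distrib-+ (𝟙 ∘ first) _ ⟩
      card first + edgeSum U (λ _ _ → 1)                          ≤⟨ +-monoˡ-≤ _ (independent-card≤ G first independent) ⟩
      α + edgeSum U (λ _ _ → 1)                                   ∎
      where
      open ≤-Reasoning
      Earlier : Fin n → Set
      Earlier u = ∃[ v ] (U v ≡ true × adj G u v ≡ true × toℕ v < toℕ u)
      earlier? : ∀ u → Dec (Earlier u)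
      earlier? u = Fin.any? λ v → (U v Bool.≟ true) ×-dec (adj G u v Bool.≟ true) ×-dec (v Fin.<? u)
      first : Fin n → Bool
      first u = U u ∧ not (does (earlier? u))
      not-earlier : ∀ u → first u ≡ true → ¬ Earlier u
      not-earlier u p q with proj₂ (∧-true {U u} p)
      ... | r rewrite dec-true (earlier? u) q with () ← r
      independent : Independent G first
      independent u v p q with adj G u v in e
      ... | false = refl
      ... | true with Fin.<-cmp u v
      ...   | tri< l _ _ = ⊥-elim (not-earlier v q (u , proj₁ (∧-true p) , trans (Graph.sym G v u) e , l))
      ...   | tri> _ _ l = ⊥-elim (not-earlier u p (v , proj₁ (∧-true q) , e , l))
      ...   | tri≈ _ refl _ with () ← trans (sym e) (irrefl G u)
      split : ∀ u → 𝟙 (U u) ≤ 𝟙 (first u) + sum (λ v → 𝟙 (U u) * (𝟙 (U v) * (a u v * 1)))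
      split u with U u in e
      ... | false = z≤n
      ... | true with earlier? u
      ...   | no _ = s≤s z≤n
      ...   | yes (v , p , q , _) = ≤-trans (≤-reflexive (sym value)) (term≤∑ (λ v → 1 * (𝟙 (U v) * (a u v * 1))) v)
        where
        value : 1 * (𝟙 (U v) * (a u v * 1)) ≡ 1
        value rewrite p | q = refl

    -- Dependent random choice in the form of an exact moment inequality: the left-hand side counts
    -- pairs of a vertex of U and a tuple of common neighbours, one for each weight in the list.
    moment-inequality : ∀ Ys U →
      sum (λ u → 𝟙 (U u) * ∏ (λ Y → degree G Y u) Ys) ≤
        α * ∏ sum Ys + edgeSum U (λ u v → ∏ (λ Y → codegree G Y u v) Ys)
    moment-inequality [] U = ≤-trans (≤-reflexive (sum-cong-≗ (λ u → *-identityʳ (𝟙 (U u)))))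
      (≤-trans (card≤independence+edges U) (+-monoˡ-≤ _ (≤-reflexive (sym (*-identityʳ α)))))
    moment-inequality (Y ∷ Ys) U = begin
      sum (λ u → 𝟙 (U u) * (degree G Y u * D u))                     ≡⟨ sum-cong-≗ expand ⟩
      sum (λ u → sum (λ b → Y b * (𝟙 (U u ∧ adj G u b) * D u)))      ≡⟨ ∑-comm (λ u b → Y b * (𝟙 (U u ∧ adj G u b) * D u)) ⟩
      sum (λ b → sum (λ u → Y b * (𝟙 (U u ∧ adj G u b) * D u)))      ≡⟨ sum-cong-≗ (λ b → sym (*-distribˡ-sum (Y b) (λ u → 𝟙 (U u ∧ adj G u b) * D u))) ⟩
      -- A sampled vertex `b` shrinks `U` to its neighbours in `U`. An edge survives exactly when
      -- `b` is a common neighbour of its ends, which is what produces the codegree factor.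
      sum (λ b → Y b * sum (λ u → 𝟙 (U u ∧ adj G u b) * D u))        ≤⟨ ∑-mono (λ b → *-monoʳ-≤ (Y b) (moment-inequality Ys (λ u → U u ∧ adj G u b))) ⟩
      sum (λ b → Y b * (α * P + edgeSum (λ u → U u ∧ adj G u b) C))  ≡⟨ sum-cong-≗ (λ b → *-distribˡ-+ (Y b) (α * P) _) ⟩
      sum (λ b → Y b * (α * P) + Y b * edgeSum (λ u → U u ∧ adj G u b) C)  ≡⟨ ∑-distrib-+ (λ b → Y b * (α * P)) _ ⟩
      sum (λ b → Y b * (α * P)) + sum (λ b → Y b * edgeSum (λ u → U u ∧ adj G u b) C)
        ≡⟨ cong₂ _+_ (trans (sym (*-distribʳ-sum (α * P) Y)) (solve 3 (λ x y z → x :* (y :* z) := y :* (x :* z)) refl (sum Y) α P)) collect ⟩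
      α * (sum Y * P) + edgeSum U (λ u v → codegree G Y u v * C u v)  ∎
      where
      open ≤-Reasoning
      open +-*-Solver
      D : Fin n → ℕ
      D u = ∏ (λ Y → degree G Y u) Ys
      C : Fin n → Fin n → ℕ
      C u v = ∏ (λ Y → codegree G Y u v) Ys
      P = ∏ sum Ys
      expand : ∀ u → 𝟙 (U u) * (degree G Y u * D u) ≡ sum (λ b → Y b * (𝟙 (U u ∧ adj G u b) * D u))
      expand u = trans (solve 3 (λ x y z → x :* (y :* z) := y :* (x :* z)) refl (𝟙 (U u)) (degree G Y u) (D u))
        (trans (*-distribʳ-sum (𝟙 (U u) * D u) (λ b → Y b * a u b))
        (sum-cong-≗ λ b → trans (solve 4 (λ y q x d → y :* q :* (x :* d) := y :* (x :* q :* d)) refl (Y b) (a u b) (𝟙 (U u)) (D u))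
                                (cong (λ t → Y b * (t * D u)) (sym (𝟙-∧ (U u) (adj G u b))))))
      collect : sum (λ b → Y b * edgeSum (λ u → U u ∧ adj G u b) C) ≡ edgeSum U (λ u v → codegree G Y u v * C u v)
      collect = trans (sum-cong-≗ (λ b → *-distribˡ-sum (Y b) (λ u → sum (λ v → F b u v))))
        (trans (∑-comm (λ b u → Y b * sum (λ v → F b u v))) (sum-cong-≗ λ u →
         trans (sum-cong-≗ (λ b → *-distribˡ-sum (Y b) (λ v → F b u v)))
        (trans (∑-comm (λ b v → Y b * F b u v)) (sum-cong-≗ λ v → sym (
         trans (solve 5 (λ x y z c d → x :* (y :* (z :* (c :* d))) := c :* (x :* (y :* (z :* d)))) refl
                  (𝟙 (U u)) (𝟙 (U v)) (a u v) (codegree G Y u v) (C u v))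
        (trans (*-distribʳ-sum (𝟙 (U u) * (𝟙 (U v) * (a u v * C u v))) (λ b → Y b * (a u b * a v b)))
        (sum-cong-≗ λ b → trans
          (solve 7 (λ y p q x z w d → y :* (p :* q) :* (x :* (z :* (w :* d))) := y :* (x :* p :* (z :* q :* (w :* d)))) refl
            (Y b) (a u b) (a v b) (𝟙 (U u)) (𝟙 (U v)) (a u v) (C u v))
          (cong₂ (λ s t → Y b * (s * (t * (a u v * C u v)))) (sym (𝟙-∧ (U u) (adj G u b))) (sym (𝟙-∧ (U v) (adj G v b)))))))))))
        where
        F : Fin n → Fin n → Fin n → ℕ
        F b u v = 𝟙 (U u ∧ adj G u b) * (𝟙 (U v ∧ adj G v b) * (a u v * C u v))

  ∏-mono : {A : Set} {f g : A → ℕ} {xs : List A} → All (λ x → f x ≤ g x) xs → ∏ f xs ≤ ∏ g xs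
  ∏-mono []       = ≤-refl
  ∏-mono (p ∷ ps) = *-mono-≤ p (∏-mono ps)

  ∏-scale : {A : Set} (c : ℕ) (f : A → ℕ) (xs : List A) → ∏ (λ x → c * f x) xs ≡ c ^ length xs * ∏ f xs
  ∏-scale c f []       = refl
  ∏-scale c f (x ∷ xs) = trans (cong (c * f x *_) (∏-scale c f xs))
    (solve 4 (λ c y p q → c :* y :* (p :* q) := c :* p :* (y :* q)) refl c (f x) (c ^ length xs) (∏ f xs))
    where open +-*-Solver

  ∏-drop : {A : Set} {f g : A → ℕ} {xs : List A} (c : ℕ) → (∀ x → f x ≤ g x) →
    Any (λ x → c * f x ≤ g x) xs → c * ∏ f xs ≤ ∏ g xs
  ∏-drop c h (here {x} {xs} p) = ≤-trans (≤-reflexive (sym (*-assoc c _ _))) (*-mono-≤ p (∏-mono {xs = xs} (All.universal h xs)))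
  ∏-drop {f = f} c h (there {x} {xs} p) = ≤-trans (≤-reflexive (solve 3 (λ c y q → c :* (y :* q) := y :* (c :* q)) refl c (f x) (∏ f xs)))
    (*-mono-≤ (h x) (∏-drop c h p))
    where open +-*-Solver

  ∏-pos : {A : Set} {f : A → ℕ} {xs : List A} → All (λ x → 1 ≤ f x) xs → 1 ≤ ∏ f xs
  ∏-pos {xs = xs} ps = ≤-trans (≤-reflexive (sym (∏-one xs))) (∏-mono ps)
    where
    ∏-one : {A : Set} (xs : List A) → ∏ (λ _ → 1) xs ≡ 1
    ∏-one [] = refl
    ∏-one (x ∷ xs) = trans (+-identityʳ _) (∏-one xs)

  ^-distribʳ-* : ∀ a b t → (a * b) ^ t ≡ a ^ t * b ^ t
  ^-distribʳ-* a b zero    = refl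
  ^-distribʳ-* a b (suc t) = trans (cong (a * b *_) (^-distribʳ-* a b t))
    (solve 4 (λ a b p q → a :* b :* (p :* q) := a :* p :* (b :* q)) refl a b (a ^ t) (b ^ t))
    where open +-*-Solver

  module _ (G : Graph n) where

    private α = indepNumber G

    degree≤ : ∀ Y u → degree G Y u ≤ sum Y
    degree≤ Y u = ∑-mono λ b → ≤-trans (*-monoʳ-≤ (Y b) (𝟙≤1 (adj G u b))) (≤-reflexive (*-identityʳ _))

    codegree≤ : ∀ Y u v → codegree G Y u v ≤ sum Y
    codegree≤ Y u v = ∑-mono λ b → ≤-trans (*-monoʳ-≤ (Y b) (*-mono-≤ (𝟙≤1 (adj G u b)) (𝟙≤1 (adj G v b))))
      (≤-reflexive (*-identityʳ _))

    RichEdge : ℕ → (Fin n → Bool) → List (Fin n → ℕ) → Set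
    RichEdge E U Ys = Σ (Fin n) λ u → Σ (Fin n) λ v → U u ≡ true × U v ≡ true × adj G u v ≡ true ×
      All (λ Y → sum Y ≤ E * codegree G Y u v) Ys

    -- If no edge in `U` were rich, every edge would lose a factor `E` in one of its codegrees,
    -- hence `E ^ t` after `t` rounds of sampling. The degrees lose at most `M ^ 3` per round, as
    -- there are at most three weights. The last hypothesis says that the moment inequality cannot
    -- balance these losses.
    rich-edge : ∀ M E t U Ys → 1 ≤ M → length Ys ≤ 3 → All (λ Y → 1 ≤ sum Y) Ys →
      (∀ u → U u ≡ true → All (λ Y → sum Y ≤ M * degree G Y u) Ys) →
      (M ^ 3) ^ t * (α * E ^ t + n * n) < card U * E ^ t → RichEdge E U Ys
    rich-edge M E t U Ys M≥1 len pos degrees big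
      with Fin.any? (λ u → Fin.any? λ v → (U u Bool.≟ true) ×-dec (U v Bool.≟ true) ×-dec (adj G u v Bool.≟ true) ×-dec
             All.all? (λ Y → sum Y ≤? E * codegree G Y u v) Ys)
    ... | yes (u , v , h) = u , v , h
    ... | no ¬rich = ⊥-elim (<-irrefl refl (<-≤-trans big (*-cancelʳ-≤ _ _ (T ^ t) {{>-nonZero (m^n>0 T {{>-nonZero T>0}} t)}} counted)))
      where
      open +-*-Solver
      T = ∏ sum Ys
      D : Fin n → ℕ
      D u = ∏ (λ Y → degree G Y u) Ys
      C : Fin n → Fin n → ℕ
      C u v = ∏ (λ Y → codegree G Y u v) Ys
      T>0 : 1 ≤ T
      T>0 = ∏-pos pos
      D-large : ∀ u → U u ≡ true → T ^ t ≤ (M ^ 3) ^ t * D u ^ t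
      D-large u p = ≤-trans (^-monoˡ-≤ t (begin
        T                       ≤⟨ ∏-mono (degrees u p) ⟩
        ∏ (λ Y → M * degree G Y u) Ys ≡⟨ ∏-scale M (λ Y → degree G Y u) Ys ⟩
        M ^ length Ys * D u     ≤⟨ *-monoˡ-≤ (D u) (^-monoʳ-≤ M {{>-nonZero M≥1}} len) ⟩
        M ^ 3 * D u             ∎)) (≤-reflexive (^-distribʳ-* (M ^ 3) (D u) t))
        where open ≤-Reasoning
      C-small : ∀ u v → U u ≡ true → U v ≡ true → adj G u v ≡ true → E ^ t * C u v ^ t ≤ T ^ t
      C-small u v p q r = ≤-trans (≤-reflexive (sym (^-distribʳ-* E (C u v) t)))
        (^-monoˡ-≤ t (∏-drop E (λ Y → codegree≤ Y u v) (Any.map (λ h → <⇒≤ (≰⇒> h))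
          (¬All⇒Any¬ (λ Y → sum Y ≤? E * codegree G Y u v) Ys (λ h → ¬rich (u , v , p , q , r , h))))))
      term : ∀ u v → E ^ t * (𝟙 (U u) * (𝟙 (U v) * (𝟙 (adj G u v) * C u v ^ t))) ≤ T ^ t
      term u v with U u in p | U v in q | adj G u v in r
      ... | false | _     | _     = ≤-trans (≤-reflexive (*-zeroʳ (E ^ t))) z≤n
      ... | true  | false | _     = ≤-trans (≤-reflexive (*-zeroʳ (E ^ t))) z≤n
      ... | true  | true  | false = ≤-trans (≤-reflexive (*-zeroʳ (E ^ t))) z≤n
      ... | true  | true  | true  = ≤-trans (≤-reflexive (cong (E ^ t *_) (trans (*-identityˡ _) (trans (*-identityˡ _) (*-identityˡ _))))) (C-small u v p q r)
      moments : sum (λ u → 𝟙 (U u) * D u ^ t) ≤ α * T ^ t + edgeSum G U (λ u v → C u v ^ t)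
      moments = subst₂ _≤_
        (sum-cong-≗ λ u → cong (𝟙 (U u) *_) (∏-copies (λ Y → degree G Y u) t Ys))
        (cong₂ _+_ (cong (α *_) (∏-copies sum t Ys))
          (sum-cong-≗ λ u → sum-cong-≗ λ v → cong (λ c → 𝟙 (U u) * (𝟙 (U v) * (𝟙 (adj G u v) * c))) (∏-copies (λ Y → codegree G Y u v) t Ys)))
        (moment-inequality G (copies t Ys) U)
      open ≤-Reasoning
      edges-few : E ^ t * edgeSum G U (λ u v → C u v ^ t) ≤ n * n * T ^ t
      edges-few = begin
        E ^ t * edgeSum G U (λ u v → C u v ^ t)
          ≡⟨ trans (*-distribˡ-sum (E ^ t) (λ u → sum (λ v → F u v))) (sum-cong-≗ λ u → *-distribˡ-sum (E ^ t) (λ v → F u v)) ⟩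
        sum (λ u → sum λ v → E ^ t * F u v) ≤⟨ ∑-≤-const {n} (n * T ^ t) (λ u → ∑-≤-const (T ^ t) (λ v → term u v)) ⟩
        n * (n * T ^ t)                     ≡⟨ *-assoc n n (T ^ t) ⟨
        n * n * T ^ t                       ∎
        where
        F : Fin n → Fin n → ℕ
        F u v = 𝟙 (U u) * (𝟙 (U v) * (𝟙 (adj G u v) * C u v ^ t))
      U-large : card U * T ^ t ≤ (M ^ 3) ^ t * sum (λ u → 𝟙 (U u) * D u ^ t)
      U-large = begin
        card U * T ^ t                                    ≡⟨ *-distribʳ-sum (T ^ t) (𝟙 ∘ U) ⟩
        sum (λ u → 𝟙 (U u) * T ^ t)                       ≤⟨ ∑-mono bound ⟩
        sum (λ u → (M ^ 3) ^ t * (𝟙 (U u) * D u ^ t))     ≡⟨ *-distribˡ-sum ((M ^ 3) ^ t) (λ u → 𝟙 (U u) * D u ^ t) ⟨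
        (M ^ 3) ^ t * sum (λ u → 𝟙 (U u) * D u ^ t)       ∎
        where
        bound : ∀ u → 𝟙 (U u) * T ^ t ≤ (M ^ 3) ^ t * (𝟙 (U u) * D u ^ t)
        bound u with U u in p
        ... | false = z≤n
        ... | true  = subst₂ _≤_ (sym (*-identityˡ _)) (cong ((M ^ 3) ^ t *_) (sym (*-identityˡ _))) (D-large u p)
      counted : card U * E ^ t * T ^ t ≤ (M ^ 3) ^ t * (α * E ^ t + n * n) * T ^ t
      counted = begin
        card U * E ^ t * T ^ t                      ≡⟨ solve 3 (λ u e t → u :* e :* t := e :* (u :* t)) refl (card U) (E ^ t) (T ^ t) ⟩
        E ^ t * (card U * T ^ t)                    ≤⟨ *-monoʳ-≤ (E ^ t) (≤-trans U-large (*-monoʳ-≤ ((M ^ 3) ^ t) moments)) ⟩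
        E ^ t * ((M ^ 3) ^ t * (α * T ^ t + edgeSum G U (λ u v → C u v ^ t)))
          ≡⟨ solve 5 (λ e m a t s → e :* (m :* (a :* t :+ s)) := m :* (a :* e :* t :+ e :* s)) refl (E ^ t) ((M ^ 3) ^ t) α (T ^ t) _ ⟩
        (M ^ 3) ^ t * (α * E ^ t * T ^ t + E ^ t * edgeSum G U (λ u v → C u v ^ t))
          ≤⟨ *-monoʳ-≤ ((M ^ 3) ^ t) (+-monoʳ-≤ (α * E ^ t * T ^ t) edges-few) ⟩
        (M ^ 3) ^ t * (α * E ^ t * T ^ t + n * n * T ^ t)
          ≡⟨ solve 4 (λ m x y t → m :* (x :* t :+ y :* t) := m :* (x :+ y) :* t) refl ((M ^ 3) ^ t) (α * E ^ t) (n * n) (T ^ t) ⟩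
        (M ^ 3) ^ t * (α * E ^ t + n * n) * T ^ t   ∎

  -- Parameters of dependent random choice

  n<2^n : ∀ n → n < 2 ^ n
  n<2^n zero    = s≤s z≤n
  n<2^n (suc n) = begin-strict
    suc n           ≤⟨ n<2^n n ⟩
    2 ^ n           <⟨ m<m+n (2 ^ n) (≤-trans (m^n>0 2 n) (≤-reflexive (sym (+-identityʳ _)))) ⟩
    2 ^ suc n       ∎
    where open ≤-Reasoning

  -- (4/3)³ ≥ 2.
  exponent-choice : ∀ B → 2 * B * 3 ^ (6 * B) ≤ 4 ^ (6 * B)
  exponent-choice B = begin
    2 * B * 3 ^ (6 * B)         ≡⟨ cong (λ e → 2 * B * 3 ^ e) (*-assoc 3 2 B) ⟩
    2 * B * 3 ^ (3 * (2 * B))   ≡⟨ cong (2 * B *_) (^-*-assoc 3 3 (2 * B)) ⟨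
    2 * B * 27 ^ (2 * B)        ≤⟨ *-monoˡ-≤ (27 ^ (2 * B)) (<⇒≤ (n<2^n (2 * B))) ⟩
    2 ^ (2 * B) * 27 ^ (2 * B)  ≡⟨ ^-distribʳ-* 2 27 (2 * B) ⟨
    54 ^ (2 * B)                ≤⟨ ^-monoˡ-≤ (2 * B) (m≤m+n 54 10) ⟩
    64 ^ (2 * B)                ≡⟨ ^-*-assoc 4 3 (2 * B) ⟩
    4 ^ (3 * (2 * B))           ≡⟨ cong (4 ^_) (*-assoc 3 2 B) ⟨
    4 ^ (6 * B)                 ∎
    where open ≤-Reasoning

  -- Opaque, since normalising powers with this exponent is infeasible.
  opaque

    richness : ℕ → ℕ
    richness M = 6 * M ^ 3

    -- Over `richness M` levels of the tower the order outgrows the independence number by a power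
    -- of 4/3, and this gain pays for the factor `M ^ 3` that one round of sampling loses, with a
    -- factor 2 to spare.
    richness-spec : ∀ M → 2 * M ^ 3 * 3 ^ richness M ≤ 4 ^ richness M
    richness-spec M = exponent-choice (M ^ 3)

    richness-pos : ∀ M → M ^ 3 ≤ richness M
    richness-pos M = m≤m+n (M ^ 3) _

  power-bracket : ∀ n → 1 ≤ n → ∃[ j ] (4 ^ j ≤ n × n < 4 ^ suc j)
  power-bracket n n≥1 = search n (<-≤-trans (n<2^n n) (^-monoˡ-≤ n (m≤m+n 2 2)))
    where
    search : ∀ k → n < 4 ^ k → ∃[ j ] (4 ^ j ≤ n × n < 4 ^ suc j)
    search zero h = ⊥-elim (<-irrefl refl (<-≤-trans h n≥1))
    search (suc k) h with 4 ^ k ≤? n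
    ... | yes p = k , p , h
    ... | no ¬p = search k (≰⇒> ¬p)

  -- One round of sampling is made for every `r` levels of the tower below `n`. The term with `α` is
  -- small because `(2 * B * 3 ^ r) ^ t` is at most `4 ^ (t * r)`, the term `n * n` because the
  -- losing factor `2 * B * 4 ^ r` contains `4 ^ r`, so that its `t`-th power is comparable with
  -- `n`. The spare `2 ^ t` in both absorbs `L` and the rounding of `n` to a power of `4 ^ r`.
  growth : ∀ B r t L n α → 1 ≤ B → 2 * B * 3 ^ r ≤ 4 ^ r → 2 * L * 4 ^ r < 2 ^ t →
    4 ^ (t * r) ≤ n → n ≤ 4 ^ (t * r) * 4 ^ r → α ≤ 3 ^ (t * r) * 3 ^ r →
    L * (B ^ t * (α * (2 * B * 4 ^ r) ^ t + n * n)) < n * (2 * B * 4 ^ r) ^ t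
  growth B r t L n α B≥1 rich big n≥ n≤ α≤ = *-cancelˡ-< 2 _ _ (begin-strict
    2 * (L * (b * (α * e + n * n)))            ≡⟨ solve 5 (λ L b α e n → con 2 :* (L :* (b :* (α :* e :+ n :* n))) := con 2 :* L :* b :* α :* e :+ con 2 :* L :* b :* n :* n) refl L b α e n ⟩
    2 * L * b * α * e + 2 * L * b * n * n      <⟨ +-mono-<-≤ first second ⟩
    n * e + n * e                              ≡⟨ solve 1 (λ x → x :+ x := con 2 :* x) refl (n * e) ⟩
    2 * (n * e)                                ∎)
    where
    open +-*-Solver
    open ≤-Reasoning
    b = B ^ t
    e = (2 * B * 4 ^ r) ^ t
    w = 2 ^ t
    p = 4 ^ (t * r)
    s = 3 ^ (t * r)
    power : ∀ c → (2 * B * c ^ r) ^ t ≡ w * b * c ^ (t * r)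
    power c = begin-equality
      (2 * B * c ^ r) ^ t       ≡⟨ ^-distribʳ-* (2 * B) (c ^ r) t ⟩
      (2 * B) ^ t * (c ^ r) ^ t ≡⟨ cong₂ _*_ (^-distribʳ-* 2 B t) (trans (^-*-assoc c r t) (cong (c ^_) (*-comm r t))) ⟩
      w * b * c ^ (t * r)       ∎
    wbs≤p : w * b * s ≤ p
    wbs≤p = subst₂ _≤_ (power 3) (trans (^-*-assoc 4 r t) (cong (4 ^_) (*-comm r t))) (^-monoˡ-≤ t rich)
    instance
      B≢0 : NonZero B
      B≢0 = >-nonZero B≥1
      positive : NonZero (b * s * e)
      positive = m*n≢0 (b * s) e {{m*n≢0 b s {{m^n≢0 B t}} {{m^n≢0 3 (t * r)}}}} {{m^n≢0 (2 * B * 4 ^ r) t {{m*n≢0 (2 * B) (4 ^ r) {{m*n≢0 2 B}} {{m^n≢0 4 r}}}}}}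
    first : 2 * L * b * α * e < n * e
    first = begin-strict
      2 * L * b * α * e              ≤⟨ *-monoˡ-≤ e (*-monoʳ-≤ (2 * L * b) α≤) ⟩
      2 * L * b * (s * 3 ^ r) * e    ≡⟨ solve 5 (λ L b s c e → con 2 :* L :* b :* (s :* c) :* e := con 2 :* L :* c :* (b :* s :* e)) refl L b s (3 ^ r) e ⟩
      2 * L * 3 ^ r * (b * s * e)    ≤⟨ *-monoˡ-≤ (b * s * e) (*-monoʳ-≤ (2 * L) (^-monoˡ-≤ r (n≤1+n 3))) ⟩
      2 * L * 4 ^ r * (b * s * e)    <⟨ *-monoˡ-< (b * s * e) big ⟩
      w * (b * s * e)                ≡⟨ solve 4 (λ w b s e → w :* (b :* s :* e) := w :* b :* s :* e) refl w b s e ⟩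
      w * b * s * e                  ≤⟨ *-monoˡ-≤ e (≤-trans wbs≤p n≥) ⟩
      n * e                          ∎
    second : 2 * L * b * n * n ≤ n * e
    second = begin
      2 * L * b * n * n              ≤⟨ *-monoʳ-≤ (2 * L * b * n) n≤ ⟩
      2 * L * b * n * (p * 4 ^ r)    ≡⟨ solve 5 (λ L b n p c → con 2 :* L :* b :* n :* (p :* c) := con 2 :* L :* c :* (b :* p :* n)) refl L b n p (4 ^ r) ⟩
      2 * L * 4 ^ r * (b * p * n)    ≤⟨ *-monoˡ-≤ (b * p * n) (<⇒≤ big) ⟩
      w * (b * p * n)                ≡⟨ solve 4 (λ w b p n → w :* (b :* p :* n) := n :* (w :* b :* p)) refl w b p n ⟩
      n * (w * b * p)                ≡⟨ cong (n *_) (power 4) ⟨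
      n * e                          ∎

  rich-edge-at-scale : ∀ M L {q} → 1 ≤ M → 1 ≤ L → IsInverseRamsey 3 n q → (G : Graph n) → indepNumber G ≤ q →
    4 ^ ((1 + 2 * L * 4 ^ richness M) * richness M) ≤ n → ∀ U → n ≤ L * card U → ∀ Ys → length Ys ≤ 3 → All (λ Y → 1 ≤ sum Y) Ys →
    (∀ u → U u ≡ true → All (λ Y → sum Y ≤ M * degree G Y u) Ys) → RichEdge G (2 * M ^ 3 * 4 ^ richness M) U Ys
  rich-edge-at-scale {n} M L {q} M≥1 L≥1 ramsey G α≤q N≤n U large Ys len pos degrees =
    rich-edge G M E t U Ys M≥1 len pos degrees
      (*-cancelˡ-< L _ _ (<-≤-trans
        (growth B r t L n α B≥1 (richness-spec M) big n≥ n≤ α≤)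
        (≤-trans (*-monoˡ-≤ (E ^ t) large) (≤-reflexive (*-assoc L (card U) (E ^ t))))))
    where
    open ≤-Reasoning
    α = indepNumber G
    E = 2 * M ^ 3 * 4 ^ richness M
    r = richness M
    B = M ^ 3
    B≥1 : 1 ≤ B
    B≥1 = m^n>0 M {{>-nonZero M≥1}} 3
    instance
      r≢0 : NonZero r
      r≢0 = >-nonZero (≤-trans B≥1 (richness-pos M))
    n≥1 : 1 ≤ n
    n≥1 = ≤-trans (m^n>0 4 ((1 + 2 * L * 4 ^ r) * r)) N≤n
    bracket = power-bracket n n≥1
    j = proj₁ bracket
    -- Only whole blocks of `r` levels are used; the remaining fewer than `r` levels cost a factor
    -- of at most `4 ^ r` in the order and `3 ^ r` in the independence number.
    t = j / r
    j≡ : j ≡ j % r + t * r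
    j≡ = m≡m%n+[m/n]*n j r
    t-large : 1 + 2 * L * 4 ^ r ≤ t
    t-large = subst (_≤ t) (m*n/n≡m (1 + 2 * L * 4 ^ r) r) (/-monoˡ-≤ r (≮⇒≥ λ j< →
      <-irrefl refl (<-≤-trans (proj₂ (proj₂ bracket)) (≤-trans (^-monoʳ-≤ 4 j<) N≤n))))
    big : 2 * L * 4 ^ r < 2 ^ t
    big = ≤-<-trans (≤-trans (n≤1+n _) t-large) (n<2^n t)
    n≥ : 4 ^ (t * r) ≤ n
    n≥ = ≤-trans (^-monoʳ-≤ 4 (subst (t * r ≤_) (sym j≡) (m≤n+m (t * r) (j % r)))) (proj₁ (proj₂ bracket))
    suc-j≤ : suc j ≤ t * r + r
    suc-j≤ = begin
      suc j                  ≡⟨ cong suc j≡ ⟩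
      suc (j % r) + t * r    ≤⟨ +-monoˡ-≤ (t * r) (m%n<n j r) ⟩
      r + t * r              ≡⟨ +-comm r (t * r) ⟩
      t * r + r              ∎
    below : n ≤ 4 ^ suc j
    below = <⇒≤ (proj₂ (proj₂ bracket))
    n≤ : n ≤ 4 ^ (t * r) * 4 ^ r
    n≤ = ≤-trans below (≤-trans (^-monoʳ-≤ 4 suc-j≤) (≤-reflexive (^-distribˡ-+-* 4 (t * r) r)))
    α≤ : α ≤ 3 ^ (t * r) * 3 ^ r
    α≤ = ≤-trans α≤q (≤-trans (inverseRamsey≤3^ (suc j) ramsey below)
      (≤-trans (^-monoʳ-≤ 3 suc-j≤) (≤-reflexive (^-distribˡ-+-* 3 (t * r) r))))

  opaque

    edgeFactor : ℕ → ℕ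
    edgeFactor M = 2 * M ^ 3 * 4 ^ richness M

    -- Large enough for at least `1 + 2 * L * 4 ^ richness M` rounds of sampling, whence
    -- `2 * L * 4 ^ richness M < 2 ^ t`.
    order-threshold : ℕ → ℕ → ℕ
    order-threshold M L = 4 ^ ((1 + 2 * L * 4 ^ richness M) * richness M)

    ≤edgeFactor : ∀ M → 1 ≤ M → M ≤ edgeFactor M
    ≤edgeFactor M M≥1 = begin
      M                             ≡⟨ ^-identityʳ M ⟨
      M ^ 1                         ≤⟨ ^-monoʳ-≤ M {{>-nonZero M≥1}} {1} {3} (s≤s z≤n) ⟩
      M ^ 3                         ≤⟨ m≤n*m (M ^ 3) 2 ⟩
      2 * M ^ 3                     ≤⟨ m≤m*n (2 * M ^ 3) (4 ^ richness M) {{m^n≢0 4 (richness M)}} ⟩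
      2 * M ^ 3 * 4 ^ richness M    ∎
      where open ≤-Reasoning

    order-threshold-pos : ∀ M L → 1 ≤ order-threshold M L
    order-threshold-pos M L = m^n>0 4 ((1 + 2 * L * 4 ^ richness M) * richness M)

    rich-edge-in-large-set : ∀ M L {q} → 1 ≤ M → 1 ≤ L → IsInverseRamsey 3 n q → (G : Graph n) → indepNumber G ≤ q →
      order-threshold M L ≤ n → ∀ U → n ≤ L * card U → ∀ Ys → length Ys ≤ 3 → All (λ Y → 1 ≤ sum Y) Ys →
      (∀ u → U u ≡ true → All (λ Y → sum Y ≤ M * degree G Y u) Ys) → RichEdge G (edgeFactor M) U Ys
    rich-edge-in-large-set = rich-edge-at-scale

  -- Embedding cliques along a tuple of weights

  data AnyPair {A : Set} (R : A → A → Set) : List A → Set where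
    head : ∀ {x xs} → Any (R x) xs → AnyPair R (x ∷ xs)
    tail : ∀ {x xs} → AnyPair R xs → AnyPair R (x ∷ xs)

  AnyPair-map : {A : Set} {R S : A → A → Set} {P : A → Set} → (∀ {x y} → P x → P y → R x y → S x y) →
    ∀ {xs} → All P xs → AnyPair R xs → AnyPair S xs
  AnyPair-map {A} {R} {S} {P} f (p ∷ ps) (head r) = head (go ps r)
    where
    go : ∀ {ys} → All P ys → Any (R _) ys → Any (S _) ys
    go (q ∷ qs) (here r)  = here (f p q r)
    go (q ∷ qs) (there r) = there (go qs r)
  AnyPair-map f (p ∷ ps) (tail r) = tail (AnyPair-map f ps r)

  AnyPair-map⁻ : {A B : Set} {R : B → B → Set} (f : A → B) {xs : List A} →
    AnyPair R (List.map f xs) → AnyPair (λ x y → R (f x) (f y)) xs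
  AnyPair-map⁻ f {x ∷ xs} (head r) = head (Any.map⁻ r)
  AnyPair-map⁻ f {x ∷ xs} (tail r) = tail (AnyPair-map⁻ f r)

  indicator : (n : ℕ) → Bool
  indicator zero    = false
  indicator (suc _) = true

  indicator-true : ∀ {m} → indicator m ≡ true → 1 ≤ m
  indicator-true {suc m} _ = s≤s z≤n

  support : (Fin n → ℕ) → Fin n → Bool
  support Y u = indicator (Y u)

  sum≤card-support : ∀ W (Y : Fin n → ℕ) → (∀ u → Y u ≤ W) → sum Y ≤ W * card (support Y)
  sum≤card-support W Y h = ≤-trans (∑-mono pointwise) (≤-reflexive (sym (*-distribˡ-sum W (𝟙 ∘ support Y))))
    where
    pointwise : ∀ u → Y u ≤ W * 𝟙 (support Y u)
    pointwise u with Y u | h u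
    ... | zero  | _ = z≤n
    ... | suc y | p = ≤-trans p (≤-reflexive (sym (*-identityʳ W)))

  -- The relative smallness of a sparse pair when `m` weights follow the current one. Refining
  -- against the following weights halves once for each; a pair found later lies in common
  -- neighbourhoods and pays a further factor `c`. The sum replaces a maximum.
  sparseness : ℕ → ℕ → ℕ
  sparseness c zero    = 1
  sparseness c (suc m) = 2 ^ suc m + c * sparseness c m

  -- Bounds n divided by the size of any support met during the embedding, if `l` bounds the initial
  -- ratio; again a sum in place of a maximum.
  demand : ℕ → ℕ → ℕ → ℕ
  demand c zero    l = l
  demand c (suc m) l = l * 2 ^ suc m + demand c m (l * c)

  module _ (G : Graph n) where

    private
      a : Fin n → Fin n → ℕ
      a u v = 𝟙 (adj G u v)

    weightedEdges : (Fin n → ℕ) → (Fin n → ℕ) → ℕ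
    weightedEdges A B = sum λ u → A u * degree G B u

    Clique : List (Fin n) → Set
    Clique = AllPairs λ u v → adj G u v ≡ true

    restrict : List (Fin n) → (Fin n → ℕ) → Fin n → ℕ
    restrict K Y b = Y b * ∏ (λ u → a u b) K

    ∏a≤1 : ∀ K b → ∏ (λ u → a u b) K ≤ 1
    ∏a≤1 []      b = ≤-refl
    ∏a≤1 (u ∷ K) b = *-mono-≤ (𝟙≤1 (adj G u b)) (∏a≤1 K b)

    restrict≤ : ∀ K Y b → restrict K Y b ≤ Y b
    restrict≤ K Y b = ≤-trans (*-monoʳ-≤ (Y b) (∏a≤1 K b)) (≤-reflexive (*-identityʳ _))

    *-posˡ : ∀ x y → 1 ≤ x * y → 1 ≤ x
    *-posˡ (suc x) y _ = s≤s z≤n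

    *-posʳ : ∀ x y → 1 ≤ x * y → 1 ≤ y
    *-posʳ x y h = *-posˡ y x (subst (1 ≤_) (*-comm x y) h)

    restrict-adjacent : ∀ K Y b → 1 ≤ restrict K Y b → All (λ u → adj G u b ≡ true) K
    restrict-adjacent K Y b h = go K (*-posʳ (Y b) _ h)
      where
      𝟙-pos : ∀ x → 1 ≤ 𝟙 x → x ≡ true
      𝟙-pos true _ = refl
      go : ∀ K → 1 ≤ ∏ (λ u → a u b) K → All (λ u → adj G u b ≡ true) K
      go []      _ = []
      go (u ∷ K) h = 𝟙-pos _ (*-posˡ (a u b) _ h) ∷ go K (*-posʳ (a u b) _ h)

    -- Densities are compared with the fraction num / den.
    module Threshold (num den : ℕ) where

      record Sparse (e : ℕ) (X Y : Fin n → ℕ) : Set where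
        constructor sparse
        field
          {A B}   : Fin n → ℕ
          A≤X     : ∀ u → A u ≤ X u
          B≤Y     : ∀ u → B u ≤ Y u
          A-large : sum X ≤ e * sum A
          B-large : sum Y ≤ e * sum B
          few     : den * weightedEdges A B ≤ num * (sum A * sum B)

      Sparse-mono : ∀ {e e′ X Y} → e ≤ e′ → Sparse e X Y → Sparse e′ X Y
      Sparse-mono h (sparse {A} {B} p q r s f) =
        sparse p q (≤-trans r (*-monoˡ-≤ (sum A) h)) (≤-trans s (*-monoˡ-≤ (sum B) h)) f

      Sparse-extend : ∀ c {e X Y X′ Y′} → (∀ u → X′ u ≤ X u) → (∀ u → Y′ u ≤ Y u) →
        sum X ≤ c * sum X′ → sum Y ≤ c * sum Y′ → Sparse e X′ Y′ → Sparse (c * e) X Y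
      Sparse-extend c {e} hX hY lX lY (sparse {A} {B} p q r s f) =
        sparse (λ u → ≤-trans (p u) (hX u)) (λ u → ≤-trans (q u) (hY u)) (enlarge lX r) (enlarge lY s) f
        where
        enlarge : ∀ {x y z} → x ≤ c * y → y ≤ e * z → x ≤ c * e * z
        enlarge {z = z} g h = ≤-trans g (≤-trans (*-monoʳ-≤ c h) (≤-reflexive (sym (*-assoc c e z))))

      Dense : (Fin n → ℕ) → Fin n → Set
      Dense Z u = num * sum Z ≤ den * degree G Z u

      record Refinement (Y : Fin n → ℕ) (Zs : List (Fin n → ℕ)) : Set where
        constructor refinement
        field
          Y′     : Fin n → ℕ
          Y′≤Y   : ∀ u → Y′ u ≤ Y u
          large  : sum Y ≤ 2 ^ length Zs * sum Y′
          dense  : ∀ u → 1 ≤ Y′ u → All (λ Z → Dense Z u) Zs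

      -- Each `Z` splits the current weight by its degrees to `Z`, and the heavier part decides. If
      -- the low degrees win, that part and the whole of `Z` are a sparse pair; otherwise the other
      -- part is kept and at most half of the mass is lost.
      refine : ∀ Y Zs → Any (Sparse (2 ^ length Zs) Y) Zs ⊎ Refinement Y Zs
      refine Y [] = inj₂ (refinement Y (λ _ → ≤-refl) (≤-reflexive (sym (*-identityˡ _))) (λ _ _ → []))
      refine Y (Z ∷ Zs) with refine Y Zs
      ... | inj₁ s = inj₁ (there (Any.map (Sparse-mono (m≤m+n (2 ^ length Zs) _)) s))
      ... | inj₂ (refinement Y′ Y′≤Y large dense) = decide (≤-total (sum (part id)) (sum (part not)))
        where
        open ≤-Reasoning
        dense? : ∀ u → Dec (Dense Z u)
        dense? u = num * sum Z ≤? den * degree G Z u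
        test : Fin n → Bool
        test u = does (dense? u)
        part : (Bool → Bool) → Fin n → ℕ
        part f u = Y′ u * 𝟙 (f (test u))
        part≤ : ∀ f u → part f u ≤ Y u
        part≤ f u = ≤-trans (*-monoʳ-≤ (Y′ u) (𝟙≤1 (f (test u)))) (≤-trans (≤-reflexive (*-identityʳ _)) (Y′≤Y u))
        parts : sum Y′ ≡ sum (part id) + sum (part not)
        parts = trans (sum-cong-≗ (λ u → split (Y′ u) (test u))) (∑-distrib-+ (part id) (part not))
          where
          split : ∀ y x → y ≡ y * 𝟙 x + y * 𝟙 (not x)
          split y true  = sym (trans (cong₂ _+_ (*-identityʳ y) (*-zeroʳ y)) (+-identityʳ y))
          split y false = sym (cong₂ _+_ (*-zeroʳ y) (*-identityʳ y))
        half : ∀ {g b} f → sum Y′ ≡ g + b → g ≤ sum (part f) → b ≤ sum (part f) → sum Y ≤ 2 ^ suc (length Zs) * sum (part f)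
        half {g} {b} f eq p q = begin
          sum Y                                       ≤⟨ large ⟩
          2 ^ length Zs * sum Y′                      ≡⟨ cong (2 ^ length Zs *_) eq ⟩
          2 ^ length Zs * (g + b)                     ≤⟨ *-monoʳ-≤ (2 ^ length Zs) (+-mono-≤ p q) ⟩
          2 ^ length Zs * (sum (part f) + sum (part f)) ≡⟨ solve 2 (λ x y → x :* (y :+ y) := con 2 :* x :* y) refl (2 ^ length Zs) (sum (part f)) ⟩
          2 ^ suc (length Zs) * sum (part f)          ∎
          where open +-*-Solver
        few : den * weightedEdges (part not) Z ≤ num * (sum (part not) * sum Z)
        few = begin
          den * weightedEdges (part not) Z             ≡⟨ *-distribˡ-sum den (λ u → part not u * degree G Z u) ⟩
          sum (λ u → den * (part not u * degree G Z u)) ≤⟨ ∑-mono pointwise ⟩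
          sum (λ u → part not u * (num * sum Z))       ≡⟨ *-distribʳ-sum (num * sum Z) (part not) ⟨
          sum (part not) * (num * sum Z)               ≡⟨ solve 3 (λ x y z → x :* (y :* z) := y :* (x :* z)) refl (sum (part not)) num (sum Z) ⟩
          num * (sum (part not) * sum Z)               ∎
          where
          open +-*-Solver
          pointwise : ∀ u → den * (part not u * degree G Z u) ≤ part not u * (num * sum Z)
          pointwise u = go (dense? u)
            where
            go : (d : Dec (Dense Z u)) → den * (Y′ u * 𝟙 (not (does d)) * degree G Z u) ≤ Y′ u * 𝟙 (not (does d)) * (num * sum Z)
            go (yes _) = ≤-reflexive (trans (cong (λ t → den * (t * degree G Z u)) (*-zeroʳ (Y′ u)))
                           (trans (*-zeroʳ den) (sym (cong (_* (num * sum Z)) (*-zeroʳ (Y′ u))))))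
            go (no ¬p) = ≤-trans (≤-reflexive (solve 3 (λ x y z → x :* (y :* z) := y :* (x :* z)) refl den (Y′ u * 1) (degree G Z u)))
                           (*-monoʳ-≤ (Y′ u * 1) (<⇒≤ (≰⇒> ¬p)))
        decide : sum (part id) ≤ sum (part not) ⊎ sum (part not) ≤ sum (part id) →
          Any (Sparse (2 ^ suc (length Zs)) Y) (Z ∷ Zs) ⊎ Refinement Y (Z ∷ Zs)
        decide (inj₁ h) = inj₁ (here (sparse {B = Z} (part≤ not) (λ _ → ≤-refl) (half not parts h ≤-refl)
          (m≤n*m (sum Z) (2 ^ suc (length Zs)) {{m^n≢0 2 (suc (length Zs))}}) few))
        decide (inj₂ h) = inj₂ (refinement (part id) (part≤ id) (half id parts ≤-refl h) dense′)
          where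
          dense′ : ∀ u → 1 ≤ part id u → All (λ Z → Dense Z u) (Z ∷ Zs)
          dense′ u p = kept (dense? u) (*-posʳ (Y′ u) (𝟙 (test u)) p) ∷ dense u (*-posˡ (Y′ u) _ p)
            where
            kept : (d : Dec (Dense Z u)) → 1 ≤ 𝟙 (does d) → Dense Z u
            kept (yes d) _ = d

      record Extension (s c : ℕ) (U : Fin n → Bool) (Ys : List (Fin n → ℕ)) : Set where
        constructor extension
        field
          K      : List (Fin n)
          size   : length K ≡ s
          clique : Clique K
          inside : All (λ u → U u ≡ true) K
          rich   : All (λ Y → sum Y ≤ c * sum (restrict K Y)) Ys

      -- The only input of the embedding that differs between its two uses: edges from dependent
      -- random choice (`s` is 2) and triangles above density 2/3 (`s` is 3). At most three weights
      -- remain once the first of four is being treated.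
      Extendable : (s c L : ℕ) → Set
      Extendable s c L = ∀ U → n ≤ L * card U → ∀ Ys → length Ys ≤ 3 → All (λ Y → 1 ≤ sum Y) Ys →
        (∀ u → U u ≡ true → All (λ Y → Dense Y u) Ys) → Extension s c U Ys

      CliqueIn : List (Fin n → ℕ) → ℕ → Set
      CliqueIn Ys k = Σ (List (Fin n)) λ K → length K ≡ k × Clique K × All (λ v → Any (λ Y → 1 ≤ Y v) Ys) K

      module _ (s c L W : ℕ) (1≤n : 1 ≤ n) (1≤W : 1 ≤ W) (extend : Extendable s c L)
               (triangle : ∀ U → n ≤ L * card U → TriangleIn G U) where

        private
          W≢0 : NonZero W
          W≢0 = >-nonZero 1≤W

        large-support : ∀ {l} {Y : Fin n → ℕ} → l ≤ L → (∀ u → Y u ≤ W) → n * W ≤ l * sum Y → n ≤ L * card (support Y)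
        large-support {l} {Y} l≤L bounded large = *-cancelʳ-≤ n _ W {{W≢0}} (begin
          n * W                          ≤⟨ large ⟩
          l * sum Y                      ≤⟨ *-mono-≤ l≤L (sum≤card-support W Y bounded) ⟩
          L * (W * card (support Y))     ≡⟨ solve 3 (λ l w c → l :* (w :* c) := l :* c :* w) refl L W (card (support Y)) ⟩
          L * card (support Y) * W       ∎)
          where
          open ≤-Reasoning
          open +-*-Solver

        -- Greedy embedding: the first weight gives an `s`-clique `K`, and the other weights are cut
        -- down to the common neighbours of `K`. The last weight gives a triangle. The size
        -- `m * s + 3` is 9 both for `m = 3`, `s = 2` and for `m = 2`, `s = 3`. The only way to fail
        -- is a sparse pair in `refine`.
        embed : ∀ m l Y Ys → length Ys ≡ m → m ≤ 3 → All (λ Y → ∀ u → Y u ≤ W) (Y ∷ Ys) →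
          All (λ Y → n * W ≤ l * sum Y) (Y ∷ Ys) → demand c m l ≤ L →
          CliqueIn (Y ∷ Ys) (m * s + 3) ⊎ AnyPair (Sparse (sparseness c m)) (Y ∷ Ys)
        embed zero l Y [] refl _ (bounded ∷ _) (large ∷ _) l≤L
          with triangle (support Y) (large-support {l} {Y} l≤L bounded large)
        ... | u , v , w , (pu , pv , pw) , (uv , vw , uw) =
          inj₁ (u ∷ v ∷ w ∷ [] , refl , (uv ∷ uw ∷ []) ∷ (vw ∷ []) ∷ [] ∷ [] ,
                here (indicator-true pu) ∷ here (indicator-true pv) ∷ here (indicator-true pw) ∷ [])
        embed (suc m) l Y Ys len m≤3 (bounded ∷ boundeds) (large ∷ larges) demand≤L with refine Y Ys
        ... | inj₁ sp = inj₂ (head (Any.map (Sparse-mono (≤-trans (≤-reflexive (cong (2 ^_) len)) (m≤m+n _ _))) sp))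
        ... | inj₂ (refinement Y′ Y′≤Y large′ dense)
          with extend (support Y′)
                 (large-support {l * 2 ^ suc m} {Y′} (≤-trans (m≤m+n _ _) demand≤L) (λ u → ≤-trans (Y′≤Y u) (bounded u))
                   (≤-trans large (≤-trans (*-monoʳ-≤ l large′)
                     (≤-reflexive (trans (cong (λ k → l * (2 ^ k * sum Y′)) len) (sym (*-assoc l (2 ^ suc m) (sum Y′))))))))
                 Ys (subst (_≤ 3) (sym len) m≤3) (All.map (λ {Z} → nonempty {Z}) larges) (λ u p → dense u (indicator-true p))
          where
          nonempty : ∀ {Z} → n * W ≤ l * sum Z → 1 ≤ sum Z
          nonempty {Z} h = *-posʳ l (sum Z) (≤-trans (*-mono-≤ 1≤n 1≤W) h)
        ... | extension K size clique inside rich with Ys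
        ...   | Z ∷ Zs
          with embed m (l * c) (restrict K Z) (List.map (restrict K) Zs) (trans (length-map (restrict K) Zs) (suc-injective len))
                 (<⇒≤ m≤3) (All.map⁺ {f = restrict K} (All.map (λ {Z} h u → ≤-trans (restrict≤ K Z u) (h u)) boundeds))
                 (All.map⁺ {f = restrict K} (All.zipWith (λ { {Z} (g , h) → ≤-trans g (≤-trans (*-monoʳ-≤ l h) (≤-reflexive (sym (*-assoc l c (sum (restrict K Z)))))) }) (larges , rich)))
                 (≤-trans (m≤n+m _ _) demand≤L)
        -- A sparse pair within common neighbourhoods of `K` is sparse for the uncut weights too, at
        -- the cost of the factor `c`, since `K` is rich for both of them.
        ...     | inj₂ sp = inj₂ (tail (AnyPair-map
                  (λ {X} {Y} p q r → Sparse-mono (m≤n+m _ (2 ^ suc m)) (Sparse-extend c (restrict≤ K X) (restrict≤ K Y) p q r))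
                  rich (AnyPair-map⁻ (restrict K) sp)))
        ...     | inj₁ (K′ , size′ , clique′ , inside′) = inj₁ (K ++ K′ ,
                    trans (length-++ K) (trans (cong₂ _+_ size size′) (sym (+-assoc s (m * s) 3))) ,
                    AllPairs.++⁺ clique clique′ (All.tabulate λ {u} u∈K → All.map (λ {v} h → All.lookup (adjacent h) u∈K) inside′) ,
                    All.++⁺ (All.map (λ {u} p → here (≤-trans (indicator-true p) (Y′≤Y u))) inside)
                            (All.map (λ {v} h → there (Any.map (λ {Z} p → ≤-trans p (restrict≤ K Z v)) (Any.map⁻ {xs = Z ∷ Zs} h))) inside′))
          where
          adjacent : ∀ {v} → Any (λ Y → 1 ≤ Y v) (List.map (restrict K) (Z ∷ Zs)) → All (λ u → adj G u v ≡ true) K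
          adjacent {v} h with Any.satisfied (Any.map⁻ {xs = Z ∷ Zs} h)
          ... | Y , p = restrict-adjacent K Y v p

  -- Edges and triangles with many common neighbours

  -- The threshold `(2 * M + 3) / (3 * M)` is 2/3 + 1/M, so three degrees above it exceed twice the
  -- mass `s` by 3/M of it, and the excess is at most the mass `r` of the common neighbours. A
  -- factor 3 is given away.
  common-degree : ∀ M c s r x y z → M ≤ c → (2 * M + 3) * s ≤ 3 * M * x → (2 * M + 3) * s ≤ 3 * M * y → (2 * M + 3) * s ≤ 3 * M * z →
    x + (y + z) ≤ 2 * s + r → s ≤ c * r
  common-degree M c s r x y z M≤c hx hy hz h = ≤-trans (*-cancelˡ-≤ {s} {M * r} 9 (+-cancelˡ-≤ (6 * M * s) (9 * s) (9 * (M * r)) total)) (*-monoˡ-≤ r M≤c)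
    where
    open ≤-Reasoning
    open +-*-Solver
    total : 6 * M * s + 9 * s ≤ 6 * M * s + 9 * (M * r)
    total = begin
      6 * M * s + 9 * s
        ≡⟨ solve 2 (λ m s → con 6 :* m :* s :+ con 9 :* s := (con 2 :* m :+ con 3) :* s :+ ((con 2 :* m :+ con 3) :* s :+ (con 2 :* m :+ con 3) :* s)) refl M s ⟩
      (2 * M + 3) * s + ((2 * M + 3) * s + (2 * M + 3) * s) ≤⟨ +-mono-≤ hx (+-mono-≤ hy hz) ⟩
      3 * M * x + (3 * M * y + 3 * M * z)
        ≡⟨ solve 4 (λ m p q r → con 3 :* m :* p :+ (con 3 :* m :* q :+ con 3 :* m :* r) := con 3 :* m :* (p :+ (q :+ r))) refl M x y z ⟩
      3 * M * (x + (y + z))          ≤⟨ *-monoʳ-≤ (3 * M) h ⟩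
      3 * M * (2 * s + r)
        ≡⟨ solve 3 (λ m s r → con 3 :* m :* (con 2 :* s :+ r) := con 6 :* m :* s :+ con 3 :* (m :* r)) refl M s r ⟩
      6 * M * s + 3 * (M * r)        ≤⟨ +-monoʳ-≤ (6 * M * s) (*-monoˡ-≤ (M * r) (m≤m+n 3 6)) ⟩
      6 * M * s + 9 * (M * r)        ∎

  module _ (G : Graph n) where

    private
      a : Fin n → Fin n → ℕ
      a u v = 𝟙 (adj G u v)

    -- The threshold 1/M is written as `3 / (3 * M)` so that both kinds of obstruction have the
    -- denominator `3 * M`.
    edge-extendable : ∀ M L {q} → 1 ≤ M → 1 ≤ L → IsInverseRamsey 3 n q → indepNumber G ≤ q → order-threshold M L ≤ n →
      Threshold.Extendable G 3 (3 * M) 2 (edgeFactor M) L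
    edge-extendable M L M≥1 L≥1 ramsey α≤q N≤n U large Ys len pos dense
      with rich-edge-in-large-set M L M≥1 L≥1 ramsey G α≤q N≤n U large Ys len pos
             (λ u p → All.map (λ {Y} h → *-cancelˡ-≤ 3 (≤-trans h (≤-reflexive (*-assoc 3 M (degree G Y u))))) (dense u p))
    ... | u , v , pu , pv , e , rich = Threshold.extension (u ∷ v ∷ []) refl ((e ∷ []) ∷ [] ∷ []) (pu ∷ pv ∷ [])
      (All.map (λ {Y} h → ≤-trans h (≤-reflexive (cong (edgeFactor M *_)
        (sum-cong-≗ λ b → cong (λ t → Y b * (a u b * t)) (sym (*-identityʳ (a v b))))))) rich)

    three-degrees : ∀ Y u v w →
      degree G Y u + (degree G Y v + degree G Y w) ≤ 2 * sum Y + sum (restrict G (u ∷ v ∷ w ∷ []) Y)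
    three-degrees Y u v w = begin
      degree G Y u + (degree G Y v + degree G Y w)
        ≡⟨ trans (cong (degree G Y u +_) (sym (∑-distrib-+ (λ b → Y b * a v b) (λ b → Y b * a w b))))
                 (sym (∑-distrib-+ (λ b → Y b * a u b) (λ b → Y b * a v b + Y b * a w b))) ⟩
      sum (λ b → Y b * a u b + (Y b * a v b + Y b * a w b)) ≤⟨ ∑-mono pointwise ⟩
      sum (λ b → 2 * Y b + restrict G K Y b)                ≡⟨ ∑-distrib-+ (λ b → 2 * Y b) (restrict G K Y) ⟩
      sum (λ b → 2 * Y b) + sum (restrict G K Y)            ≡⟨ cong (_+ sum (restrict G K Y)) (*-distribˡ-sum 2 Y) ⟨
      2 * sum Y + sum (restrict G K Y)                      ∎
      where
      open ≤-Reasoning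
      open +-*-Solver
      K = u ∷ v ∷ w ∷ []
      bits : ∀ x y z → 𝟙 x + (𝟙 y + 𝟙 z) ≤ 2 + 𝟙 x * (𝟙 y * (𝟙 z * 1))
      bits true  true  true  = ≤-refl
      bits true  true  false = ≤-refl
      bits true  false true  = ≤-refl
      bits true  false false = n≤1+n _
      bits false true  true  = ≤-refl
      bits false true  false = n≤1+n _
      bits false false true  = n≤1+n _
      bits false false false = z≤n
      pointwise : ∀ b → Y b * a u b + (Y b * a v b + Y b * a w b) ≤ 2 * Y b + restrict G K Y b
      pointwise b = begin
        Y b * a u b + (Y b * a v b + Y b * a w b)
          ≡⟨ solve 4 (λ y p q r → y :* p :+ (y :* q :+ y :* r) := y :* (p :+ (q :+ r))) refl (Y b) (a u b) (a v b) (a w b) ⟩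
        Y b * (a u b + (a v b + a w b))                  ≤⟨ *-monoʳ-≤ (Y b) (bits (adj G u b) (adj G v b) (adj G w b)) ⟩
        Y b * (2 + ∏ (λ u → a u b) K)                    ≡⟨ solve 2 (λ y p → y :* (con 2 :+ p) := con 2 :* y :+ y :* p) refl (Y b) (∏ (λ u → a u b) K) ⟩
        2 * Y b + Y b * ∏ (λ u → a u b) K                ∎

    triangle-extendable : ∀ M c L → M ≤ c → (∀ U → n ≤ L * card U → TriangleIn G U) →
      Threshold.Extendable G (2 * M + 3) (3 * M) 3 c L
    triangle-extendable M c L M≤c triangle U large Ys _ _ dense with triangle U large
    ... | u , v , w , (pu , pv , pw) , (uv , vw , uw) =
      Threshold.extension K refl ((uv ∷ uw ∷ []) ∷ (vw ∷ []) ∷ [] ∷ []) (pu ∷ pv ∷ pw ∷ [])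
        (All.zipWith (λ { {Y} (x , y , z) → rich Y x y z }) (dense u pu , All.zip (dense v pv , dense w pw)))
      where
      K = u ∷ v ∷ w ∷ []
      rich : ∀ Y → (2 * M + 3) * sum Y ≤ 3 * M * degree G Y u → (2 * M + 3) * sum Y ≤ 3 * M * degree G Y v →
        (2 * M + 3) * sum Y ≤ 3 * M * degree G Y w → sum Y ≤ c * sum (restrict G K Y)
      rich Y p q r = common-degree M c (sum Y) (sum (restrict G K Y)) (degree G Y u) (degree G Y v) (degree G Y w)
        M≤c p q r (three-degrees Y u v w)

    clique⇒HasClique : ∀ {K} → Clique G K → HasClique (length K) G
    clique⇒HasClique {K} clique = List.lookup K , injective , adjacent
      where
      pairwise : ∀ {K : List (Fin n)} → Clique G K → ∀ i j → i ≢ j → adj G (List.lookup K i) (List.lookup K j) ≡ true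
      pairwise (p ∷ ps) zero    zero    i≢j = ⊥-elim (i≢j refl)
      pairwise (p ∷ ps) zero    (suc j) i≢j = All.lookup p (∈-lookup j)
      pairwise (p ∷ ps) (suc i) zero    i≢j = trans (Graph.sym G _ _) (All.lookup p (∈-lookup i))
      pairwise (p ∷ ps) (suc i) (suc j) i≢j = pairwise ps i j (i≢j ∘ cong suc)
      adjacent : ∀ i j → i ≢ j → adj G (List.lookup K i) (List.lookup K j) ≡ true
      adjacent = pairwise clique
      injective : Injective _≡_ _≡_ (List.lookup K)
      injective {i} {j} e with i Fin.≟ j
      ... | yes p = p
      ... | no ¬p with () ← trans (sym (irrefl G (List.lookup K j))) (trans (cong (λ x → adj G x (List.lookup K j)) (sym e)) (adjacent i j ¬p))

  -- A weighted Turán bound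

  ∑-mono-< : {f g : Fin n → ℕ} → (∀ i → f i ≤ g i) → ∀ i → f i < g i → sum f < sum g
  ∑-mono-< h zero    l = +-mono-<-≤ l (∑-mono (h ∘ suc))
  ∑-mono-< h (suc i) l = +-mono-≤-< (h zero) (∑-mono-< (h ∘ suc) i l)

  listSum : {A : Set} → (A → ℕ) → List A → ℕ
  listSum f xs = ListAction.sum (List.map f xs)

  multiplicity : List (Fin k) → Fin k → ℕ
  multiplicity K i = listSum (λ p → 𝟙 (does (p Fin.≟ i))) K

  ∑-multiplicity : (K : List (Fin k)) (f : Fin k → ℕ) → sum (λ i → multiplicity K i * f i) ≡ listSum f K
  ∑-multiplicity {k} [] f = sum-replicate-zero k
  ∑-multiplicity (p ∷ K) f = trans (sum-cong-≗ (λ i → *-distribʳ-+ (f i) (𝟙 (does (p Fin.≟ i))) (multiplicity K i)))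
    (trans (∑-distrib-+ (λ i → 𝟙 (does (p Fin.≟ i)) * f i) (λ i → multiplicity K i * f i)) (cong₂ _+_ (∑-≟ f p) (∑-multiplicity K f)))

  listSum-one : {A : Set} (xs : List A) → listSum (λ _ → 1) xs ≡ length xs
  listSum-one []       = refl
  listSum-one (x ∷ xs) = cong suc (listSum-one xs)

  ∑-multiplicity-one : (K : List (Fin k)) → sum (multiplicity K) ≡ length K
  ∑-multiplicity-one K = trans (sum-cong-≗ (λ i → sym (*-identityʳ (multiplicity K i)))) (trans (∑-multiplicity K (λ _ → 1)) (listSum-one K))

  ∈⇒multiplicity : {K : List (Fin k)} {p : Fin k} → p ∈ K → 1 ≤ multiplicity K p
  ∈⇒multiplicity {p = p} (here refl) = ≤-trans (≤-reflexive (cong 𝟙 (sym (≟-refl p)))) (m≤m+n _ _)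
  ∈⇒multiplicity (there i) = ≤-trans (∈⇒multiplicity i) (m≤n+m _ _)

  multiplicity⇒∈ : (K : List (Fin k)) {p : Fin k} → 1 ≤ multiplicity K p → p ∈ K
  multiplicity⇒∈ (q ∷ K) {p} h with q Fin.≟ p
  ... | yes refl = here refl
  ... | no _     = there (multiplicity⇒∈ K h)

  -- Finds the coordinate that vanishes first when growing multiples of `y` are subtracted from `x`.
  -- Ratios are compared by cross multiplication, and cancelling `y i` is where positivity enters.
  least-ratio : (x y : Fin k → ℕ) (p : Fin k) (K : List (Fin k)) → All (λ q → 1 ≤ y q) (p ∷ K) →
    ∃[ i ] (i ∈ p ∷ K × All (λ q → x i * y q ≤ x q * y i) (p ∷ K))
  least-ratio x y p [] _ = p , here refl , ≤-refl ∷ []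
  least-ratio x y p (q ∷ K) (hp ∷ hs) with least-ratio x y q K hs
  ... | i , i∈ , least with ≤-total (x i * y p) (x p * y i)
  ...   | inj₁ h = i , there i∈ , h ∷ least
  ...   | inj₂ h = p , here refl , ≤-refl ∷ All.map (λ {r} g → through r g) least
    where
    open ≤-Reasoning
    open +-*-Solver
    through : ∀ r → x i * y r ≤ x r * y i → x p * y r ≤ x r * y p
    through r g = *-cancelʳ-≤ _ _ (y i) {{>-nonZero (All.lookup hs i∈)}} (begin
      x p * y r * y i    ≡⟨ solve 3 (λ a b c → a :* b :* c := a :* c :* b) refl (x p) (y r) (y i) ⟩
      x p * y i * y r    ≤⟨ *-monoˡ-≤ (y r) h ⟩
      x i * y p * y r    ≡⟨ solve 3 (λ a b c → a :* b :* c := a :* c :* b) refl (x i) (y p) (y r) ⟩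
      x i * y r * y p    ≤⟨ *-monoˡ-≤ (y p) g ⟩
      x r * y i * y p    ≡⟨ solve 3 (λ a b c → a :* b :* c := a :* c :* b) refl (x r) (y i) (y p) ⟩
      x r * y p * y i    ∎)

  module QuadraticForm (w : Fin k → Fin k → ℕ) (w-sym : ∀ i j → w i j ≡ w j i) where

    row : (Fin k → ℕ) → Fin k → ℕ
    row x i = sum λ j → w i j * x j

    form : (Fin k → ℕ) → ℕ
    form x = sum λ i → x i * row x i

    -- For entries in units of 1/3 the ratio 9/5 is the density 3/5.
    SatisfiesBound : (Fin k → ℕ) → Set
    SatisfiesBound x = 5 * form x ≤ 9 * (sum x * sum x)

    -- A multiset K whose rows are at most 9/5 on the support of x can be subtracted from a multiple
    -- of x, until a coordinate vanishes, without losing the bound.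
    subtract : (x : Fin k → ℕ) (p : Fin k) (K : List (Fin k)) → All (λ q → 1 ≤ x q) (p ∷ K) →
      (∀ v → 1 ≤ x v → 5 * listSum (w v) (p ∷ K) ≤ 9 * length (p ∷ K)) →
      (∀ z → card (support z) < card (support x) → SatisfiesBound z) → SatisfiesBound x
    subtract x p K′ K⊆x rows ih with least-ratio x (multiplicity (p ∷ K′)) p K′ (All.tabulate ∈⇒multiplicity)
    ... | i₀ , i₀∈K , least = *-cancelˡ-≤ (c * c) {{m*n≢0 c c {{c≢0}} {{c≢0}}}} (begin
      c * c * (5 * form x)     ≡⟨ solve 2 (λ c f → c :* c :* (con 5 :* f) := con 5 :* (c :* c :* f)) refl c (form x) ⟩
      5 * (c * c * form x)     ≡⟨ cong (5 *_) expand ⟩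
      5 * (s * s * yy + (s * yz + (s * yz + zz)))
        ≡⟨ solve 4 (λ s a b d → con 5 :* (s :* s :* a :+ (s :* b :+ (s :* b :+ d))) := s :* s :* (con 5 :* a) :+ (con 2 :* s :* (con 5 :* b) :+ con 5 :* d)) refl s yy yz zz ⟩
      s * s * (5 * yy) + (2 * s * (5 * yz) + 5 * zz)
        -- The supports of `y` and `z` lie in that of `x`, so the row hypothesis bounds `yy` and the
        -- mixed term, and induction is needed for `zz` only. The three bounds add up to a perfect
        -- square.
        ≤⟨ +-mono-≤ (*-monoʳ-≤ (s * s) yy≤) (+-mono-≤ (*-monoʳ-≤ (2 * s) yz≤) (ih z smaller)) ⟩
      s * s * (μ * (9 * μ)) + (2 * s * (sum z * (9 * μ)) + 9 * (sum z * sum z))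
        ≡⟨ solve 3 (λ s μ z → s :* s :* (μ :* (con 9 :* μ)) :+ (con 2 :* s :* (z :* (con 9 :* μ)) :+ con 9 :* (z :* z)) := con 9 :* ((s :* μ :+ z) :* (s :* μ :+ z))) refl s μ (sum z) ⟩
      9 * ((s * μ + sum z) * (s * μ + sum z)) ≡⟨ cong (λ t → 9 * (t * t)) total ⟨
      9 * (c * sum x * (c * sum x))           ≡⟨ solve 2 (λ c x → con 9 :* (c :* x :* (c :* x)) := c :* c :* (con 9 :* (x :* x))) refl c (sum x) ⟩
      c * c * (9 * (sum x * sum x))           ∎)
      where
      open ≤-Reasoning
      open +-*-Solver
      K = p ∷ K′
      y = multiplicity K
      μ = length K
      -- The scaling by `c` clears the denominator of the ratio `s / c`: the remainder `c x − s y`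
      -- is nonnegative and vanishes at `i₀`.
      c = y i₀
      s = x i₀
      c≢0 : NonZero c
      c≢0 = >-nonZero (∈⇒multiplicity i₀∈K)
      z : Fin k → ℕ
      z i = c * x i ∸ s * y i
      s*y≤c*x : ∀ i → s * y i ≤ c * x i
      s*y≤c*x i with y i in e
      ... | zero  = ≤-trans (≤-reflexive (*-zeroʳ s)) z≤n
      ... | suc t = ≤-trans (≤-reflexive (cong (s *_) (sym e)))
        (≤-trans (All.lookup least (multiplicity⇒∈ K (≤-trans (s≤s z≤n) (≤-reflexive (sym e))))) (≤-reflexive (*-comm (x i) c)))
      decompose : ∀ i → c * x i ≡ s * y i + z i
      decompose i = sym (m+[n∸m]≡n (s*y≤c*x i))
      y⊆x : ∀ i → 1 ≤ y i → 1 ≤ x i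
      y⊆x i h = All.lookup K⊆x (multiplicity⇒∈ K h)
      z⊆x : ∀ i → 1 ≤ z i → 1 ≤ x i
      z⊆x i h with x i
      ... | suc _ = s≤s z≤n
      ... | zero with () ← ≤-trans h (≤-trans (m∸n≤m (c * 0) (s * y i)) (≤-reflexive (*-zeroʳ c)))
      z-i₀ : z i₀ ≡ 0
      z-i₀ = trans (cong (_∸ s * c) (*-comm c s)) (n∸n≡0 (s * c))
      smaller : card (support z) < card (support x)
      smaller = ∑-mono-< pointwise i₀ drop
        where
        drop : 𝟙 (support z i₀) < 𝟙 (support x i₀)
        drop rewrite z-i₀ with x i₀ | y⊆x i₀ (∈⇒multiplicity i₀∈K)
        ... | suc _ | _ = s≤s z≤n
        pointwise : ∀ i → 𝟙 (support z i) ≤ 𝟙 (support x i)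
        pointwise i with z i | z⊆x i
        ... | zero  | _ = z≤n
        ... | suc _ | h with x i | h (s≤s z≤n)
        ...   | suc _ | _ = ≤-refl
      total : c * sum x ≡ s * μ + sum z
      total = trans (*-distribˡ-sum c x) (trans (sum-cong-≗ decompose) (trans (∑-distrib-+ (λ i → s * y i) z)
        (cong (_+ sum z) (trans (sym (*-distribˡ-sum s y)) (cong (s *_) (∑-multiplicity-one K))))))
      pairing : (Fin k → ℕ) → (Fin k → ℕ) → ℕ
      pairing u v = sum λ i → u i * row v i
      yy = pairing y y
      yz = pairing z y
      zz = form z
      pairing-comm : ∀ u v → pairing u v ≡ pairing v u
      pairing-comm u v = trans (sum-cong-≗ (λ i → *-distribˡ-sum (u i) (λ j → w i j * v j)))
        (trans (∑-comm (λ i j → u i * (w i j * v j))) (sum-cong-≗ λ j → trans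
          (sum-cong-≗ λ i → trans (cong (λ t → u i * (t * v j)) (w-sym i j)) (solve 3 (λ a b d → a :* (b :* d) := d :* (b :* a)) refl (u i) (w j i) (v j)))
          (sym (*-distribˡ-sum (v j) (λ i → w j i * u i)))))
      row-c : ∀ i → c * row x i ≡ s * row y i + row z i
      row-c i = trans (*-distribˡ-sum c (λ j → w i j * x j)) (trans (sum-cong-≗ λ j →
          trans (solve 3 (λ c w x → c :* (w :* x) := w :* (c :* x)) refl c (w i j) (x j))
          (trans (cong (w i j *_) (decompose j)) (solve 4 (λ w s y z → w :* (s :* y :+ z) := s :* (w :* y) :+ w :* z) refl (w i j) s (y j) (z j))))
        (trans (∑-distrib-+ (λ j → s * (w i j * y j)) (λ j → w i j * z j)) (cong (_+ row z i) (sym (*-distribˡ-sum s (λ j → w i j * y j))))))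
      expand : c * c * form x ≡ s * s * yy + (s * yz + (s * yz + zz))
      expand = begin-equality
        c * c * form x ≡⟨ *-distribˡ-sum (c * c) (λ i → x i * row x i) ⟩
        sum (λ i → c * c * (x i * row x i)) ≡⟨ sum-cong-≗ term ⟩
        sum (λ i → s * s * (y i * row y i) + (s * (y i * row z i) + (s * (z i * row y i) + z i * row z i)))
          ≡⟨ trans (∑-distrib-+ (λ i → s * s * (y i * row y i)) (λ i → s * (y i * row z i) + (s * (z i * row y i) + z i * row z i)))
              (cong₂ _+_ (sym (*-distribˡ-sum (s * s) (λ i → y i * row y i)))
             (trans (∑-distrib-+ (λ i → s * (y i * row z i)) (λ i → s * (z i * row y i) + z i * row z i))
              (cong₂ _+_ (sym (*-distribˡ-sum s (λ i → y i * row z i)))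
             (trans (∑-distrib-+ (λ i → s * (z i * row y i)) (λ i → z i * row z i))
              (cong (_+ form z) (sym (*-distribˡ-sum s (λ i → z i * row y i)))))))) ⟩
        s * s * yy + (s * pairing y z + (s * yz + zz)) ≡⟨ cong (λ t → s * s * yy + (s * t + (s * yz + zz))) (pairing-comm y z) ⟩
        s * s * yy + (s * yz + (s * yz + zz)) ∎
        where
        term : ∀ i → c * c * (x i * row x i) ≡ s * s * (y i * row y i) + (s * (y i * row z i) + (s * (z i * row y i) + z i * row z i))
        term i = trans (solve 3 (λ c x r → c :* c :* (x :* r) := (c :* x) :* (c :* r)) refl c (x i) (row x i))
          (trans (cong₂ _*_ (decompose i) (row-c i))
            (solve 5 (λ s y z p q → (s :* y :+ z) :* (s :* p :+ q) := s :* s :* (y :* p) :+ (s :* (y :* q) :+ (s :* (z :* p) :+ z :* q))) refl s (y i) (z i) (row y i) (row z i)))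
      row-y : ∀ v → 1 ≤ x v → 5 * row y v ≤ 9 * μ
      row-y v h = ≤-trans (≤-reflexive (cong (5 *_) (trans (sum-cong-≗ (λ j → *-comm (w v j) (y j))) (∑-multiplicity K (w v))))) (rows v h)
      pairing≤ : ∀ u → (∀ i → 1 ≤ u i → 1 ≤ x i) → 5 * pairing u y ≤ sum u * (9 * μ)
      pairing≤ u u⊆x = begin
        5 * pairing u y                   ≡⟨ *-distribˡ-sum 5 (λ i → u i * row y i) ⟩
        sum (λ i → 5 * (u i * row y i))   ≤⟨ ∑-mono pointwise ⟩
        sum (λ i → u i * (9 * μ))         ≡⟨ *-distribʳ-sum (9 * μ) u ⟨
        sum u * (9 * μ)                   ∎
        where
        pointwise : ∀ i → 5 * (u i * row y i) ≤ u i * (9 * μ)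
        pointwise i with u i | u⊆x i
        ... | zero  | _ = z≤n
        ... | suc t | h = ≤-trans (≤-reflexive (solve 2 (λ a b → con 5 :* (a :* b) := a :* (con 5 :* b)) refl (suc t) (row y i)))
          (*-monoʳ-≤ (suc t) (row-y i (h (s≤s z≤n))))
      yy≤ : 5 * yy ≤ μ * (9 * μ)
      yy≤ = ≤-trans (pairing≤ y y⊆x) (≤-reflexive (cong (_* (9 * μ)) (∑-multiplicity-one K)))
      yz≤ : 5 * yz ≤ sum z * (9 * μ)
      yz≤ = pairing≤ z z⊆x

  -- The Turán bound for absent, light and heavy pairs

  -- A pair is absent (0F), light (1F) or heavy (2F); the values are densities in units of 1/3.
  Tier : Set
  Tier = Fin 3

  value : Tier → ℕ
  value 0F = 0
  value 1F = 2
  value 2F = 3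

  -- Here `p` belongs to the apex, which is heavy to the other two vertices. The bound 18 is 9/5 of
  -- the total multiplicity 10 and is attained, for instance, at tiers `(0F , 2F , 2F)` and
  -- `(2F , 1F , 0F)`.
  check-cherry : ∀ p q r → ¬ (p ≢ 0F × q ≢ 0F × r ≢ 0F) → ¬ (p ≡ 2F × q ≡ 2F) → ¬ (p ≡ 2F × r ≡ 2F) →
    4 * value p + (3 * value q + 3 * value r) ≤ 18
  check-cherry = toWitness {a? = Fin.all? λ p → Fin.all? λ q → Fin.all? λ r →
    ¬? (¬? (p Fin.≟ 0F) ×-dec ¬? (q Fin.≟ 0F) ×-dec ¬? (r Fin.≟ 0F)) →-dec
    (¬? ((p Fin.≟ 2F) ×-dec (q Fin.≟ 2F)) →-dec (¬? ((p Fin.≟ 2F) ×-dec (r Fin.≟ 2F)) →-dec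
    (4 * value p + (3 * value q + 3 * value r) ≤? 18)))} _

  check-triangle : ∀ p q r → ¬ (p ≢ 0F × q ≢ 0F × r ≢ 0F) → ¬ (p ≡ 2F × q ≡ 2F) → ¬ (p ≡ 2F × r ≡ 2F) → ¬ (q ≡ 2F × r ≡ 2F) →
    value p + (value q + value r) ≤ 5
  check-triangle = toWitness {a? = Fin.all? λ p → Fin.all? λ q → Fin.all? λ r →
    ¬? (¬? (p Fin.≟ 0F) ×-dec ¬? (q Fin.≟ 0F) ×-dec ¬? (r Fin.≟ 0F)) →-dec
    (¬? ((p Fin.≟ 2F) ×-dec (q Fin.≟ 2F)) →-dec (¬? ((p Fin.≟ 2F) ×-dec (r Fin.≟ 2F)) →-dec (¬? ((q Fin.≟ 2F) ×-dec (r Fin.≟ 2F)) →-dec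
    (value p + (value q + value r) ≤? 5))))} _

  check-edge : ∀ p q → ¬ (p ≢ 0F × q ≢ 0F) → value p + value q ≤ 3
  check-edge = toWitness {a? = Fin.all? λ p → Fin.all? λ q →
    ¬? (¬? (p Fin.≟ 0F) ×-dec ¬? (q Fin.≟ 0F)) →-dec (value p + value q ≤? 3)} _

  -- The vertices in the hypotheses may coincide: `no-K₄ a a a a` makes the diagonal absent, and in
  -- the row estimates `v` may belong to the configuration itself.
  module WeightedTurán (t : Fin k → Fin k → Tier) (t-sym : ∀ i j → t i j ≡ t j i)
    (no-K₄ : ∀ a b c d → ¬ (t a b ≢ 0F × t a c ≢ 0F × t a d ≢ 0F × t b c ≢ 0F × t b d ≢ 0F × t c d ≢ 0F))
    (no-heavy-triangle : ∀ a b c → ¬ (t a b ≡ 2F × t a c ≡ 2F × t b c ≡ 2F)) where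

    open QuadraticForm (λ i j → value (t i j)) (λ i j → cong value (t-sym i j))

    private
      2F≢0F : ∀ {p : Tier} → p ≡ 2F → p ≢ 0F
      2F≢0F refl ()

    bounded : ∀ c x → card (support x) ≤ c → SatisfiesBound x
    -- The configurations are tried from the richest down. A triangle with two heavy pairs comes
    -- first. Once the support has none, no vertex of it is heavy to two vertices of a triangle
    -- there, so any triangle has small rows. Without triangles an edge does, and without edges the
    -- form vanishes.
    step : ∀ c x → card (support x) ≤ c → (∀ z → card (support z) < card (support x) → SatisfiesBound z) → SatisfiesBound x

    bounded zero x h = step zero x h (λ z l → ⊥-elim (n≮0 (<-≤-trans l h)))
    bounded (suc c) x h = step (suc c) x h (λ z l → bounded c z (s≤s⁻¹ (≤-trans l h)))

    step c x h ih
      with Fin.any? (λ a → Fin.any? λ b → Fin.any? λ d → (1 ≤? x a) ×-dec (1 ≤? x b) ×-dec (1 ≤? x d) ×-dec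
             (t a b Fin.≟ 2F) ×-dec (t a d Fin.≟ 2F) ×-dec ¬? (t b d Fin.≟ 0F))
    ... | yes (a , b , d , xa , xb , xd , ab , ad , bd) =
      -- The pair `b d` is light, as there is no heavy triangle, and the ratio 4 : 3 : 3 equalises
      -- the rows: 9 + 9 at `a`, and 12 + 6 at `b` and at `d`.
      subtract x a (a ∷ a ∷ a ∷ b ∷ b ∷ b ∷ d ∷ d ∷ d ∷ []) (xa ∷ xa ∷ xa ∷ xa ∷ xb ∷ xb ∷ xb ∷ xd ∷ xd ∷ xd ∷ [])
        (λ v _ → ≤-trans (≤-reflexive (solve 3 (λ p q r → con 5 :* (p :+ (p :+ (p :+ (p :+ (q :+ (q :+ (q :+ (r :+ (r :+ (r :+ con 0)))))))))) :=
             con 5 :* (con 4 :* p :+ (con 3 :* q :+ con 3 :* r))) refl (value (t v a)) (value (t v b)) (value (t v d))))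
          (*-monoʳ-≤ 5 (check-cherry (t v a) (t v b) (t v d)
            (λ { (p , q , r) → no-K₄ v a b d (p , q , r , 2F≢0F ab , 2F≢0F ad , bd) })
            (λ { (p , q) → no-heavy-triangle v a b (p , q , ab) })
            (λ { (p , r) → no-heavy-triangle v a d (p , r , ad) })))) ih
      where open +-*-Solver
    ... | no ¬cherry
      with Fin.any? (λ a → Fin.any? λ b → Fin.any? λ d → (1 ≤? x a) ×-dec (1 ≤? x b) ×-dec (1 ≤? x d) ×-dec
             ¬? (t a b Fin.≟ 0F) ×-dec ¬? (t a d Fin.≟ 0F) ×-dec ¬? (t b d Fin.≟ 0F))
    ...   | yes (a , b , d , xa , xb , xd , ab , ad , bd) =
      subtract x a (b ∷ d ∷ []) (xa ∷ xb ∷ xd ∷ [])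
        (λ v xv → ≤-trans (≤-trans (≤-reflexive (solve 3 (λ p q r → con 5 :* (p :+ (q :+ (r :+ con 0))) := con 5 :* (p :+ (q :+ r))) refl (value (t v a)) (value (t v b)) (value (t v d))))
          (*-monoʳ-≤ 5 (check-triangle (t v a) (t v b) (t v d)
            (λ { (p , q , r) → no-K₄ v a b d (p , q , r , ab , ad , bd) })
            (λ { (p , q) → ¬cherry (v , a , b , xv , xa , xb , p , q , ab) })
            (λ { (p , r) → ¬cherry (v , a , d , xv , xa , xd , p , r , ad) })
            (λ { (q , r) → ¬cherry (v , b , d , xv , xb , xd , q , r , bd) })))) (m≤m+n 25 2)) ih
      where open +-*-Solver
    ...   | no ¬triangle
      with Fin.any? (λ a → Fin.any? λ b → (1 ≤? x a) ×-dec (1 ≤? x b) ×-dec ¬? (t a b Fin.≟ 0F))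
    ...     | yes (a , b , xa , xb , ab) =
      subtract x a (b ∷ []) (xa ∷ xb ∷ [])
        (λ v xv → ≤-trans (≤-trans (≤-reflexive (cong (5 *_) (cong (value (t v a) +_) (+-identityʳ (value (t v b))))))
          (*-monoʳ-≤ 5 (check-edge (t v a) (t v b) (λ { (p , q) → ¬triangle (v , a , b , xv , xa , xb , p , q , ab) })))) (m≤m+n 15 3)) ih
    ...     | no ¬edge = ≤-trans (*-monoʳ-≤ 5 (∑-≤-const {k} 0 vanish)) (≤-trans (≤-reflexive (trans (cong (5 *_) (*-zeroʳ k)) refl)) z≤n)
      where
      vanish : ∀ i → x i * row x i ≤ 0
      vanish i with x i in e
      ... | zero  = z≤n
      ... | suc s = ≤-trans (*-monoʳ-≤ (suc s) (∑-≤-const {k} 0 zero-term)) (≤-reflexive (trans (cong (suc s *_) (*-zeroʳ k)) (*-zeroʳ (suc s))))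
        where
        zero-term : ∀ j → value (t i j) * x j ≤ 0
        zero-term j with t i j Fin.≟ 0F | x j in f
        ... | yes p | _     = ≤-reflexive (cong (λ q → value q * _) p)
        ... | no _  | zero  = ≤-reflexive (*-zeroʳ (value (t i j)))
        ... | no q  | suc r = ⊥-elim (¬edge (i , j , subst (1 ≤_) (sym e) (s≤s z≤n) , subst (1 ≤_) (sym f) (s≤s z≤n) , q))

    turán : 5 * sum (λ i → sum λ j → value (t i j)) ≤ 9 * (k * k)
    turán = subst₂ (λ f s → 5 * f ≤ 9 * (s * s))
      (sum-cong-≗ λ i → trans (*-identityˡ _) (sum-cong-≗ λ j → *-identityʳ (value (t i j))))
      (trans (∑-const k 1) (*-identityʳ k))
      (bounded _ (λ _ → 1) ≤-refl)

module Density where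

  open import Defs hiding (sym)
  open import Data.Nat as ℕ using (ℕ; zero; suc; s≤s; z≤n; _<ᵇ_)
  import Data.Nat.Properties as ℕ
  open import Data.Nat.Coprimality using (1-coprimeTo) renaming (sym to coprime-sym)
  open import Data.Nat.Solver using () renaming (module +-*-Solver to ℕ-Solver)
  import Data.Integer as ℤ
  import Data.Integer.Properties as ℤ
  import Data.Rational as ℚ
  import Data.Rational.Properties as ℚ
  open import Data.Rational using (ℚ; 0ℚ; 1ℚ; mkℚ; _≤_; _<_; *≤*)
  open import Data.Rational.Properties using (≤-refl; ≤-trans; ≤-reflexive; ≤-total; <⇒≤; ≰⇒>; <-irrefl; <-≤-trans; module ≤-Reasoning)
  open import Data.Rational.Solver using (module +-*-Solver)
  import Data.Rational.Unnormalised as ℚᵘ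
  import Data.Rational.Unnormalised.Properties as ℚᵘ
  open import Data.Bool using (Bool; true; false; if_then_else_; _∧_)
  open import Data.Fin using (Fin; zero; suc; toℕ)
  open import Data.Fin.Patterns
  import Data.Fin.Properties as Fin
  open import Data.List as List using (List; []; _∷_; length; allFin; cartesianProduct; _++_)
  open import Data.List.Relation.Unary.Any using (Any; here; there)
  open import Data.List.Relation.Unary.All as All using (All; []; _∷_)
  import Data.List.Relation.Unary.All.Properties as All
  open import Data.List.Relation.Unary.AllPairs using (AllPairs; []; _∷_)
  open import Data.Product using (_×_; _,_; Σ; ∃-syntax; proj₁; proj₂)
  open import Data.Sum using (_⊎_; inj₁; inj₂)
  open import Data.Empty using (⊥; ⊥-elim)
  open import Relation.Binary.PropositionalEquality
  open import Relation.Nullary using (Dec; yes; no; does)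
  open import Relation.Nullary.Decidable using (_×-dec_; ¬?)
  open import Function using (_∘_)
  import Algebra.Properties.Semiring.Sum as SemiringSum
  open import Algebra.Bundles using (CommutativeRing)
  open import Algebra.Structures using (IsCommutativeRing)
  open import Algebra.Properties.Semiring.Sum ℕ.+-*-semiring
    using (sum; sum-cong-≗; ∑-distrib-+; ∑-comm; *-distribˡ-sum; *-distribʳ-sum)
  open Combinatorics

  private variable
    n : ℕ

  -- Rational arithmetic

  infixl 6 _+_ _-_
  infixl 7 _*_
  infix 8 -_
  infix 4 _≤?_

  -- Opaque, since the operations of ℚ unfold even on variables, which makes unification infeasible.
  opaque

    _+_ _*_ : ℚ → ℚ → ℚ
    _+_ = ℚ._+_
    _*_ = ℚ._*_

    -_ : ℚ → ℚ
    -_ = ℚ.-_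

    _≤?_ : ∀ p q → Dec (p ≤ q)
    _≤?_ = ℚ._≤?_

    ι : ℕ → ℚ
    ι n = mkℚ (ℤ.+ n) 0 (coprime-sym (1-coprimeTo n))

    inv : ℕ → ℚ
    inv zero    = 0ℚ
    inv (suc n) = ℚ.1/ mkℚ (ℤ.+ suc n) 0 (coprime-sym (1-coprimeTo (suc n)))

  _-_ : ℚ → ℚ → ℚ
  p - q = p + - q

  opaque
    unfolding _+_ _*_ -_ ι inv

    ring-laws : IsCommutativeRing _≡_ _+_ _*_ -_ 0ℚ 1ℚ
    ring-laws = ℚ.+-*-isCommutativeRing

    +≡ : ∀ p q → p + q ≡ p ℚ.+ q
    +≡ p q = refl

    *≡ : ∀ p q → p * q ≡ p ℚ.* q
    *≡ p q = refl

    ι≡ : ∀ n → ℤ.+ n ℚ./ 1 ≡ ι n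
    ι≡ n = ℚ.↥p/↧p≡p (mkℚ (ℤ.+ n) 0 (coprime-sym (1-coprimeTo n)))

    ι-0 : ι 0 ≡ 0ℚ
    ι-0 = refl

    ι-1 : ι 1 ≡ 1ℚ
    ι-1 = refl

    ι-+ : ∀ m n → ι (m ℕ.+ n) ≡ ι m + ι n
    ι-+ m n = ℚ.toℚᵘ-injective (ℚᵘ.≃-trans (ℚᵘ.*≡* (cong (ℤ._* ℤ.+ 1)
      (sym (cong₂ ℤ._+_ (ℤ.*-identityʳ (ℤ.+ m)) (ℤ.*-identityʳ (ℤ.+ n)))))) (ℚᵘ.≃-sym (ℚ.toℚᵘ-homo-+ (ι m) (ι n))))

    ι-* : ∀ m n → ι (m ℕ.* n) ≡ ι m * ι n
    ι-* m n = ℚ.toℚᵘ-injective (ℚᵘ.≃-trans (ℚᵘ.*≡* (cong (ℤ._* ℤ.+ 1) (ℤ.pos-* m n))) (ℚᵘ.≃-sym (ℚ.toℚᵘ-homo-* (ι m) (ι n))))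

    ι-mono : ∀ {m n} → m ℕ.≤ n → ι m ≤ ι n
    ι-mono {m} {n} h = *≤* (subst₂ ℤ._≤_ (sym (ℤ.*-identityʳ (ℤ.+ m))) (sym (ℤ.*-identityʳ (ℤ.+ n))) (ℤ.+≤+ h))

    ι-cancel : ∀ {m n} → ι m ≤ ι n → m ℕ.≤ n
    ι-cancel {m} {n} (*≤* h) = ℤ.drop‿+≤+ (subst₂ ℤ._≤_ (ℤ.*-identityʳ (ℤ.+ m)) (ℤ.*-identityʳ (ℤ.+ n)) h)

    archimedean : ∀ {p} → 0ℚ < p → ∃[ N ] (1 ℕ.≤ N × 1ℚ ≤ ι N * p)
    archimedean {mkℚ (ℤ.+ suc a) d c} _ = suc d , ℕ.s≤s ℕ.z≤n , ℚ.toℚᵘ-cancel-≤ (ℚᵘ.≤-respʳ-≃ (ℚᵘ.≃-sym (ℚ.toℚᵘ-homo-* (ι (suc d)) (mkℚ (ℤ.+ suc a) d c)))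
      (ℚᵘ.*≤* (ℤ.+≤+ (bound a d))))
      where
      bound : ∀ a d → 1 ℕ.* (1 ℕ.* suc d) ℕ.≤ suc d ℕ.* suc a ℕ.* 1
      bound a d = subst₂ ℕ._≤_ (trans (sym (ℕ.*-identityˡ _)) (sym (ℕ.*-identityˡ _))) (sym (ℕ.*-identityʳ _)) (ℕ.m≤m*n (suc d) (suc a))
    archimedean {mkℚ (ℤ.+ 0) d c} (ℚ.*<* (ℤ.+<+ ()))
    archimedean {mkℚ ℤ.-[1+ a ] d c} (ℚ.*<* ())

    half+half : inv 2 + inv 2 ≡ 1ℚ
    half+half = refl

    0<ι : ∀ {n} → 1 ℕ.≤ n → 0ℚ < ι n
    0<ι {suc n} _ = ℚ.positive⁻¹ (ι (suc n))

    ι*inv : ∀ {n} → 1 ℕ.≤ n → ι n * inv n ≡ 1ℚ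
    ι*inv {suc n} _ = ℚ.*-inverseʳ (ι (suc n))

    0≤inv : ∀ n → 0ℚ ≤ inv n
    0≤inv zero    = ≤-refl
    0≤inv (suc n) = ℚ.nonNegative⁻¹ (ℚ.1/ ι (suc n))

    0<inv : ∀ {n} → 1 ℕ.≤ n → 0ℚ < inv n
    0<inv {suc n} _ = ℚ.positive⁻¹ (ℚ.1/ ι (suc n))

    +-mono-≤ : ∀ {p q r s} → p ≤ q → r ≤ s → p + r ≤ q + s
    +-mono-≤ = ℚ.+-mono-≤

    +-mono-<-≤ : ∀ {p q r s} → p < q → r ≤ s → p + r < q + s
    +-mono-<-≤ = ℚ.+-mono-<-≤

    *-monoˡ : ∀ {r p q} → 0ℚ ≤ r → p ≤ q → r * p ≤ r * q
    *-monoˡ {r} h = ℚ.*-monoˡ-≤-nonNeg r {{ℚ.nonNegative h}}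

    *-monoˡ-< : ∀ {r p q} → 0ℚ < r → p < q → r * p < r * q
    *-monoˡ-< {r} h = ℚ.*-monoʳ-<-pos r {{ℚ.positive h}}

    *-cancelˡ : ∀ {r p q} → 0ℚ < r → r * p ≤ r * q → p ≤ q
    *-cancelˡ {r} h = ℚ.*-cancelˡ-≤-pos r {{ℚ.positive h}}

    0<* : ∀ {p q} → 0ℚ < p → 0ℚ < q → 0ℚ < p * q
    0<* {p} {q} hp hq = subst (_< p * q) (ℚ.*-zeroʳ p) (*-monoˡ-< hp hq)

    ten*three-tenths : ι 10 * (ℤ.+ 3 ℚ./ 10) ≡ ι 3
    ten*three-tenths = refl

    0≤square : ∀ p → 0ℚ ≤ p * p
    0≤square p with ≤-total 0ℚ p
    ... | inj₁ h = subst (_≤ p * p) (ℚ.*-zeroʳ p) (*-monoˡ h h)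
    ... | inj₂ h = subst (_≤ p * p) (ℚ.*-zeroʳ p) (ℚ.*-monoˡ-≤-nonPos p {{ℚ.nonPositive h}} h)

  ring : CommutativeRing _ _
  ring = record { isCommutativeRing = ring-laws }

  open CommutativeRing ring public using (+-assoc; +-comm; +-identityˡ; +-identityʳ; *-assoc; *-comm; *-identityˡ; *-identityʳ)
    renaming (zeroˡ to *-zeroˡ; zeroʳ to *-zeroʳ; distribˡ to *-distribˡ-+; distribʳ to *-distribʳ-+; -‿inverseʳ to +-inverseʳ)

  module ℚSum = SemiringSum (CommutativeRing.semiring ring)
  open ℚSum using () renaming (sum to ∑ℚ)

  +-monoˡ-≤ : ∀ r {p q} → p ≤ q → p + r ≤ q + r
  +-monoˡ-≤ r h = +-mono-≤ h ≤-refl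

  +-monoʳ-≤ : ∀ r {p q} → p ≤ q → r + p ≤ r + q
  +-monoʳ-≤ r h = +-mono-≤ (≤-refl {r}) h

  *-monoʳ : ∀ {r p q} → 0ℚ ≤ r → p ≤ q → p * r ≤ q * r
  *-monoʳ {r} {p} {q} h l = subst₂ _≤_ (*-comm r p) (*-comm r q) (*-monoˡ h l)

  0≤ι : ∀ n → 0ℚ ≤ ι n
  0≤ι n = subst (_≤ ι n) ι-0 (ι-mono ℕ.z≤n)

  0≤* : ∀ {p q} → 0ℚ ≤ p → 0ℚ ≤ q → 0ℚ ≤ p * q
  0≤* {p} {q} hp hq = subst (_≤ p * q) (*-zeroʳ p) (*-monoˡ hp hq)

  0≤+ : ∀ {p q} → 0ℚ ≤ p → 0ℚ ≤ q → 0ℚ ≤ p + q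
  0≤+ {p} {q} hp hq = subst (_≤ p + q) (+-identityʳ 0ℚ) (+-mono-≤ hp hq)

  ≤-diff : ∀ {x y} r → 0ℚ ≤ r → y ≡ x + r → x ≤ y
  ≤-diff {x} r h e = subst₂ _≤_ (+-identityʳ x) (sym e) (+-monoʳ-≤ x h)

  0≤diff : ∀ {x y} → x ≤ y → 0ℚ ≤ y - x
  0≤diff {x} {y} h = subst (_≤ y - x) (+-inverseʳ x) (+-monoˡ-≤ (- x) h)

  ∑ℚ-mono : ∀ {n} {f g : Fin n → ℚ} → (∀ i → f i ≤ g i) → ∑ℚ f ≤ ∑ℚ g
  ∑ℚ-mono {zero}  h = ≤-refl
  ∑ℚ-mono {suc n} h = +-mono-≤ (h zero) (∑ℚ-mono (h ∘ suc))

  ∑ℚ-mono-gain : ∀ {n} {f g : Fin n → ℚ} {r} → (∀ i → f i ≤ g i) → ∀ i → f i + r ≤ g i → ∑ℚ f + r ≤ ∑ℚ g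
  ∑ℚ-mono-gain {suc n} {f} {g} {r} h zero l = subst (_≤ ∑ℚ g)
    (trans (+-assoc (f zero) r _) (trans (cong (f zero +_) (+-comm r _)) (sym (+-assoc (f zero) _ r)))) (+-mono-≤ l (∑ℚ-mono (h ∘ suc)))
  ∑ℚ-mono-gain {suc n} {f} h (suc i) l = subst (_≤ _) (sym (+-assoc (f zero) _ _)) (+-mono-≤ (h zero) (∑ℚ-mono-gain (h ∘ suc) i l))

  ∑ℚ-const : ∀ n c → ∑ℚ {n} (λ _ → c) ≡ ι n * c
  ∑ℚ-const zero    c = sym (trans (cong (_* c) ι-0) (*-zeroˡ c))
  ∑ℚ-const (suc n) c = trans (cong (_+_ c) (∑ℚ-const n c))
    (trans (cong (_+ (ι n * c)) (sym (*-identityˡ c))) (trans (sym (*-distribʳ-+ c 1ℚ (ι n))) (cong (_* c) (trans (cong (_+ ι n) (sym ι-1)) (sym (ι-+ 1 n))))))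

  module _ (κ : ℚ) where

    F : ℚ → ℚ
    F d = κ * d + d * d

    opaque
      unfolding _+_ _*_ -_

      -- Expansion around `v`: when `v` is the weighted mean of `u` and `u′`, the last summand
      -- vanishes and only the squared deviations remain, whatever the linear coefficient `κ` is.
      F-expansion : ∀ p p′ u u′ v → p * F u + p′ * F u′ ≡
        (p + p′) * F v + (p * ((u - v) * (u - v)) + p′ * ((u′ - v) * (u′ - v))) + (κ + (v + v)) * ((p * u + p′ * u′) - (p + p′) * v)
      F-expansion p p′ u u′ v = solve 6 (λ k p p′ u u′ v → p :* (k :* u :+ u :* u) :+ p′ :* (k :* u′ :+ u′ :* u′) :=
          (p :+ p′) :* (k :* v :+ v :* v) :+ (p :* ((u :- v) :* (u :- v)) :+ p′ :* ((u′ :- v) :* (u′ :- v)))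
            :+ (k :+ (v :+ v)) :* ((p :* u :+ p′ :* u′) :- (p :+ p′) :* v)) refl κ p p′ u u′ v
        where open +-*-Solver

    F-split : ∀ p p′ u u′ v → p * u + p′ * u′ ≡ (p + p′) * v →
      p * F u + p′ * F u′ ≡ (p + p′) * F v + (p * ((u - v) * (u - v)) + p′ * ((u′ - v) * (u′ - v)))
    F-split p p′ u u′ v e = begin
      p * F u + p′ * F u′                                       ≡⟨ F-expansion p p′ u u′ v ⟩
      rhs + (κ + (v + v)) * ((p * u + p′ * u′) - (p + p′) * v)  ≡⟨ cong (λ t → rhs + (κ + (v + v)) * (t - (p + p′) * v)) e ⟩
      rhs + (κ + (v + v)) * ((p + p′) * v - (p + p′) * v)       ≡⟨ cong (λ t → rhs + (κ + (v + v)) * t) (+-inverseʳ ((p + p′) * v)) ⟩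
      rhs + (κ + (v + v)) * 0ℚ                                  ≡⟨ cong (rhs +_) (*-zeroʳ (κ + (v + v))) ⟩
      rhs + 0ℚ                                                  ≡⟨ +-identityʳ rhs ⟩
      rhs                                                       ∎
      where
      open ≡-Reasoning
      rhs = (p + p′) * F v + (p * ((u - v) * (u - v)) + p′ * ((u′ - v) * (u′ - v)))

    F-split-gain : ∀ {p p′} u u′ v → 0ℚ ≤ p → 0ℚ ≤ p′ → p * u + p′ * u′ ≡ (p + p′) * v →
      (p + p′) * F v + p * ((u - v) * (u - v)) ≤ p * F u + p′ * F u′
    F-split-gain {p} {p′} u u′ v hp hp′ e = ≤-diff (p′ * ((u′ - v) * (u′ - v))) (0≤* hp′ (0≤square (u′ - v)))
      (trans (F-split p p′ u u′ v e) (sym (+-assoc ((p + p′) * F v) _ _)))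

    F-split-convex : ∀ {p p′} u u′ v → 0ℚ ≤ p → 0ℚ ≤ p′ → p * u + p′ * u′ ≡ (p + p′) * v →
      (p + p′) * F v ≤ p * F u + p′ * F u′
    F-split-convex {p} {p′} u u′ v hp hp′ e = ≤-trans (≤-diff (p * ((u - v) * (u - v))) (0≤* hp (0≤square (u - v))) refl)
      (F-split-gain u u′ v hp hp′ e)

  average-choice : ∀ {p p′ s s′ t} → 0ℚ < p → 0ℚ ≤ p′ → (p + p′) * t ≤ p * s + p′ * s′ → t ≤ s ⊎ t ≤ s′
  average-choice {p} {p′} {s} {s′} {t} hp hp′ h with t ≤? s | t ≤? s′
  ... | yes a | _     = inj₁ a
  ... | no _  | yes b = inj₂ b
  ... | no a  | no b  = ⊥-elim (<-irrefl refl (<-≤-trans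
    (+-mono-<-≤ (*-monoˡ-< hp (≰⇒> a)) (*-monoˡ hp′ (<⇒≤ (≰⇒> b))))
    (subst (_≤ p * s + p′ * s′) (*-distribʳ-+ t p p′) h)))

  opaque
    unfolding _+_ _*_ -_

    swap-middle : ∀ a b c d → a * b * (c * d) ≡ a * c * (b * d)
    swap-middle = solve 4 (λ a b c d → a :* b :* (c :* d) := a :* c :* (b :* d)) refl
      where open +-*-Solver

    pull-in : ∀ a e i j → a * (e * (i * j)) ≡ a * i * (e * j)
    pull-in = solve 4 (λ a e i j → a :* (e :* (i :* j)) := a :* i :* (e :* j)) refl
      where open +-*-Solver

    add-subtract : ∀ p q x → p * x ≡ (p + q) * x - q * x
    add-subtract = solve 3 (λ p q x → p :* x := (p :+ q) :* x :- q :* x) refl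
      where open +-*-Solver

    subtract-shift : ∀ p q x y h → p * y + q * (x + h) - q * x ≡ p * y + q * h
    subtract-shift = solve 5 (λ p q x y h → p :* y :+ q :* (x :+ h) :- q :* x := p :* y :+ q :* h) refl
      where open +-*-Solver

    factor-out : ∀ p y c h → p * y + p * c * h ≡ p * (y + c * h)
    factor-out = solve 4 (λ p y c h → p :* y :+ p :* c :* h := p :* (y :+ c :* h)) refl
      where open +-*-Solver

    square-of-gap : ∀ x y η → (x - y) * (x - y) ≡ η * η + ((y - (x + η)) * (y - (x + η)) + (η + η) * (y - (x + η)))
    square-of-gap = solve 3 (λ x y η → (x :- y) :* (x :- y) := η :* η :+ ((y :- (x :+ η)) :* (y :- (x :+ η)) :+ (η :+ η) :* (y :- (x :+ η)))) refl
      where open +-*-Solver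

    add-swap : ∀ y c h → y + (h + c) ≡ y + c + h
    add-swap = solve 3 (λ y c h → y :+ (h :+ c) := y :+ c :+ h) refl
      where open +-*-Solver

    undo-add : ∀ x r → x + r - r ≡ x
    undo-add = solve 2 (λ x r → x :+ r :- r := x) refl
      where open +-*-Solver

  -- Densities and energy of tuples

  module _ {n : ℕ} (G : Graph n) where

    private
      Weight = Fin n → ℕ

    weightedEdges-sym : ∀ (A B : Weight) → weightedEdges G A B ≡ weightedEdges G B A
    weightedEdges-sym A B = trans (sum-cong-≗ (λ u → *-distribˡ-sum (A u) (λ v → B v ℕ.* 𝟙 (adj G u v))))
      (trans (∑-comm (λ u v → A u ℕ.* (B v ℕ.* 𝟙 (adj G u v)))) (sum-cong-≗ λ v → trans
        (sum-cong-≗ λ u → trans (cong (λ t → A u ℕ.* (B v ℕ.* 𝟙 t)) (Graph.sym G u v))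
          (solve 3 (λ a b c → a :* (b :* c) := b :* (a :* c)) refl (A u) (B v) (𝟙 (adj G v u))))
        (sym (*-distribˡ-sum (B v) (λ u → A u ℕ.* 𝟙 (adj G v u))))))
      where open ℕ-Solver

    weightedEdges≤ : ∀ (A B : Weight) → weightedEdges G A B ℕ.≤ sum A ℕ.* sum B
    weightedEdges≤ A B = ℕ.≤-trans (∑-mono (λ u → ℕ.*-monoʳ-≤ (A u) (degree≤ G B u))) (ℕ.≤-reflexive (sym (*-distribʳ-sum (sum B) A)))

    -- As `inv 0` is `0`, an empty weight has density zero; positive sums are assumed wherever the
    -- quotient has to be a true ratio.
    density : Weight → Weight → ℚ
    density A B = ι (weightedEdges G A B) * (inv (sum A) * inv (sum B))

    density-sym : ∀ A B → density A B ≡ density B A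
    density-sym A B = cong₂ _*_ (cong ι (weightedEdges-sym A B)) (*-comm (inv (sum A)) (inv (sum B)))

    0≤density : ∀ A B → 0ℚ ≤ density A B
    0≤density A B = 0≤* (0≤ι _) (0≤* (0≤inv (sum A)) (0≤inv (sum B)))

    sizes-cancel : ∀ {a b} → 1 ℕ.≤ a → 1 ℕ.≤ b → ι (a ℕ.* b) * (inv a * inv b) ≡ 1ℚ
    sizes-cancel {a} {b} ha hb = begin
      ι (a ℕ.* b) * (inv a * inv b)      ≡⟨ cong (_* (inv a * inv b)) (ι-* a b) ⟩
      ι a * ι b * (inv a * inv b)        ≡⟨ swap-middle (ι a) (ι b) (inv a) (inv b) ⟩
      ι a * inv a * (ι b * inv b)        ≡⟨ cong₂ _*_ (ι*inv ha) (ι*inv hb) ⟩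
      1ℚ * 1ℚ                            ≡⟨ *-identityˡ 1ℚ ⟩
      1ℚ                                 ∎
      where
      open ≡-Reasoning

    density-scaled≤ : ∀ A B {num den} → 1 ℕ.≤ sum A → 1 ℕ.≤ sum B →
      den ℕ.* weightedEdges G A B ℕ.≤ num ℕ.* (sum A ℕ.* sum B) → ι den * density A B ≤ ι num
    density-scaled≤ A B {num} {den} hA hB h = subst₂ _≤_
      (trans (cong (_* r) (ι-* den (weightedEdges G A B))) (*-assoc (ι den) (ι (weightedEdges G A B)) r))
      (trans (cong (_* r) (ι-* num (sum A ℕ.* sum B))) (trans (*-assoc (ι num) (ι (sum A ℕ.* sum B)) r) (trans (cong (_*_ (ι num)) (sizes-cancel hA hB)) (*-identityʳ (ι num)))))
      (*-monoʳ (0≤* (0≤inv (sum A)) (0≤inv (sum B))) (ι-mono h))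
      where r = inv (sum A) * inv (sum B)

    density≤1 : ∀ A B → 1 ℕ.≤ sum A → 1 ℕ.≤ sum B → density A B ≤ 1ℚ
    density≤1 A B hA hB = subst₂ _≤_ (trans (cong (_* density A B) ι-1) (*-identityˡ (density A B))) ι-1
      (density-scaled≤ A B {1} {1} hA hB (subst₂ ℕ._≤_ (sym (ℕ.*-identityˡ _)) (sym (ℕ.*-identityˡ _)) (weightedEdges≤ A B)))

    complement : Weight → Weight → Weight
    complement X A u = 2 ℕ.* X u ℕ.∸ A u

    complement-+ : ∀ {X A} → (∀ u → A u ℕ.≤ X u) → ∀ u → A u ℕ.+ complement X A u ≡ 2 ℕ.* X u
    complement-+ {X} A≤X u = ℕ.m+[n∸m]≡n (ℕ.≤-trans (A≤X u) (ℕ.m≤m+n (X u) _))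

    ≤complement : ∀ {X A} → (∀ u → A u ℕ.≤ X u) → ∀ u → X u ℕ.≤ complement X A u
    ≤complement {X} {A} A≤X u = ℕ.m+n≤o⇒m≤o∸n (X u) (ℕ.+-mono-≤ (ℕ.≤-refl {X u}) (ℕ.≤-trans (A≤X u) (ℕ.≤-reflexive (sym (ℕ.+-identityʳ _)))))

    sum-complement : ∀ {X A} → (∀ u → A u ℕ.≤ X u) → sum A ℕ.+ sum (complement X A) ≡ 2 ℕ.* sum X
    sum-complement {X} {A} A≤X = trans (sym (∑-distrib-+ A (complement X A))) (trans (sum-cong-≗ (complement-+ A≤X)) (sym (*-distribˡ-sum 2 X)))

    edges-complement : ∀ {X A} Y → (∀ u → A u ℕ.≤ X u) →
      weightedEdges G A Y ℕ.+ weightedEdges G (complement X A) Y ≡ 2 ℕ.* weightedEdges G X Y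
    edges-complement {X} {A} Y A≤X = trans (sym (∑-distrib-+ (λ u → A u ℕ.* degree G Y u) _)) (trans
      (sum-cong-≗ λ u → trans (sym (ℕ.*-distribʳ-+ (degree G Y u) (A u) _)) (trans (cong (ℕ._* degree G Y u) (complement-+ A≤X u)) (ℕ.*-assoc 2 (X u) _)))
      (sym (*-distribˡ-sum 2 (λ u → X u ℕ.* degree G Y u))))

    size*density : ∀ A Y → 1 ℕ.≤ sum A → ι (sum A) * density A Y ≡ ι (weightedEdges G A Y) * inv (sum Y)
    size*density A Y hA = begin
      ι (sum A) * (ι e * (inv (sum A) * inv (sum Y)))
        ≡⟨ pull-in (ι (sum A)) (ι e) (inv (sum A)) (inv (sum Y)) ⟩
      ι (sum A) * inv (sum A) * (ι e * inv (sum Y))   ≡⟨ cong (_* (ι e * inv (sum Y))) (ι*inv hA) ⟩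
      1ℚ * (ι e * inv (sum Y))                        ≡⟨ *-identityˡ (ι e * inv (sum Y)) ⟩
      ι e * inv (sum Y)                               ∎
      where
      open ≡-Reasoning
      e = weightedEdges G A Y

    density-split : ∀ {X A} Y → (∀ u → A u ℕ.≤ X u) → 1 ℕ.≤ sum A →
      ι (sum A) * density A Y + ι (sum (complement X A)) * density (complement X A) Y
        ≡ (ι (sum A) + ι (sum (complement X A))) * density X Y
    density-split {X} {A} Y A≤X hA = begin
      ι (sum A) * density A Y + ι (sum A′) * density A′ Y   ≡⟨ cong₂ _+_ (size*density A Y hA) (size*density A′ Y hA′) ⟩
      ι (weightedEdges G A Y) * i + ι (weightedEdges G A′ Y) * i ≡⟨ *-distribʳ-+ i (ι (weightedEdges G A Y)) (ι (weightedEdges G A′ Y)) ⟨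
      (ι (weightedEdges G A Y) + ι (weightedEdges G A′ Y)) * i
        ≡⟨ cong (_* i) (trans (sym (ι-+ (weightedEdges G A Y) (weightedEdges G A′ Y)))
                       (trans (cong ι (edges-complement Y A≤X)) (ι-* 2 (weightedEdges G X Y)))) ⟩
      ι 2 * ι (weightedEdges G X Y) * i                     ≡⟨ *-assoc (ι 2) (ι (weightedEdges G X Y)) i ⟩
      ι 2 * (ι (weightedEdges G X Y) * i)                   ≡⟨ cong (_*_ (ι 2)) (size*density X Y hX) ⟨
      ι 2 * (ι (sum X) * density X Y)                       ≡⟨ *-assoc (ι 2) (ι (sum X)) (density X Y) ⟨
      ι 2 * ι (sum X) * density X Y                         ≡⟨ cong (_* density X Y) (trans (sym (ι-* 2 (sum X))) (trans (cong ι (sym (sum-complement A≤X))) (ι-+ (sum A) (sum A′)))) ⟩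
      (ι (sum A) + ι (sum A′)) * density X Y                ∎
      where
      open ≡-Reasoning
      A′ = complement X A
      i = inv (sum Y)
      hX = ℕ.≤-trans hA (∑-mono A≤X)
      hA′ = ℕ.≤-trans hX (∑-mono (≤complement A≤X))

    module Energy {k : ℕ} (κ : ℚ) where

      Tuple : Set
      Tuple = Fin k → Weight

      -- The diagonal is left out because replacing `X i` changes both arguments of
      -- `density (X i) (X i)`, so that this density is not an average over the two pieces.
      cell : Tuple → Fin k → Fin k → ℚ
      cell X i j = if does (i Fin.≟ j) then 0ℚ else F κ (density (X i) (X j))

      energy : Tuple → ℚ
      energy X = ∑ℚ λ i → ∑ℚ λ j → cell X i j

      replace : Tuple → Fin k → Weight → Tuple
      replace X i₀ A i = if does (i Fin.≟ i₀) then A else X i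

      replace-same : ∀ X i A → replace X i A i ≡ A
      replace-same X i A = cong (λ b → if b then A else X i) (≟-refl i)

      replace-other : ∀ X {i i₀} A → i ≢ i₀ → replace X i₀ A i ≡ X i
      replace-other X {i} {i₀} A i≢ with i Fin.≟ i₀
      ... | yes p = ⊥-elim (i≢ p)
      ... | no _  = refl

      module Split (X : Tuple) {i₀ j₀ : Fin k} (i₀≢j₀ : i₀ ≢ j₀) {A : Weight} (A≤X : ∀ u → A u ℕ.≤ X i₀ u) (hA : 1 ℕ.≤ sum A) where

        A′ : Weight
        A′ = complement (X i₀) A

        p p′ : ℚ
        p  = ι (sum A)
        p′ = ι (sum A′)

        X₁ X₂ : Tuple
        X₁ = replace X i₀ A
        X₂ = replace X i₀ A′

        gap : ℚ
        gap = density A (X j₀) - density (X i₀) (X j₀)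

        private
          0≤p : 0ℚ ≤ p
          0≤p = 0≤ι (sum A)
          0≤p′ : 0ℚ ≤ p′
          0≤p′ = 0≤ι (sum A′)
          zero-cell : (p + p′) * 0ℚ ≤ p * 0ℚ + p′ * 0ℚ
          zero-cell = ≤-reflexive (*-distribʳ-+ 0ℚ p p′)

        cell-convex : ∀ i j → (p + p′) * cell X i j ≤ p * cell X₁ i j + p′ * cell X₂ i j
        cell-convex i j with i Fin.≟ j
        ... | yes _ = zero-cell
        ... | no i≢j with i Fin.≟ i₀ | j Fin.≟ i₀
        ...   | yes refl | yes refl = ⊥-elim (i≢j refl)
        ...   | yes refl | no _     = F-split-convex κ _ _ _ 0≤p 0≤p′ (density-split (X j) A≤X hA)
        ...   | no _     | yes refl = subst₂ _≤_
          (cong (λ d → (p + p′) * F κ d) (density-sym (X i₀) (X i)))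
          (cong₂ (λ d d′ → p * F κ d + p′ * F κ d′) (density-sym A (X i)) (density-sym A′ (X i)))
          (F-split-convex κ _ _ _ 0≤p 0≤p′ (density-split (X i) A≤X hA))
        ...   | no _     | no _     = ≤-reflexive (*-distribʳ-+ _ p p′)

        cell-gain : (p + p′) * cell X i₀ j₀ + p * (gap * gap) ≤ p * cell X₁ i₀ j₀ + p′ * cell X₂ i₀ j₀
        cell-gain with i₀ Fin.≟ j₀
        ... | yes e = ⊥-elim (i₀≢j₀ e)
        ... | no _ with i₀ Fin.≟ i₀ | j₀ Fin.≟ i₀
        ...   | no ¬e | _        = ⊥-elim (¬e refl)
        ...   | yes _ | yes e    = ⊥-elim (i₀≢j₀ (sym e))
        ...   | yes _ | no _     = F-split-gain κ _ _ _ 0≤p 0≤p′ (density-split (X j₀) A≤X hA)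

        private
          expandˡ : (p + p′) * energy X ≡ ∑ℚ (λ i → ∑ℚ λ j → (p + p′) * cell X i j)
          expandˡ = trans (ℚSum.*-distribˡ-sum (p + p′) (λ i → ∑ℚ (cell X i))) (ℚSum.sum-cong-≗ λ i → ℚSum.*-distribˡ-sum (p + p′) (cell X i))
          expandʳ : p * energy X₁ + p′ * energy X₂ ≡ ∑ℚ (λ i → ∑ℚ λ j → p * cell X₁ i j + p′ * cell X₂ i j)
          expandʳ = trans (cong₂ _+_ (both p X₁) (both p′ X₂))
            (trans (sym (ℚSum.∑-distrib-+ (λ i → ∑ℚ λ j → p * cell X₁ i j) _))
                   (ℚSum.sum-cong-≗ λ i → sym (ℚSum.∑-distrib-+ (λ j → p * cell X₁ i j) _)))
            where
            both : ∀ q Y → q * energy Y ≡ ∑ℚ (λ i → ∑ℚ λ j → q * cell Y i j)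
            both q Y = trans (ℚSum.*-distribˡ-sum q (λ i → ∑ℚ (cell Y i))) (ℚSum.sum-cong-≗ λ i → ℚSum.*-distribˡ-sum q (cell Y i))

        energy-gain : (p + p′) * energy X + p * (gap * gap) ≤ p * energy X₁ + p′ * energy X₂
        energy-gain = subst₂ _≤_ (cong (_+ p * (gap * gap)) (sym expandˡ)) (sym expandʳ)
          (∑ℚ-mono-gain (λ i → ∑ℚ-mono (cell-convex i)) i₀ (∑ℚ-mono-gain (cell-convex i₀) j₀ cell-gain))

        module Selection {e : ℕ} (A-large : sum (X i₀) ℕ.≤ e ℕ.* sum A) where

          total≤ : p + p′ ≤ p * ι (2 ℕ.* e)
          total≤ = subst₂ _≤_ (trans (cong ι (sym (sum-complement A≤X))) (ι-+ (sum A) (sum A′))) (ι-* (sum A) (2 ℕ.* e))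
            (ι-mono (ℕ.≤-trans (ℕ.*-monoʳ-≤ 2 A-large) (ℕ.≤-reflexive (solve 2 (λ a e → con 2 :* (e :* a) := a :* (con 2 :* e)) refl (sum A) e))))
            where open ℕ-Solver

          p′≤ : p′ ≤ p * ι (2 ℕ.* e)
          p′≤ = ≤-trans (subst (_≤ p + p′) (+-identityˡ p′) (+-monoˡ-≤ p′ 0≤p)) total≤

          gain : ∀ {δ} → 0ℚ ≤ δ → ι (2 ℕ.* e) * δ ≤ gap * gap → energy X + δ ≤ energy X₁ ⊎ energy X + δ ≤ energy X₂
          gain {δ} hδ h = average-choice (0<ι hA) 0≤p′ (begin
            (p + p′) * (energy X + δ)              ≡⟨ *-distribˡ-+ (p + p′) (energy X) δ ⟩
            (p + p′) * energy X + (p + p′) * δ     ≤⟨ +-monoʳ-≤ _ (*-monoʳ hδ total≤) ⟩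
            (p + p′) * energy X + p * ι (2 ℕ.* e) * δ ≡⟨ cong ((p + p′) * energy X +_) (*-assoc p (ι (2 ℕ.* e)) δ) ⟩
            (p + p′) * energy X + p * (ι (2 ℕ.* e) * δ) ≤⟨ +-monoʳ-≤ _ (*-monoˡ 0≤p h) ⟩
            (p + p′) * energy X + p * (gap * gap)  ≤⟨ energy-gain ⟩
            p * energy X₁ + p′ * energy X₂         ∎)
            where open ≤-Reasoning

          -- The weighted average of the two new energies is at least the old one, so if the
          -- complement gains little, passing to `A` cannot lose much. The factor `2 * e` bounds the
          -- ratio of the two masses.
          loss : ∀ {h} → 0ℚ ≤ h → energy X₂ ≤ energy X + h → energy X ≤ energy X₁ + ι (2 ℕ.* e) * h
          loss {h} 0≤h small = *-cancelˡ (0<ι hA) (begin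
            p * energy X                                   ≡⟨ add-subtract p p′ (energy X) ⟩
            (p + p′) * energy X - p′ * energy X            ≤⟨ +-monoˡ-≤ (- (p′ * energy X)) (≤-trans (≤-diff (p * (gap * gap)) (0≤* 0≤p (0≤square gap)) refl) energy-gain) ⟩
            p * energy X₁ + p′ * energy X₂ - p′ * energy X ≤⟨ +-monoˡ-≤ (- (p′ * energy X)) (+-monoʳ-≤ (p * energy X₁) (*-monoˡ 0≤p′ small)) ⟩
            p * energy X₁ + p′ * (energy X + h) - p′ * energy X ≡⟨ subtract-shift p p′ (energy X) (energy X₁) h ⟩
            p * energy X₁ + p′ * h                         ≤⟨ +-monoʳ-≤ (p * energy X₁) (*-monoʳ 0≤h p′≤) ⟩
            p * energy X₁ + p * ι (2 ℕ.* e) * h            ≡⟨ factor-out p (energy X₁) (ι (2 ℕ.* e)) h ⟩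
            p * (energy X₁ + ι (2 ℕ.* e) * h)              ∎)
            where
            open ≤-Reasoning

      -- Mass is measured against the maximal value `W`, because this ratio is what bounds supports
      -- from below, and because values double with every split.
      record Valid (W l : ℕ) (X : Tuple) : Set where
        constructor valid
        field
          bounded : ∀ i u → X i u ℕ.≤ W
          large   : ∀ i → n ℕ.* W ℕ.≤ l ℕ.* sum (X i)
      open Valid public

      Valid-mono : ∀ {W l l′ X} → l ℕ.≤ l′ → Valid W l X → Valid W l′ X
      Valid-mono {X = X} h v = valid (bounded v) λ i → ℕ.≤-trans (large v i) (ℕ.*-monoˡ-≤ (sum (X i)) h)

      Valid-double : ∀ {W l X} → Valid W l X → Valid (2 ℕ.* W) (2 ℕ.* l) X
      Valid-double {W} {l} {X} v = valid (λ i u → ℕ.≤-trans (bounded v i u) (ℕ.m≤m+n W _)) λ i →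
        subst₂ ℕ._≤_ (solve 2 (λ n w → con 2 :* (n :* w) := n :* (con 2 :* w)) refl n W) (sym (ℕ.*-assoc 2 l (sum (X i)))) (ℕ.*-monoʳ-≤ 2 (large v i))
        where open ℕ-Solver

      replace-valid : ∀ {W l X i₀ A} → Valid W l X → (∀ u → A u ℕ.≤ W) → n ℕ.* W ℕ.≤ l ℕ.* sum A → Valid W l (replace X i₀ A)
      replace-valid {W} {l} {X} {i₀} {A} v A≤W A-large = valid b m
        where
        b : ∀ i u → replace X i₀ A i u ℕ.≤ W
        b i with i Fin.≟ i₀
        ... | yes _ = A≤W
        ... | no _  = bounded v i
        m : ∀ i → n ℕ.* W ℕ.≤ l ℕ.* sum (replace X i₀ A i)
        m i with i Fin.≟ i₀
        ... | yes _ = A-large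
        ... | no _  = large v i

      split-valid : ∀ {W l X i₀ A e} → 1 ℕ.≤ e → Valid W l X → (∀ u → A u ℕ.≤ X i₀ u) → sum (X i₀) ℕ.≤ e ℕ.* sum A →
        Valid (2 ℕ.* W) (2 ℕ.* l ℕ.* e) (replace X i₀ A) × Valid (2 ℕ.* W) (2 ℕ.* l ℕ.* e) (replace X i₀ (complement (X i₀) A))
      split-valid {W} {l} {X} {i₀} {A} {e} 1≤e v A≤X A-large =
        replace-valid doubled (λ u → ℕ.≤-trans (A≤X u) (bounded doubled i₀ u))
          (ℕ.≤-trans (large (Valid-double v) i₀) (ℕ.≤-trans (ℕ.*-monoʳ-≤ (2 ℕ.* l) A-large) (ℕ.≤-reflexive (sym (ℕ.*-assoc (2 ℕ.* l) e (sum A)))))) ,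
        replace-valid doubled (λ u → ℕ.≤-trans (ℕ.m∸n≤m (2 ℕ.* X i₀ u) (A u)) (ℕ.*-monoʳ-≤ 2 (bounded v i₀ u)))
          (ℕ.≤-trans (large doubled i₀) (ℕ.*-monoʳ-≤ (2 ℕ.* l ℕ.* e) (∑-mono (≤complement A≤X))))
        where
        doubled : Valid (2 ℕ.* W) (2 ℕ.* l ℕ.* e) X
        doubled = Valid-mono (ℕ.m≤m*n (2 ℕ.* l) e {{ℕ.>-nonZero 1≤e}}) (Valid-double v)

      module Improve (e : ℕ) (1≤e : 1 ℕ.≤ e) (η δ h : ℚ) (0≤η : 0ℚ ≤ η) (0≤h : 0ℚ ≤ h)
                     (δ-small : ι (2 ℕ.* e) * δ ≤ η * η) (h-small : h + ι (2 ℕ.* e) * h ≤ δ) where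

        private
          h≤δ : h ≤ δ
          h≤δ = ≤-trans (≤-diff (ι (2 ℕ.* e) * h) (0≤* (0≤ι (2 ℕ.* e)) 0≤h) refl) h-small

          0≤δ : 0ℚ ≤ δ
          0≤δ = ≤-trans 0≤h h≤δ

          gap-square : ∀ x y → x + η ≤ y → η * η ≤ (x - y) * (x - y)
          gap-square x y le = ≤-diff (r * r + (η + η) * r) (0≤+ (0≤square r) (0≤* (0≤+ 0≤η 0≤η) (0≤diff le)))
            (square-of-gap x y η)
            where
            r = y - (x + η)

        -- The parameters leave room for two successive splits; `pad` brings the outcome of a single
        -- split to the same form.
        Improved : ℕ → ℕ → Tuple → Set
        Improved W l X = Σ Tuple λ X′ → Valid (2 ℕ.* (2 ℕ.* W)) (2 ℕ.* (2 ℕ.* l ℕ.* e) ℕ.* e) X′ × energy X + h ≤ energy X′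

        private
          pad : ∀ {W l X} → Valid (2 ℕ.* W) (2 ℕ.* l ℕ.* e) X → Valid (2 ℕ.* (2 ℕ.* W)) (2 ℕ.* (2 ℕ.* l ℕ.* e) ℕ.* e) X
          pad {W} {l} {X} v = Valid-mono {X = X} (ℕ.m≤m*n (2 ℕ.* (2 ℕ.* l ℕ.* e)) e {{ℕ.>-nonZero 1≤e}}) (Valid-double {X = X} v)

        -- The drop of `η + η` from `(X i , X j)` to `(A , B)` is reached in two moves, `X j` to `B`
        -- and then `X i` to `A`, and one of them drops by at least `η`. If the first does, its
        -- split gains `δ` at once. If only the second does, the first move has to be made without a
        -- gain of its own, and its loss must be kept below what the second earns.
        improve : ∀ {W l X} → Valid W l X → ∀ {i j} → i ≢ j → {A B : Weight} →
          (∀ u → A u ℕ.≤ X i u) → (∀ u → B u ℕ.≤ X j u) → 1 ℕ.≤ sum A → 1 ℕ.≤ sum B →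
          sum (X i) ℕ.≤ e ℕ.* sum A → sum (X j) ℕ.≤ e ℕ.* sum B →
          density A B + (η + η) ≤ density (X i) (X j) → Improved W l X
        improve {W} {l} {X} v {i} {j} i≢j {A} {B} A≤X B≤X hA hB lA lB sparse = decide (density B (X i) + η ≤? density (X j) (X i))
          where
          module S = Split X {j} {i} (i≢j ∘ sym) {B} B≤X hB
          module S′ = S.Selection {e} lB
          Y = S.X₁
          v₁ = proj₁ (split-valid {W} {l} {X} {j} {B} {e} 1≤e v B≤X lB)
          v₂ = proj₂ (split-valid {W} {l} {X} {j} {B} {e} 1≤e v B≤X lB)
          Yi : Y i ≡ X i
          Yi = replace-other X B i≢j
          Yj : Y j ≡ B
          Yj = replace-same X j B
          A≤Y : ∀ u → A u ℕ.≤ Y i u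
          A≤Y u = subst (λ Z → A u ℕ.≤ Z u) (sym Yi) (A≤X u)
          lA′ : sum (Y i) ℕ.≤ e ℕ.* sum A
          lA′ = subst (λ Z → sum Z ℕ.≤ e ℕ.* sum A) (sym Yi) lA
          module R = Split Y {i} {j} i≢j {A} A≤Y hA
          module R′ = R.Selection {e} lA′
          w = split-valid {2 ℕ.* W} {2 ℕ.* l ℕ.* e} {Y} {i} {A} {e} 1≤e v₁ A≤Y lA′
          second : density A B + η ≤ density (X i) B → energy X ≤ energy Y + ι (2 ℕ.* e) * h → Improved W l X
          second le lossy = conclude (R′.gain 0≤δ (≤-trans δ-small (gap-square (density A (Y j)) (density (Y i) (Y j))
              (subst₂ (λ P Q → density A Q + η ≤ density P Q) (sym Yi) (sym Yj) le))))
            where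
            combined : energy X + h ≤ energy Y + δ
            combined = ≤-trans (+-monoˡ-≤ h lossy) (subst (_≤ energy Y + δ)
              (add-swap (energy Y) (ι (2 ℕ.* e) * h) h) (+-monoʳ-≤ (energy Y) h-small))
            conclude : energy Y + δ ≤ energy R.X₁ ⊎ energy Y + δ ≤ energy R.X₂ → Improved W l X
            conclude (inj₁ g) = _ , proj₁ w , ≤-trans combined g
            conclude (inj₂ g) = _ , proj₂ w , ≤-trans combined g
          decide : Dec (density B (X i) + η ≤ density (X j) (X i)) → Improved W l X
          decide (yes le) with S′.gain 0≤δ (≤-trans δ-small (gap-square (density B (X i)) (density (X j) (X i)) le))
          ... | inj₁ g = _ , pad {W} {l} {Y} v₁ , ≤-trans (+-monoʳ-≤ (energy X) h≤δ) g
          ... | inj₂ g = _ , pad {W} {l} {S.X₂} v₂ , ≤-trans (+-monoʳ-≤ (energy X) h≤δ) g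
          decide (no ¬le) with energy X + h ≤? energy S.X₂
          ... | yes g = _ , pad {W} {l} {S.X₂} v₂ , g
          -- Neither the complement of `B` gains `h` nor does the first move drop by `η`. So the
          -- passage to `B` costs at most `ι (2 * e) * h`, the split by `A` earns `δ`, and at least
          -- `h` is left.
          ... | no ¬g = second through (S′.loss 0≤h (<⇒≤ (≰⇒> ¬g)))
            where
            through : density A B + η ≤ density (X i) B
            through = +-cancelʳ-≤′ η (≤-trans (≤-trans (≤-reflexive (+-assoc (density A B) η η)) sparse)
              (≤-trans (≤-reflexive (density-sym (X i) (X j))) (≤-trans (<⇒≤ (≰⇒> ¬le)) (≤-reflexive (cong (_+ η) (density-sym B (X i)))))))
              where
              +-cancelʳ-≤′ : ∀ r {x y} → x + r ≤ y + r → x ≤ y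
              +-cancelʳ-≤′ r {x} {y} le = subst₂ _≤_ (undo-add x r) (undo-add y r) (+-monoˡ-≤ (- r) le)

  -- The reduced graph of a tuple

  ∑ℚ-ι : ∀ {n} (f : Fin n → ℕ) → ∑ℚ (ι ∘ f) ≡ ι (sum f)
  ∑ℚ-ι {zero}  f = sym ι-0
  ∑ℚ-ι {suc n} f = trans (cong (ι (f zero) +_) (∑ℚ-ι (f ∘ suc))) (sym (ι-+ (f zero) (sum (f ∘ suc))))

  pick-pair : {A : Set} {Q R : A → A → Set} {xs : List A} → AllPairs Q xs → AnyPair R xs → ∃[ x ] ∃[ y ] (Q x y × R x y)
  pick-pair (q ∷ _) (head r) = _ , go q r
    where
    go : ∀ {A : Set} {Q R : A → Set} {xs} → All Q xs → Any R xs → ∃[ y ] (Q y × R y)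
    go (q ∷ _)  (here r)  = _ , q , r
    go (_ ∷ qs) (there r) = go qs r
  pick-pair (_ ∷ qs) (tail r) = pick-pair qs r

  module Gain (M : ℕ) (1≤M : 1 ℕ.≤ M) (c : ℕ) where

    e : ℕ
    e = sparseness c 3

    1≤e : 1 ℕ.≤ e
    1≤e = s≤s z≤n

    -- `η + η` is 1/M, the distance between the tier thresholds and the densities used by the
    -- embedding. `δ` is what a gap of `η` guarantees, and `h` solves `h + ι (2 * e) * h ≡ δ`.
    η δ h : ℚ
    η = inv 2 * inv M
    δ = inv (2 ℕ.* e) * (η * η)
    h = inv (1 ℕ.+ 2 ℕ.* e) * δ

    0≤η : 0ℚ ≤ η
    0≤η = 0≤* (0≤inv 2) (0≤inv M)

    0<h : 0ℚ < h
    0<h = 0<* (0<inv (s≤s z≤n)) (0<* (0<inv (s≤s z≤n)) (0<* (0<* (0<inv (s≤s z≤n)) (0<inv 1≤M)) (0<* (0<inv (s≤s z≤n)) (0<inv 1≤M))))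

    0≤h : 0ℚ ≤ h
    0≤h = <⇒≤ 0<h

    ι-inv-cancel : ∀ m p → 1 ℕ.≤ m → ι m * (inv m * p) ≡ p
    ι-inv-cancel m p 1≤m = trans (sym (*-assoc (ι m) (inv m) p)) (trans (cong (_* p) (ι*inv 1≤m)) (*-identityˡ p))

    δ-small : ι (2 ℕ.* e) * δ ≤ η * η
    δ-small = ≤-reflexive (ι-inv-cancel (2 ℕ.* e) (η * η) (s≤s z≤n))

    h-small : h + ι (2 ℕ.* e) * h ≤ δ
    h-small = ≤-reflexive (begin
      h + ι (2 ℕ.* e) * h          ≡⟨ cong (_+ ι (2 ℕ.* e) * h) (trans (cong (_* h) ι-1) (*-identityˡ h)) ⟨
      ι 1 * h + ι (2 ℕ.* e) * h    ≡⟨ *-distribʳ-+ h (ι 1) (ι (2 ℕ.* e)) ⟨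
      (ι 1 + ι (2 ℕ.* e)) * h      ≡⟨ cong (_* h) (ι-+ 1 (2 ℕ.* e)) ⟨
      ι (1 ℕ.+ 2 ℕ.* e) * h        ≡⟨ ι-inv-cancel (1 ℕ.+ 2 ℕ.* e) δ (s≤s z≤n) ⟩
      δ                            ∎)
      where open ≡-Reasoning

  module Reduced {n : ℕ} (1≤n : 1 ℕ.≤ n) (G : Graph n) (free : KFree 9 G) (M : ℕ) (1≤M : 1 ℕ.≤ M)
    (c L l₀ : ℕ) (1≤c : 1 ℕ.≤ c)
    (extend₂ : Threshold.Extendable G 3 (3 ℕ.* M) 2 c L)
    (extend₃ : Threshold.Extendable G (2 ℕ.* M ℕ.+ 3) (3 ℕ.* M) 3 c L)
    (triangle : ∀ U → n ℕ.≤ L ℕ.* card U → TriangleIn G U)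
    (demand₃ : demand c 3 l₀ ℕ.≤ L) (demand₂ : demand c 2 l₀ ℕ.≤ L) where

    open Energy G {M} (ι M)

    open Gain M 1≤M c

    open Improve e 1≤e η δ h 0≤η 0≤h δ-small h-small using (Improved; improve) public

    private
      0<3M : 0ℚ < ι (3 ℕ.* M)
      0<3M = 0<ι (ℕ.≤-trans 1≤M (ℕ.m≤m+n M _))

      2η : η + η ≡ inv M
      2η = trans (sym (*-distribʳ-+ (inv M) (inv 2) (inv 2))) (trans (cong (_* inv M) half+half) (*-identityˡ (inv M)))

    sum-pos : ∀ {W l X} → 1 ℕ.≤ W → Valid W l X → ∀ i → 1 ℕ.≤ sum (X i)
    sum-pos {W} {l} {X} 1≤W v i = *-posʳ G l (sum (X i)) (ℕ.≤-trans (ℕ.*-mono-≤ 1≤n 1≤W) (large v i))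

    sparse-improved : ∀ {num W l X i j e′} → e′ ℕ.≤ e → 1 ℕ.≤ W → Valid W l X → i ≢ j →
      ι (num ℕ.+ 3) ≤ ι (3 ℕ.* M) * density G (X i) (X j) → Threshold.Sparse G num (3 ℕ.* M) e′ (X i) (X j) → Improved W l X
    sparse-improved {num} {W} {l} {X} {i} {j} e′≤e 1≤W v i≢j dense sp with Threshold.Sparse-mono G num (3 ℕ.* M) e′≤e sp
    ... | Threshold.sparse {A} {B} A≤X B≤X lA lB few =
      improve v i≢j A≤X B≤X hA hB lA lB (*-cancelˡ 0<3M (≤-trans (≤-trans (≤-reflexive scaled) (+-monoˡ-≤ (ι 3) (density-scaled≤ G A B hA hB few)))
        (≤-trans (≤-reflexive (sym (ι-+ num 3))) dense)))
      where
      hA : 1 ℕ.≤ sum A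
      hA = *-posʳ G e (sum A) (ℕ.≤-trans (sum-pos 1≤W v i) lA)
      hB : 1 ℕ.≤ sum B
      hB = *-posʳ G e (sum B) (ℕ.≤-trans (sum-pos 1≤W v j) lB)
      scaled : ι (3 ℕ.* M) * (density G A B + (η + η)) ≡ ι (3 ℕ.* M) * density G A B + ι 3
      scaled = trans (*-distribˡ-+ (ι (3 ℕ.* M)) (density G A B) (η + η)) (cong (ι (3 ℕ.* M) * density G A B +_)
        (trans (cong₂ _*_ (ι-* 3 M) 2η) (trans (*-assoc (ι 3) (ι M) (inv M)) (trans (cong (ι 3 *_) (ι*inv 1≤M)) (*-identityʳ (ι 3))))))

    -- The cuts are at 2/M and 2/3 + 2/M. Each lies 1/M above the threshold, 1/M or 2/3 + 1/M, at
    -- which the embedding tests, so a sparse pair inside a pair above the cut has density lower by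
    -- at least `η + η`.
    level : ℚ → Tier
    level d = if does (ι (3 ℕ.* M) * d ≤? ι 6) then 0F else if does (ι (3 ℕ.* M) * d ≤? ι (2 ℕ.* M ℕ.+ 6)) then 1F else 2F

    level-nonzero : ∀ d → level d ≢ 0F → ι 6 ≤ ι (3 ℕ.* M) * d
    level-nonzero d h with ι (3 ℕ.* M) * d ≤? ι 6
    ... | yes _ = ⊥-elim (h refl)
    ... | no ¬p = <⇒≤ (≰⇒> ¬p)

    level-heavy : ∀ d → level d ≡ 2F → ι (2 ℕ.* M ℕ.+ 6) ≤ ι (3 ℕ.* M) * d
    level-heavy d h with ι (3 ℕ.* M) * d ≤? ι 6 | ι (3 ℕ.* M) * d ≤? ι (2 ℕ.* M ℕ.+ 6)
    level-heavy d () | yes _ | _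
    level-heavy d () | no _  | yes _
    level-heavy d _  | no _  | no ¬p = <⇒≤ (≰⇒> ¬p)

    level-upper : ∀ d → d ≤ 1ℚ → ι (3 ℕ.* M) * d ≤ ι (M ℕ.* value (level d) ℕ.+ 6)
    level-upper d d≤1 with ι (3 ℕ.* M) * d ≤? ι 6 | ι (3 ℕ.* M) * d ≤? ι (2 ℕ.* M ℕ.+ 6)
    ... | yes p | _     = ≤-trans p (ι-mono (ℕ.m≤n+m 6 (M ℕ.* 0)))
    ... | no _  | yes p = ≤-trans p (≤-reflexive (cong (λ m → ι (m ℕ.+ 6)) (ℕ.*-comm 2 M)))
    ... | no _  | no _  = ≤-trans (*-monoˡ (0≤ι (3 ℕ.* M)) d≤1) (≤-trans (≤-reflexive (*-identityʳ (ι (3 ℕ.* M))))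
                            (ι-mono (ℕ.≤-trans (ℕ.≤-reflexive (ℕ.*-comm 3 M)) (ℕ.m≤m+n (M ℕ.* 3) 6))))

    module Tiers (X : Tuple) where

      D : Fin M → Fin M → ℚ
      D i j = density G (X i) (X j)

      tier : Fin M → Fin M → Tier
      tier i j = if does (i Fin.≟ j) then 0F else level (D i j)

      tier-sym : ∀ i j → tier i j ≡ tier j i
      tier-sym i j = cong₂ (λ b d → if b then 0F else level d) (does-≟-sym i j) (density-sym G (X i) (X j))

      tier-nonzero : ∀ {i j} → tier i j ≢ 0F → i ≢ j × ι 6 ≤ ι (3 ℕ.* M) * D i j
      tier-nonzero {i} {j} h with i Fin.≟ j
      ... | yes _ = ⊥-elim (h refl)
      ... | no ¬p = ¬p , level-nonzero (D i j) h

      tier-heavy : ∀ {i j} → tier i j ≡ 2F → i ≢ j × ι (2 ℕ.* M ℕ.+ 6) ≤ ι (3 ℕ.* M) * D i j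
      tier-heavy {i} {j} h with i Fin.≟ j
      tier-heavy () | yes _
      ... | no ¬p = ¬p , level-heavy (D i j) h

      -- Of the error 9, the tier cuts contribute 6 and the square term, being at most 1,
      -- contributes 3.
      cell-upper : (∀ i → 1 ℕ.≤ sum (X i)) → ∀ i j → ι 3 * cell X i j ≤ ι (M ℕ.* value (tier i j) ℕ.+ 9)
      cell-upper pos i j with i Fin.≟ j
      ... | yes _ = ≤-trans (≤-reflexive (*-zeroʳ (ι 3))) (0≤ι _)
      ... | no _  = begin
        ι 3 * (ι M * d + d * d)            ≡⟨ *-distribˡ-+ (ι 3) (ι M * d) (d * d) ⟩
        ι 3 * (ι M * d) + ι 3 * (d * d)    ≡⟨ cong (_+ ι 3 * (d * d)) (trans (sym (*-assoc (ι 3) (ι M) d)) (cong (_* d) (sym (ι-* 3 M)))) ⟩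
        ι (3 ℕ.* M) * d + ι 3 * (d * d)    ≤⟨ +-mono-≤ (level-upper d d≤1) (*-monoˡ (0≤ι 3) (≤-trans (*-monoˡ 0≤d d≤1) (≤-trans (≤-reflexive (*-identityʳ d)) d≤1))) ⟩
        ι (M ℕ.* v ℕ.+ 6) + ι 3 * 1ℚ       ≡⟨ cong (ι (M ℕ.* v ℕ.+ 6) +_) (*-identityʳ (ι 3)) ⟩
        ι (M ℕ.* v ℕ.+ 6) + ι 3            ≡⟨ ι-+ (M ℕ.* v ℕ.+ 6) 3 ⟨
        ι (M ℕ.* v ℕ.+ 6 ℕ.+ 3)            ≡⟨ cong ι (ℕ.+-assoc (M ℕ.* v) 6 3) ⟩
        ι (M ℕ.* v ℕ.+ 9)                  ∎
        where
        open ≤-Reasoning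
        d = D i j
        v = value (level d)
        0≤d : 0ℚ ≤ d
        0≤d = 0≤density G (X i) (X j)
        d≤1 : d ≤ 1ℚ
        d≤1 = density≤1 G (X i) (X j) (pos i) (pos j)

      energy-upper : (∀ i → 1 ℕ.≤ sum (X i)) → 5 ℕ.* sum (λ i → sum λ j → value (tier i j)) ℕ.≤ 9 ℕ.* (M ℕ.* M) →
        ι 15 * energy X ≤ ι (9 ℕ.* (M ℕ.* (M ℕ.* M)) ℕ.+ 45 ℕ.* (M ℕ.* M))
      energy-upper pos turán = begin
        ι 15 * energy X                    ≡⟨ trans (cong (_* energy X) (ι-* 5 3)) (*-assoc (ι 5) (ι 3) (energy X)) ⟩
        ι 5 * (ι 3 * energy X)             ≤⟨ *-monoˡ (0≤ι 5) triple ⟩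
        ι 5 * ι (M ℕ.* V ℕ.+ 9 ℕ.* (M ℕ.* M)) ≡⟨ ι-* 5 (M ℕ.* V ℕ.+ 9 ℕ.* (M ℕ.* M)) ⟨
        ι (5 ℕ.* (M ℕ.* V ℕ.+ 9 ℕ.* (M ℕ.* M))) ≤⟨ ι-mono (final M V turán) ⟩
        ι (9 ℕ.* (M ℕ.* (M ℕ.* M)) ℕ.+ 45 ℕ.* (M ℕ.* M)) ∎
        where
        open ≤-Reasoning
        V : ℕ
        V = sum λ i → sum λ j → value (tier i j)
        final : ∀ M V → 5 ℕ.* V ℕ.≤ 9 ℕ.* (M ℕ.* M) → 5 ℕ.* (M ℕ.* V ℕ.+ 9 ℕ.* (M ℕ.* M)) ℕ.≤ 9 ℕ.* (M ℕ.* (M ℕ.* M)) ℕ.+ 45 ℕ.* (M ℕ.* M)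
        final M V t = subst₂ ℕ._≤_
          (solve 2 (λ m v → m :* (con 5 :* v) :+ con 45 :* (m :* m) := con 5 :* (m :* v :+ con 9 :* (m :* m))) refl M V)
          (cong (ℕ._+ 45 ℕ.* (M ℕ.* M)) (solve 1 (λ m → m :* (con 9 :* (m :* m)) := con 9 :* (m :* (m :* m))) refl M))
          (ℕ.+-monoˡ-≤ (45 ℕ.* (M ℕ.* M)) (ℕ.*-monoʳ-≤ M t))
          where open ℕ-Solver
        count : sum (λ i → sum λ j → M ℕ.* value (tier i j) ℕ.+ 9) ≡ M ℕ.* V ℕ.+ 9 ℕ.* (M ℕ.* M)
        count = trans (sum-cong-≗ λ i → trans (∑-distrib-+ (λ j → M ℕ.* value (tier i j)) (λ _ → 9))
            (cong₂ ℕ._+_ (sym (*-distribˡ-sum M (λ j → value (tier i j)))) (∑-const M 9)))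
          (trans (∑-distrib-+ (λ i → M ℕ.* sum (λ j → value (tier i j))) (λ _ → M ℕ.* 9))
            (cong₂ ℕ._+_ (sym (*-distribˡ-sum M (λ i → sum λ j → value (tier i j))))
              (trans (∑-const M (M ℕ.* 9)) (trans (sym (ℕ.*-assoc M M 9)) (ℕ.*-comm (M ℕ.* M) 9)))))
        triple : ι 3 * energy X ≤ ι (M ℕ.* V ℕ.+ 9 ℕ.* (M ℕ.* M))
        triple = begin
          ι 3 * energy X
            ≡⟨ trans (ℚSum.*-distribˡ-sum (ι 3) (λ i → ∑ℚ (cell X i)))
                     (ℚSum.sum-cong-≗ λ i → ℚSum.*-distribˡ-sum (ι 3) (cell X i)) ⟩
          ∑ℚ (λ i → ∑ℚ λ j → ι 3 * cell X i j)            ≤⟨ ∑ℚ-mono (λ i → ∑ℚ-mono (cell-upper pos i)) ⟩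
          ∑ℚ (λ i → ∑ℚ λ j → ι (M ℕ.* value (tier i j) ℕ.+ 9))
            ≡⟨ trans (ℚSum.sum-cong-≗ λ i → ∑ℚ-ι (λ j → M ℕ.* value (tier i j) ℕ.+ 9))
                     (∑ℚ-ι (λ i → sum λ j → M ℕ.* value (tier i j) ℕ.+ 9)) ⟩
          ι (sum (λ i → sum λ j → M ℕ.* value (tier i j) ℕ.+ 9)) ≡⟨ cong ι count ⟩
          ι (M ℕ.* V ℕ.+ 9 ℕ.* (M ℕ.* M))                 ∎

      module _ {W l : ℕ} (1≤W : 1 ℕ.≤ W) (l≤l₀ : l ℕ.≤ l₀) (v : Valid W l X) where

        private
          bounds : (is : List (Fin M)) → All (λ Y → ∀ u → Y u ℕ.≤ W) (List.map X is)
          bounds is = All.map⁺ (All.universal (bounded v) is)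
          larges : (is : List (Fin M)) → All (λ Y → n ℕ.* W ℕ.≤ l₀ ℕ.* sum Y) (List.map X is)
          larges is = All.map⁺ (All.universal (large (Valid-mono l≤l₀ v)) is)
          no-clique : ∀ {K} → length K ≡ 9 → Clique G K → ⊥
          no-clique size clique = free (subst (λ s → HasClique s G) size (clique⇒HasClique G clique))

        K₄-improved : ∀ a b d f → tier a b ≢ 0F → tier a d ≢ 0F → tier a f ≢ 0F → tier b d ≢ 0F → tier b f ≢ 0F → tier d f ≢ 0F → Improved W l X
        K₄-improved a b d f ab ad af bd bf df
          with Threshold.embed G 3 (3 ℕ.* M) 2 c L W 1≤n 1≤W extend₂ triangle 3 l₀ (X a) (List.map X (b ∷ d ∷ f ∷ [])) refl ℕ.≤-refl
                 (bounds (a ∷ b ∷ d ∷ f ∷ [])) (larges (a ∷ b ∷ d ∷ f ∷ [])) demand₃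
        ... | inj₁ (K , size , clique , _) = ⊥-elim (no-clique size clique)
        ... | inj₂ sp with pick-pair ((ab ∷ ad ∷ af ∷ []) ∷ (bd ∷ bf ∷ []) ∷ (df ∷ []) ∷ [] ∷ []) (AnyPair-map⁻ X {a ∷ b ∷ d ∷ f ∷ []} sp)
        ...   | i , j , t , s = sparse-improved ℕ.≤-refl 1≤W v (proj₁ (tier-nonzero t)) (proj₂ (tier-nonzero t)) s

        heavy-triangle-improved : ∀ a b d → tier a b ≡ 2F → tier a d ≡ 2F → tier b d ≡ 2F → Improved W l X
        heavy-triangle-improved a b d ab ad bd
          with Threshold.embed G (2 ℕ.* M ℕ.+ 3) (3 ℕ.* M) 3 c L W 1≤n 1≤W extend₃ triangle 2 l₀ (X a) (List.map X (b ∷ d ∷ [])) refl (s≤s (s≤s z≤n))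
                 (bounds (a ∷ b ∷ d ∷ [])) (larges (a ∷ b ∷ d ∷ [])) demand₂
        ... | inj₁ (K , size , clique , _) = ⊥-elim (no-clique size clique)
        ... | inj₂ sp with pick-pair ((ab ∷ ad ∷ []) ∷ (bd ∷ []) ∷ [] ∷ []) (AnyPair-map⁻ X {a ∷ b ∷ d ∷ []} sp)
        ...   | i , j , t , s = sparse-improved weaker 1≤W v (proj₁ (tier-heavy t))
                (≤-trans (≤-reflexive (cong ι (ℕ.+-assoc (2 ℕ.* M) 3 3))) (proj₂ (tier-heavy t))) s
          where
          weaker : sparseness c 2 ℕ.≤ e
          weaker = ℕ.≤-trans (ℕ.m≤n*m (sparseness c 2) c {{ℕ.>-nonZero 1≤c}}) (ℕ.m≤n+m (c ℕ.* sparseness c 2) 8)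

        improved-or-bounded : Improved W l X ⊎ ι 15 * energy X ≤ ι (9 ℕ.* (M ℕ.* (M ℕ.* M)) ℕ.+ 45 ℕ.* (M ℕ.* M))
        improved-or-bounded
          with Fin.any? (λ a → Fin.any? λ b → Fin.any? λ d → Fin.any? λ f → ¬? (tier a b Fin.≟ 0F) ×-dec ¬? (tier a d Fin.≟ 0F) ×-dec
                 ¬? (tier a f Fin.≟ 0F) ×-dec ¬? (tier b d Fin.≟ 0F) ×-dec ¬? (tier b f Fin.≟ 0F) ×-dec ¬? (tier d f Fin.≟ 0F))
        ... | yes (a , b , d , f , ab , ad , af , bd , bf , df) = inj₁ (K₄-improved a b d f ab ad af bd bf df)
        ... | no ¬K₄
          with Fin.any? (λ a → Fin.any? λ b → Fin.any? λ d → (tier a b Fin.≟ 2F) ×-dec (tier a d Fin.≟ 2F) ×-dec (tier b d Fin.≟ 2F))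
        ...   | yes (a , b , d , ab , ad , bd) = inj₁ (heavy-triangle-improved a b d ab ad bd)
        ...   | no ¬heavy = inj₂ (energy-upper (sum-pos 1≤W v)
                  (WeightedTurán.turán tier tier-sym (λ a b d f p → ¬K₄ (a , b , d , f , p)) (λ a b d p → ¬heavy (a , b , d , p))))

  -- Iterating the energy increment

  countB-listSum : {A : Set} (p : A → Bool) (xs : List A) → countB p xs ≡ listSum (𝟙 ∘ p) xs
  countB-listSum p []       = refl
  countB-listSum p (x ∷ xs) with p x
  ... | true  = cong suc (countB-listSum p xs)
  ... | false = countB-listSum p xs

  listSum-++ : {A : Set} (f : A → ℕ) (xs ys : List A) → listSum f (xs ++ ys) ≡ listSum f xs ℕ.+ listSum f ys
  listSum-++ f []       ys = refl
  listSum-++ f (x ∷ xs) ys = trans (cong (f x ℕ.+_) (listSum-++ f xs ys)) (sym (ℕ.+-assoc (f x) _ _))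

  listSum-map : {A B : Set} (f : B → ℕ) (g : A → B) (xs : List A) → listSum f (List.map g xs) ≡ listSum (f ∘ g) xs
  listSum-map f g []       = refl
  listSum-map f g (x ∷ xs) = cong (f (g x) ℕ.+_) (listSum-map f g xs)

  listSum-cartesianProduct : {A B : Set} (f : A × B → ℕ) (xs : List A) (ys : List B) →
    listSum f (cartesianProduct xs ys) ≡ listSum (λ x → listSum (λ y → f (x , y)) ys) xs
  listSum-cartesianProduct f []       ys = refl
  listSum-cartesianProduct f (x ∷ xs) ys = trans (listSum-++ f (List.map (x ,_) ys) (cartesianProduct xs ys))
    (cong₂ ℕ._+_ (listSum-map f (x ,_) ys) (listSum-cartesianProduct f xs ys))

  listSum-tabulate : {A : Set} (f : A → ℕ) (g : Fin n → A) → listSum f (List.tabulate g) ≡ sum (f ∘ g)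
  listSum-tabulate {zero}  f g = refl
  listSum-tabulate {suc n} f g = cong (f (g zero) ℕ.+_) (listSum-tabulate f (g ∘ suc))

  edges-sum : (G : Graph n) → edges G ≡ sum (λ i → sum λ j → 𝟙 ((toℕ i <ᵇ toℕ j) ∧ adj G i j))
  edges-sum {n} G = trans (countB-listSum _ (pairs n)) (trans (listSum-cartesianProduct _ (allFin n) (allFin n))
    (trans (listSum-tabulate {n} _ (λ i → i))
      (sum-cong-≗ {n} {λ i → listSum (λ j → E i j) (allFin n)} {λ i → sum (E i)} λ i → listSum-tabulate {n} (E i) (λ j → j))))
    where
    E : Fin n → Fin n → ℕ
    E i j = 𝟙 ((toℕ i <ᵇ toℕ j) ∧ adj G i j)

  ones : Fin n → ℕ
  ones _ = 1

  twice-edges≤ : (G : Graph n) → 2 ℕ.* edges G ℕ.≤ weightedEdges G ones ones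
  twice-edges≤ {n} G = begin
    2 ℕ.* edges G                                              ≡⟨ cong (edges G ℕ.+_) (ℕ.+-identityʳ (edges G)) ⟩
    edges G ℕ.+ edges G                                        ≡⟨ cong₂ ℕ._+_ (edges-sum G) (trans (edges-sum G) (∑-comm E)) ⟩
    sum (λ i → sum (E i)) ℕ.+ sum (λ j → sum λ i → E i j)      ≡⟨ ∑-distrib-+ (λ i → sum (E i)) (λ j → sum λ i → E i j) ⟨
    sum (λ i → sum (E i) ℕ.+ sum (λ j → E j i))                ≡⟨ sum-cong-≗ (λ i → sym (∑-distrib-+ (E i) (λ j → E j i))) ⟩
    sum (λ i → sum λ j → E i j ℕ.+ E j i)                      ≤⟨ ∑-mono (λ i → ∑-mono λ j → once i j) ⟩
    sum (λ i → sum λ j → 𝟙 (adj G i j))                        ≡⟨ sum-cong-≗ (λ i → trans (sum-cong-≗ λ j → sym (ℕ.*-identityˡ (𝟙 (adj G i j)))) (sym (ℕ.*-identityˡ _))) ⟩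
    weightedEdges G ones ones                                  ∎
    where
    open ℕ.≤-Reasoning
    E : Fin n → Fin n → ℕ
    E i j = 𝟙 ((toℕ i <ᵇ toℕ j) ∧ adj G i j)
    asymmetric : ∀ x y → (x <ᵇ y) ≡ true → (y <ᵇ x) ≡ true → ⊥
    asymmetric (suc x) (suc y) p q = asymmetric x y p q
    exclusive : ∀ {p q} a → (p ≡ true → q ≡ true → ⊥) → 𝟙 (p ∧ a) ℕ.+ 𝟙 (q ∧ a) ℕ.≤ 𝟙 a
    exclusive {true}  {true}  a     h = ⊥-elim (h refl refl)
    exclusive {true}  {false} a     h = ℕ.≤-reflexive (ℕ.+-identityʳ (𝟙 a))
    exclusive {false} {true}  a     h = ℕ.≤-refl
    exclusive {false} {false} a     h = z≤n
    once : ∀ i j → E i j ℕ.+ E j i ℕ.≤ 𝟙 (adj G i j)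
    once i j rewrite Graph.sym G j i = exclusive (adj G i j) (asymmetric (toℕ i) (toℕ j))

  ∑ℚ-off-diagonal : ∀ {m} (i : Fin (suc m)) q → ∑ℚ (λ j → if does (i Fin.≟ j) then 0ℚ else q) ≡ ι m * q
  ∑ℚ-off-diagonal {m} zero q = trans (+-identityˡ _) (∑ℚ-const m q)
  ∑ℚ-off-diagonal {suc m} (suc i) q = begin
    q + ∑ℚ (λ j → if does (i Fin.≟ j) then 0ℚ else q) ≡⟨ cong (q +_) (∑ℚ-off-diagonal i q) ⟩
    q + ι m * q            ≡⟨ cong (_+ ι m * q) (trans (cong (_* q) ι-1) (*-identityˡ q)) ⟨
    ι 1 * q + ι m * q      ≡⟨ *-distribʳ-+ q (ι 1) (ι m) ⟨
    (ι 1 + ι m) * q        ≡⟨ cong (_* q) (ι-+ 1 m) ⟨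
    ι (suc m) * q          ∎
    where open ≡-Reasoning

  -- The right-hand side is 9M³ + 54M² - 63M, because the missing diagonal costs 9M² of the 63M²
  -- that the excess 21 provides. This exceeds 9M³ + 48M² from `M = 11` on, and 48 is chosen to beat
  -- the 45 of `energy-upper`.
  start-arithmetic : ∀ m → 10 ℕ.≤ m → let M = suc m in
    9 ℕ.* (M ℕ.* (M ℕ.* M)) ℕ.+ 48 ℕ.* (M ℕ.* M) ℕ.≤ 3 ℕ.* (M ℕ.* m) ℕ.* (3 ℕ.* M ℕ.+ 21)
  start-arithmetic m m≥10 = subst Claim {10 ℕ.+ (m ℕ.∸ 10)} {m} (ℕ.m+[n∸m]≡n m≥10) (shifted (m ℕ.∸ 10))
    where
    open ℕ-Solver
    Claim : ℕ → Set
    Claim m = 9 ℕ.* (suc m ℕ.* (suc m ℕ.* suc m)) ℕ.+ 48 ℕ.* (suc m ℕ.* suc m) ℕ.≤ 3 ℕ.* (suc m ℕ.* m) ℕ.* (3 ℕ.* suc m ℕ.+ 21)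
    shifted : ∀ k → 9 ℕ.* ((11 ℕ.+ k) ℕ.* ((11 ℕ.+ k) ℕ.* (11 ℕ.+ k))) ℕ.+ 48 ℕ.* ((11 ℕ.+ k) ℕ.* (11 ℕ.+ k)) ℕ.≤
      3 ℕ.* ((11 ℕ.+ k) ℕ.* (10 ℕ.+ k)) ℕ.* (3 ℕ.* (11 ℕ.+ k) ℕ.+ 21)
    shifted k = ℕ.≤-trans (ℕ.m≤m+n _ ((11 ℕ.+ k) ℕ.* (6 ℕ.* k ℕ.+ 3))) (ℕ.≤-reflexive
      (solve 1 (λ k → con 9 :* ((con 11 :+ k) :* ((con 11 :+ k) :* (con 11 :+ k))) :+ con 48 :* ((con 11 :+ k) :* (con 11 :+ k)) :+ (con 11 :+ k) :* (con 6 :* k :+ con 3)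
         := con 3 :* ((con 11 :+ k) :* (con 10 :+ k)) :* (con 3 :* (con 11 :+ k) :+ con 21)) refl k))

  module _ {n : ℕ} (1≤n : 1 ℕ.≤ n) (G : Graph n) (m : ℕ) (m≥10 : 10 ℕ.≤ m)
    (many : (3 ℕ.* suc m ℕ.+ 21) ℕ.* (n ℕ.* n) ℕ.≤ 5 ℕ.* suc m ℕ.* weightedEdges G ones ones) where

    private
      M : ℕ
      M = suc m

    open Energy G {M} (ι M)

    constant : Tuple
    constant _ = ones

    sum-ones : sum (ones {n}) ≡ n
    sum-ones = trans (∑-const n 1) (ℕ.*-identityʳ n)

    constant-density : ι (3 ℕ.* M ℕ.+ 21) ≤ ι (5 ℕ.* M) * density G ones ones
    constant-density = begin
      ι (3 ℕ.* M ℕ.+ 21)                               ≡⟨ *-identityʳ _ ⟨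
      ι (3 ℕ.* M ℕ.+ 21) * 1ℚ                          ≡⟨ cong (ι (3 ℕ.* M ℕ.+ 21) *_) (sizes-cancel G pos pos) ⟨
      ι (3 ℕ.* M ℕ.+ 21) * (ι (s ℕ.* s) * r)           ≡⟨ *-assoc (ι (3 ℕ.* M ℕ.+ 21)) (ι (s ℕ.* s)) r ⟨
      ι (3 ℕ.* M ℕ.+ 21) * ι (s ℕ.* s) * r             ≡⟨ cong (_* r) (ι-* (3 ℕ.* M ℕ.+ 21) (s ℕ.* s)) ⟨
      ι ((3 ℕ.* M ℕ.+ 21) ℕ.* (s ℕ.* s)) * r           ≤⟨ *-monoʳ (0≤* (0≤inv s) (0≤inv s)) (ι-mono many′) ⟩
      ι (5 ℕ.* M ℕ.* weightedEdges G ones ones) * r    ≡⟨ cong (_* r) (ι-* (5 ℕ.* M) (weightedEdges G ones ones)) ⟩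
      ι (5 ℕ.* M) * ι (weightedEdges G ones ones) * r  ≡⟨ *-assoc (ι (5 ℕ.* M)) (ι (weightedEdges G ones ones)) r ⟩
      ι (5 ℕ.* M) * density G ones ones                ∎
      where
      open ≤-Reasoning
      s : ℕ
      s = sum (ones {n})
      r : ℚ
      r = inv s * inv s
      pos : 1 ℕ.≤ s
      pos = subst (1 ℕ.≤_) (sym sum-ones) 1≤n
      many′ : (3 ℕ.* M ℕ.+ 21) ℕ.* (s ℕ.* s) ℕ.≤ 5 ℕ.* M ℕ.* weightedEdges G ones ones
      many′ = subst (λ t → (3 ℕ.* M ℕ.+ 21) ℕ.* (t ℕ.* t) ℕ.≤ 5 ℕ.* M ℕ.* weightedEdges G ones ones) (sym sum-ones) many

    constant-energy : energy constant ≡ ι M * (ι m * F (ι M) (density G ones ones))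
    constant-energy = trans (ℚSum.sum-cong-≗ λ i → ∑ℚ-off-diagonal i (F (ι M) (density G ones ones)))
      (∑ℚ-const M (ι m * F (ι M) (density G ones ones)))

    constant-energy-lower : ι (9 ℕ.* (M ℕ.* (M ℕ.* M)) ℕ.+ 48 ℕ.* (M ℕ.* M)) ≤ ι 15 * energy constant
    constant-energy-lower = begin
      ι (9 ℕ.* (M ℕ.* (M ℕ.* M)) ℕ.+ 48 ℕ.* (M ℕ.* M)) ≤⟨ ι-mono (start-arithmetic m m≥10) ⟩
      ι (3 ℕ.* (M ℕ.* m) ℕ.* (3 ℕ.* M ℕ.+ 21))         ≡⟨ ι-* (3 ℕ.* (M ℕ.* m)) (3 ℕ.* M ℕ.+ 21) ⟩
      ι (3 ℕ.* (M ℕ.* m)) * ι (3 ℕ.* M ℕ.+ 21)         ≤⟨ *-monoˡ (0≤ι _) constant-density ⟩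
      ι (3 ℕ.* (M ℕ.* m)) * (ι (5 ℕ.* M) * d)          ≡⟨ cong (ι (3 ℕ.* (M ℕ.* m)) *_) (trans (cong (_* d) (ι-* 5 M)) (*-assoc (ι 5) (ι M) d)) ⟩
      ι (3 ℕ.* (M ℕ.* m)) * (ι 5 * (ι M * d))          ≤⟨ *-monoˡ (0≤ι _) (*-monoˡ (0≤ι 5) (≤-diff (d * d) (0≤square d) refl)) ⟩
      ι (3 ℕ.* (M ℕ.* m)) * (ι 5 * F (ι M) d)          ≡⟨ *-assoc (ι (3 ℕ.* (M ℕ.* m))) (ι 5) (F (ι M) d) ⟨
      ι (3 ℕ.* (M ℕ.* m)) * ι 5 * F (ι M) d            ≡⟨ cong (_* F (ι M) d) regroup ⟩
      ι 15 * (ι M * ι m) * F (ι M) d                   ≡⟨ trans (*-assoc (ι 15) (ι M * ι m) (F (ι M) d)) (cong (ι 15 *_) (*-assoc (ι M) (ι m) (F (ι M) d))) ⟩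
      ι 15 * (ι M * (ι m * F (ι M) d))                 ≡⟨ cong (ι 15 *_) constant-energy ⟨
      ι 15 * energy constant                           ∎
      where
      open ≤-Reasoning
      d : ℚ
      d = density G ones ones
      regroup : ι (3 ℕ.* (M ℕ.* m)) * ι 5 ≡ ι 15 * (ι M * ι m)
      regroup = trans (sym (ι-* (3 ℕ.* (M ℕ.* m)) 5)) (trans (cong ι (reorder (M ℕ.* m))) (trans (ι-* 15 (M ℕ.* m)) (cong (ι 15 *_) (ι-* M m))))
        where
        reorder : ∀ x → 3 ℕ.* x ℕ.* 5 ≡ 15 ℕ.* x
        reorder = solve 1 (λ x → con 3 :* x :* con 5 := con 15 :* x) refl
          where open ℕ-Solver

    constant-valid : Valid 1 1 constant
    constant-valid = valid (λ _ _ → s≤s z≤n) λ _ → ℕ.≤-reflexive (trans (ℕ.*-identityʳ n) (trans (sym sum-ones) (sym (ℕ.*-identityˡ (sum (ones {n}))))))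

  -- The mass ratio after `f` improvements: each allows for two splits, and a split multiplies the
  -- ratio by `2 * e`.
  grow : ℕ → ℕ → ℕ → ℕ
  grow e zero    l = l
  grow e (suc f) l = grow e f (2 ℕ.* (2 ℕ.* l ℕ.* e) ℕ.* e)

  ≤grow : ∀ e f l → 1 ℕ.≤ e → l ℕ.≤ grow e f l
  ≤grow e zero    l 1≤e = ℕ.≤-refl
  ≤grow e (suc f) l 1≤e = ℕ.≤-trans (ℕ.≤-trans (twice l) (twice (2 ℕ.* l ℕ.* e))) (≤grow e f _ 1≤e)
    where
    twice : ∀ x → x ℕ.≤ 2 ℕ.* x ℕ.* e
    twice x = ℕ.≤-trans (ℕ.m≤m+n x _) (ℕ.m≤m*n (2 ℕ.* x) e {{ℕ.>-nonZero 1≤e}})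

  module Iteration {n : ℕ} (1≤n : 1 ℕ.≤ n) (G : Graph n) (free : KFree 9 G) (M : ℕ) (1≤M : 1 ℕ.≤ M)
    (c L l₀ : ℕ) (1≤c : 1 ℕ.≤ c)
    (extend₂ : Threshold.Extendable G 3 (3 ℕ.* M) 2 c L)
    (extend₃ : Threshold.Extendable G (2 ℕ.* M ℕ.+ 3) (3 ℕ.* M) 3 c L)
    (triangle : ∀ U → n ℕ.≤ L ℕ.* card U → TriangleIn G U)
    (demand₃ : demand c 3 l₀ ℕ.≤ L) (demand₂ : demand c 2 l₀ ℕ.≤ L) where

    open Energy G {M} (ι M)
    open Gain M 1≤M c
    open Reduced 1≤n G free M 1≤M c L l₀ 1≤c extend₂ extend₃ triangle demand₃ demand₂

    energy-max : ∀ X → (∀ i → 1 ℕ.≤ sum (X i)) → energy X ≤ ι (M ℕ.* (M ℕ.* (M ℕ.+ 1)))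
    energy-max X pos = begin
      energy X                                  ≤⟨ ∑ℚ-mono (λ i → ∑ℚ-mono (cell-max i)) ⟩
      ∑ℚ {M} (λ i → ∑ℚ {M} λ j → ι (M ℕ.+ 1))       ≡⟨ ℚSum.sum-cong-≗ {M} (λ i → ∑ℚ-const M (ι (M ℕ.+ 1))) ⟩
      ∑ℚ {M} (λ i → ι M * ι (M ℕ.+ 1))          ≡⟨ ∑ℚ-const M (ι M * ι (M ℕ.+ 1)) ⟩
      ι M * (ι M * ι (M ℕ.+ 1))                 ≡⟨ trans (cong (ι M *_) (sym (ι-* M (M ℕ.+ 1)))) (sym (ι-* M (M ℕ.* (M ℕ.+ 1)))) ⟩
      ι (M ℕ.* (M ℕ.* (M ℕ.+ 1)))               ∎
      where
      open ≤-Reasoning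
      cell-max : ∀ i j → cell X i j ≤ ι (M ℕ.+ 1)
      cell-max i j with i Fin.≟ j
      ... | yes _ = 0≤ι (M ℕ.+ 1)
      ... | no _  = begin
        ι M * d + d * d      ≤⟨ +-mono-≤ (*-monoˡ (0≤ι M) d≤1) (≤-trans (*-monoˡ (0≤density G (X i) (X j)) d≤1) (≤-trans (≤-reflexive (*-identityʳ d)) d≤1)) ⟩
        ι M * 1ℚ + 1ℚ        ≡⟨ cong₂ _+_ (*-identityʳ (ι M)) (sym ι-1) ⟩
        ι M + ι 1            ≡⟨ ι-+ M 1 ⟨
        ι (M ℕ.+ 1)          ∎
        where
        d : ℚ
        d = density G (X i) (X j)
        d≤1 : d ≤ 1ℚ
        d≤1 = density≤1 G (X i) (X j) (pos i) (pos j)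

    -- The last hypothesis says that the remaining fuel, at `h` per round, would carry the energy
    -- beyond its maximum, which is absurd at fuel zero. The lower bound on the energy persists
    -- because the energy only grows, and its 48 against 45 rules out the round in which no
    -- improvement exists.
    iterate : ∀ fuel {W l X} → 1 ℕ.≤ W → Valid W l X → grow e fuel l ℕ.≤ l₀ →
      ι (9 ℕ.* (M ℕ.* (M ℕ.* M)) ℕ.+ 48 ℕ.* (M ℕ.* M)) ≤ ι 15 * energy X →
      ι (M ℕ.* (M ℕ.* (M ℕ.+ 1)) ℕ.+ 1) ≤ energy X + ι fuel * h → ⊥
    iterate zero {X = X} 1≤W v _ _ top = ℕ.m+1+n≰m (M ℕ.* (M ℕ.* (M ℕ.+ 1))) (ι-cancel (≤-trans top (≤-trans
      (≤-reflexive (trans (cong (energy X +_) (trans (cong (_* h) ι-0) (*-zeroˡ h))) (+-identityʳ (energy X)))) (energy-max X (sum-pos 1≤W v)))))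
    iterate (suc fuel) {W} {l} {X} 1≤W v l≤ low top with Tiers.improved-or-bounded X 1≤W (ℕ.≤-trans (≤grow e (suc fuel) l 1≤e) l≤) v
    ... | inj₁ (X′ , v′ , gain) = iterate fuel {X = X′} (ℕ.≤-trans 1≤W (ℕ.≤-trans (ℕ.m≤m+n W _) (ℕ.m≤m+n (2 ℕ.* W) _))) v′ l≤
        (≤-trans low (*-monoˡ (0≤ι 15) (≤-trans (≤-diff h 0≤h refl) gain)))
        (≤-trans top (≤-trans (≤-reflexive shift) (+-monoˡ-≤ (ι fuel * h) gain)))
      where
      shift : energy X + ι (suc fuel) * h ≡ energy X + h + ι fuel * h
      shift = trans (cong (energy X +_) (trans (cong (_* h) (ι-+ 1 fuel)) (trans (*-distribʳ-+ h (ι 1) (ι fuel))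
        (cong (_+ ι fuel * h) (trans (cong (_* h) ι-1) (*-identityˡ h)))))) (sym (+-assoc (energy X) h (ι fuel * h)))
    ... | inj₂ bound = impossible M 1≤M (ι-cancel (≤-trans low bound))
      where
      impossible : ∀ M → 1 ℕ.≤ M → 9 ℕ.* (M ℕ.* (M ℕ.* M)) ℕ.+ 48 ℕ.* (M ℕ.* M) ℕ.≤ 9 ℕ.* (M ℕ.* (M ℕ.* M)) ℕ.+ 45 ℕ.* (M ℕ.* M) → ⊥
      impossible M 1≤M le = ℕ.<-irrefl refl (ℕ.<-≤-trans (ℕ.*-monoˡ-< (M ℕ.* M) {{ℕ.>-nonZero (ℕ.*-mono-≤ 1≤M 1≤M)}} {45} {48} (ℕ.m≤m+n 46 2))
        (ℕ.+-cancelˡ-≤ (9 ℕ.* (M ℕ.* (M ℕ.* M))) _ _ le))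

    refute : ∀ {m} → M ≡ suc m → 10 ℕ.≤ m → (3 ℕ.* M ℕ.+ 21) ℕ.* (n ℕ.* n) ℕ.≤ 5 ℕ.* M ℕ.* weightedEdges G ones ones →
      ∀ R → grow e R 1 ℕ.≤ l₀ → ι (M ℕ.* (M ℕ.* (M ℕ.+ 1)) ℕ.+ 1) ≤ ι R * h → ⊥
    refute {m} refl m≥10 many R R≤ top = iterate R (s≤s z≤n) (constant-valid 1≤n G m m≥10 many) R≤ low
      (≤-trans top (≤-trans (≤-reflexive (sym (+-identityˡ (ι R * h)))) (+-monoˡ-≤ (ι R * h) nonneg)))
      where
      low : ι (9 ℕ.* (M ℕ.* (M ℕ.* M)) ℕ.+ 48 ℕ.* (M ℕ.* M)) ≤ ι 15 * energy (λ _ → ones)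
      low = constant-energy-lower 1≤n G m m≥10 many
      nonneg : 0ℚ ≤ energy (λ _ → ones)
      nonneg = *-cancelˡ (0<ι (s≤s z≤n)) (≤-trans (≤-reflexive (*-zeroʳ (ι 15))) (≤-trans (0≤ι _) low))

  -- Choice of constants and conclusion

  indepNumber-pos : (G : Graph n) → 1 ℕ.≤ n → 1 ℕ.≤ indepNumber G
  indepNumber-pos {suc n} G _ = ℕ.≤-trans (ℕ.≤-trans (ℕ.≤-reflexive (cong 𝟙 (sym (≟-refl {suc n} zero)))) (term≤∑ (𝟙 ∘ single) zero))
    (independent-card≤ G single λ u v p q → trans (cong₂ (adj G) (sym (≟-true p)) (sym (≟-true q))) (irrefl G zero))
    where
    single : Fin (suc n) → Bool
    single u = does (zero Fin.≟ u)

  -- Fixed from `M` alone, before the graph is given: the number of rounds `R` determines the worst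
  -- mass ratio `l₀` of the tuples, and this determines the ratio `L` for the vertex sets in which
  -- edges and triangles are needed.
  record Constants (M : ℕ) (1≤M : 1 ℕ.≤ M) : Set where
    open Gain M 1≤M (edgeFactor M)
    field
      R l₀ L  : ℕ
      1≤L     : 1 ℕ.≤ L
      growth≤ : grow e R 1 ℕ.≤ l₀
      demand₃ : demand (edgeFactor M) 3 l₀ ℕ.≤ L
      demand₂ : demand (edgeFactor M) 2 l₀ ℕ.≤ L
      enough  : ι (M ℕ.* (M ℕ.* (M ℕ.+ 1)) ℕ.+ 1) ≤ ι R * h

  constants : ∀ M 1≤M → Constants M 1≤M
  constants M 1≤M = choose (archimedean 0<h)
    where
    open Gain M 1≤M (edgeFactor M)
    b : ℕ
    b = M ℕ.* (M ℕ.* (M ℕ.+ 1)) ℕ.+ 1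
    choose : ∃[ H ] (1 ℕ.≤ H × 1ℚ ≤ ι H * h) → Constants M 1≤M
    choose (H , _ , 1≤Hh) = record
      { R       = b ℕ.* H
      ; l₀      = l₀
      ; L       = suc (demand (edgeFactor M) 3 l₀ ℕ.+ demand (edgeFactor M) 2 l₀)
      ; 1≤L     = s≤s z≤n
      ; growth≤ = ℕ.≤-refl
      ; demand₃ = ℕ.m≤n⇒m≤1+n (ℕ.m≤m+n (demand (edgeFactor M) 3 l₀) (demand (edgeFactor M) 2 l₀))
      ; demand₂ = ℕ.m≤n⇒m≤1+n (ℕ.m≤n+m (demand (edgeFactor M) 2 l₀) (demand (edgeFactor M) 3 l₀))
      ; enough  = begin
          ι b                ≡⟨ *-identityʳ (ι b) ⟨
          ι b * 1ℚ           ≤⟨ *-monoˡ (0≤ι b) 1≤Hh ⟩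
          ι b * (ι H * h)    ≡⟨ *-assoc (ι b) (ι H) h ⟨
          ι b * ι H * h      ≡⟨ cong (_* h) (ι-* b H) ⟨
          ι (b ℕ.* H) * h    ∎
      }
      where
      open ≤-Reasoning
      l₀ : ℕ
      l₀ = grow e (b ℕ.* H) 1

  edge-bound : ∀ {M} (1≤M : 1 ℕ.≤ M) → 11 ℕ.≤ M → (C : Constants M 1≤M) → let open Constants C in
    order-threshold M L ℕ.≤ n → ∀ {q} → IsInverseRamsey 3 n q → (G : Graph n) → KFree 9 G →
    suc L ℕ.* indepNumber G ℕ.≤ q → 10 ℕ.* M ℕ.* edges G ℕ.< (3 ℕ.* M ℕ.+ 21) ℕ.* (n ℕ.* n)
  edge-bound {n} {M} 1≤M 11≤M record { R = R ; l₀ = l₀ ; L = L ; 1≤L = 1≤L ; growth≤ = growth≤ ; demand₃ = demand₃ ; demand₂ = demand₂ ; enough = enough }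
    n-large {q} ramsey G free α-small = ℕ.≰⇒> λ many →
    Iteration.refute 1≤n G free M 1≤M (edgeFactor M) L l₀ (ℕ.≤-trans 1≤M (≤edgeFactor M 1≤M))
      (edge-extendable G M L 1≤M 1≤L ramsey α≤q n-large) (triangle-extendable G M (edgeFactor M) L (≤edgeFactor M 1≤M) triangle) triangle demand₃ demand₂
      (sym (ℕ.suc-pred M {{ℕ.>-nonZero 1≤M}})) (ℕ.pred-mono-≤ 11≤M)
      (ℕ.≤-trans many (ℕ.≤-trans (ℕ.≤-reflexive (halve M (edges G))) (ℕ.*-monoʳ-≤ (5 ℕ.* M) (twice-edges≤ G)))) R growth≤ enough
    where
    1≤n : 1 ℕ.≤ n
    1≤n = ℕ.≤-trans (order-threshold-pos M L) n-large
    halve : ∀ M x → 10 ℕ.* M ℕ.* x ≡ 5 ℕ.* M ℕ.* (2 ℕ.* x)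
    halve = solve 2 (λ m x → con 10 :* m :* x := con 5 :* m :* (con 2 :* x)) refl
      where open ℕ-Solver
    α≤q : indepNumber G ℕ.≤ q
    α≤q = ℕ.≤-trans (ℕ.m≤m+n (indepNumber G) (L ℕ.* indepNumber G)) α-small
    triangle : ∀ U → n ℕ.≤ L ℕ.* card U → TriangleIn G U
    -- The factor `suc L` in place of `L`, together with a positive independence number, gives the
    -- strict inequality that the disjoint copies require.
    triangle = triangle-in-large-set {L = L} ramsey G (ℕ.≤-trans (ℕ.+-monoˡ-≤ (L ℕ.* indepNumber G) (indepNumber-pos G 1≤n)) α-small)

  -- The edge bound has density 3/10 + 21/(10M), so the error has to be at most `γ`.
  choose-M : ∀ {γ} → 0ℚ < γ → ∃[ M ] (11 ℕ.≤ M × ι 21 ≤ ι (10 ℕ.* M) * γ)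
  choose-M {γ} 0<γ with archimedean 0<γ
  ... | N , 1≤N , 1≤Nγ = 21 ℕ.* N , ℕ.≤-trans (ℕ.m≤m+n 11 10) (ℕ.*-monoʳ-≤ 21 1≤N) , (begin
    ι 21                       ≤⟨ ι-mono (ℕ.m≤m+n 21 189) ⟩
    ι 210                      ≡⟨ *-identityʳ (ι 210) ⟨
    ι 210 * 1ℚ                 ≤⟨ *-monoˡ (0≤ι 210) 1≤Nγ ⟩
    ι 210 * (ι N * γ)          ≡⟨ *-assoc (ι 210) (ι N) γ ⟨
    ι 210 * ι N * γ            ≡⟨ cong (_* γ) (trans (sym (ι-* 210 N)) (cong ι (ℕ.*-assoc 10 21 N))) ⟩
    ι (10 ℕ.* (21 ℕ.* N)) * γ  ∎)
    where open ≤-Reasoning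

  edge-density-bound : ∀ γ → 0ℚ < γ → Σ ℚ λ δ → 0ℚ < δ × Σ ℕ λ N₀ → ∀ n → N₀ ℕ.≤ n →
    ∀ q → IsInverseRamsey 3 n q → ∀ (G : Graph n) → KFree 9 G →
    ι (indepNumber G) ≤ δ * ι q → ι (edges G) ≤ (ℤ.+ 3 ℚ./ 10 + γ) * ι (n ℕ.* n)
  edge-density-bound γ 0<γ = conclude (choose-M 0<γ)
    where
    conclude : ∃[ M ] (11 ℕ.≤ M × ι 21 ≤ ι (10 ℕ.* M) * γ) → _
    conclude (M , 11≤M , 21≤) = inv (suc L) , 0<inv (s≤s z≤n) , order-threshold M L , λ n n-large q ramsey G free α-small →
      *-cancelˡ (0<ι (ℕ.≤-trans 1≤M (ℕ.m≤m+n M _))) (begin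
        ι (10 ℕ.* M) * ι (edges G)                             ≡⟨ ι-* (10 ℕ.* M) (edges G) ⟨
        ι (10 ℕ.* M ℕ.* edges G)                               ≤⟨ ι-mono (ℕ.<⇒≤ (edge-bound 1≤M 11≤M C n-large ramsey G free (ι-cancel (scale (indepNumber G) q α-small)))) ⟩
        ι ((3 ℕ.* M ℕ.+ 21) ℕ.* (n ℕ.* n))                     ≡⟨ ι-* (3 ℕ.* M ℕ.+ 21) (n ℕ.* n) ⟩
        ι (3 ℕ.* M ℕ.+ 21) * ι (n ℕ.* n)                       ≤⟨ *-monoʳ (0≤ι (n ℕ.* n)) slack ⟩
        ι (10 ℕ.* M) * (ℤ.+ 3 ℚ./ 10 + γ) * ι (n ℕ.* n)        ≡⟨ *-assoc (ι (10 ℕ.* M)) (ℤ.+ 3 ℚ./ 10 + γ) (ι (n ℕ.* n)) ⟩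
        ι (10 ℕ.* M) * ((ℤ.+ 3 ℚ./ 10 + γ) * ι (n ℕ.* n))      ∎)
      where
      open ≤-Reasoning
      1≤M : 1 ℕ.≤ M
      1≤M = ℕ.≤-trans (s≤s z≤n) 11≤M
      C : Constants M 1≤M
      C = constants M 1≤M
      open Constants C using (L)
      scale : ∀ α q → ι α ≤ inv (suc L) * ι q → ι (suc L ℕ.* α) ≤ ι q
      scale α q le = ≤-trans (≤-reflexive (ι-* (suc L) α)) (≤-trans (*-monoˡ (0≤ι (suc L)) le)
        (≤-reflexive (trans (sym (*-assoc (ι (suc L)) (inv (suc L)) (ι q))) (trans (cong (_* ι q) (ι*inv (s≤s z≤n))) (*-identityˡ (ι q))))))
      three-tenths : ι (3 ℕ.* M) ≡ ι (10 ℕ.* M) * (ℤ.+ 3 ℚ./ 10)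
      three-tenths = sym (trans (cong (_* (ℤ.+ 3 ℚ./ 10)) (trans (cong ι (ℕ.*-comm 10 M)) (ι-* M 10))) (trans (*-assoc (ι M) (ι 10) (ℤ.+ 3 ℚ./ 10))
        (trans (cong (ι M *_) ten*three-tenths) (trans (sym (ι-* M 3)) (cong ι (ℕ.*-comm M 3))))))
      slack : ι (3 ℕ.* M ℕ.+ 21) ≤ ι (10 ℕ.* M) * (ℤ.+ 3 ℚ./ 10 + γ)
      slack = begin
        ι (3 ℕ.* M ℕ.+ 21)                                ≡⟨ ι-+ (3 ℕ.* M) 21 ⟩
        ι (3 ℕ.* M) + ι 21                                ≤⟨ +-mono-≤ (≤-reflexive three-tenths) 21≤ ⟩
        ι (10 ℕ.* M) * (ℤ.+ 3 ℚ./ 10) + ι (10 ℕ.* M) * γ  ≡⟨ *-distribˡ-+ (ι (10 ℕ.* M)) (ℤ.+ 3 ℚ./ 10) γ ⟨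
        ι (10 ℕ.* M) * (ℤ.+ 3 ℚ./ 10 + γ)                 ∎

  -- Passes from the opaque arithmetic back to the operations of `ℚ` in which the theorem is stated.
  standard-operations : ∀ {γ} →
    (Σ ℚ λ δ → 0ℚ < δ × Σ ℕ λ N → ∀ n → N ℕ.≤ n → ∀ q → IsInverseRamsey 3 n q → ∀ (G : Graph n) → KFree 9 G →
      ι (indepNumber G) ≤ δ * ι q → ι (edges G) ≤ (ℤ.+ 3 ℚ./ 10 + γ) * ι (n ℕ.* n)) →
    Σ ℚ λ δ → 0ℚ < δ × Σ ℕ λ N → ∀ n → n ℕ.≥ N → ∀ q → IsInverseRamsey 3 n q → ∀ (G : Graph n) → KFree 9 G →
      ℤ.+ indepNumber G ℚ./ 1 ≤ δ ℚ.* (ℤ.+ q ℚ./ 1) → ℤ.+ edges G ℚ./ 1 ≤ (ℤ.+ 3 ℚ./ 10 ℚ.+ γ) ℚ.* (ℤ.+ (n ℕ.* n) ℚ./ 1)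
  standard-operations {γ} (δ , 0<δ , N , bound) = δ , 0<δ , N , λ n n≥N q ramsey G free small →
    out (edges G) (n ℕ.* n) (bound n n≥N q ramsey G free (into (indepNumber G) q small))
    where
    into : ∀ a q → ℤ.+ a ℚ./ 1 ≤ δ ℚ.* (ℤ.+ q ℚ./ 1) → ι a ≤ δ * ι q
    into a q = subst₂ _≤_ {ℤ.+ a ℚ./ 1} {ι a} {δ ℚ.* (ℤ.+ q ℚ./ 1)} {δ * ι q} (ι≡ a) (trans (cong (δ ℚ.*_) (ι≡ q)) (sym (*≡ δ (ι q))))
    out : ∀ a s → ι a ≤ (ℤ.+ 3 ℚ./ 10 + γ) * ι s → ℤ.+ a ℚ./ 1 ≤ (ℤ.+ 3 ℚ./ 10 ℚ.+ γ) ℚ.* (ℤ.+ s ℚ./ 1)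
    out a s = subst₂ _≤_ {ι a} {ℤ.+ a ℚ./ 1} {(ℤ.+ 3 ℚ./ 10 + γ) * ι s} {(ℤ.+ 3 ℚ./ 10 ℚ.+ γ) ℚ.* (ℤ.+ s ℚ./ 1)} (sym (ι≡ a))
      (trans (*≡ (ℤ.+ 3 ℚ./ 10 + γ) (ι s)) (cong₂ ℚ._*_ (+≡ (ℤ.+ 3 ℚ./ 10) γ) (sym (ι≡ s))))

open import Defs
open import Data.Nat using (ℕ; _≥_; _*_)
open import Data.Integer using (+_)
open import Data.Rational using (ℚ; _/_; _≤_; _<_; _+_; 0ℚ)
open import Data.Product using (Σ; _×_)
open import Relation.Binary.PropositionalEquality using (_≡_)
open Density using (edge-density-bound; standard-operations)

theorem1p3 : ∀ (γ : ℚ) → 0ℚ < γ →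
    Σ ℚ λ δ → 0ℚ < δ × Σ ℕ λ N → ∀ (n : ℕ) → n ≥ N →
    ∀ (q : ℕ) → IsInverseRamsey 3 n q →
    ∀ (G : Graph n) → KFree 9 G →
    (+ indepNumber G / 1) ≤ δ Data.Rational.* (+ q / 1) →
    (+ edges G / 1) ≤ (+ 3 / 10 + γ) Data.Rational.* (+ (n * n) / 1)
theorem1p3 γ 0<γ = standard-operations (edge-density-bound γ 0<γ)
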